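{- Let $\sigma$ be a signature, let $r$ be the maximum arity of a relation symbol in $\sigma$, and let $k$ be an integer with $r\le k$. For every pair of $\sigma$-structures $\mathbf{A},\mathbf{B}$ the following are equivalent: (1) $\mathbf{A}\equiv_k\mathbf{B}$; (2) $\hom(\mathbf{X};\mathbf{A})=\hom(\mathbf{X};\mathbf{B})$ for every $\sigma$-structure $\mathbf{X}$ of treewidth $<k$; (3) $\mathbf{A}$ and $\mathbf{B}$ satisfy the same sentences of the logic $\mathscr{C}^k$.
   Context: A $\sigma$-structure $\mathbf{A}$ is a finite universe $A$ with non-empty relations $R^{\mathbf{A}}\subseteq A^{\operatorname{ar}(R)}$ for $R\in\sigma$. $\hom(\mathbf{X};\mathbf{A})$ is the number of homomorphisms from $\mathbf{X}$ to $\mathbf{A}$ (maps $h:X\to A$ with $h(\mathbf{x})\in R^{\mathbf{A}}$ for all $\mathbf{x}\in R^{\mathbf{X}}$). For a tuple $\mathbf{a}$, $\{\mathbf{a}\}$ is its set of entries; $\mathcal{C}_{\mathbf{A}}$ is the set of formal expressions $R(\mathbf{a})$ with $\mathbf{a}\in R^{\mathbf{A}}$. For $\mathbf{a}\in A^j$, $\mathbf{i}=(i_1,\dots,i_n)\in[j]^n$, $\pi_{\mathbf{i}}\mathbf{a}=(a_{i_1},\dots,a_{i_n})$. A tree-decomposition of $\mathbf{X}$ is a pair $(G,\beta)$ with $G$ a tree and $\beta$ mapping nodes of $G$ to subsets of $X$ such that every $R(\mathbf{x})\in\mathcal{C}_{\mathbf{X}}$ has a node $v$ with $\{\mathbf{x}\}\subseteq\beta(v)$,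 and for each $x\in X$ the nodes $v$ with $x\in\beta(v)$ form a connected subtree; its width is $\max_v|\beta(v)|-1$, and the treewidth of $\mathbf{X}$ is the minimum width over its tree-decompositions. $\mathscr{C}^k$ is the $k$-variable fragment of first-order logic over $\sigma$ enriched with counting quantifiers $\exists^{n}x$ ("there exist at least $n$ elements $x$ such that"). $\equiv_1$: the factor graph of $\mathbf{B}$ is the bipartite graph on $B\cup\mathcal{C}_{\mathbf{B}}$ with edges $\{b,R(\mathbf{b})\}$ for $b\in\{\mathbf{b}\}$, labelled $(S,R)$ with $S=\{i:b_i=b\}$; $\delta_0(v)$ is one fixed symbol for elements and another for constraints; $\delta_j(v)=\{\{(\text{label of }\{v,w\},\delta_{j-1}(w)):w\text{ adjacent to }v\}\}$; $\delta(v)=(\delta_j(v))_{j\ge0}$; $\mathbf{B}\equiv_1\mathbf{B}'$ iff the multisets of iterated degrees of all vertices of the factor graphs coincide. $\mathbf{A}^{*_k}$ has universe $\bigcup_{1\le j\le k}A^j\cup\mathcal{C}_{\mathbf{A}}$ and relations: unary $T_{j,S}=\{\mathbf{a}\in A^j:a_i=a_{i'}\ \forall i,i'\in S\}$ ($j\le k$, $S\subseteq[j]$); binary $T_{j,\mathbf{i}}=\{(\mathbf{a},\pi_{\mathbf{i}}\mathbf{a}):\mathbf{a}\in A^j\}$ ($j,j'\le k$, $\mathbf{i}\in[j]^{j'}$); unary $R_S=\{R(\mathbf{a}):\mathbf{a}\in R^{\mathbf{A}},a_i=a_{i'}\ \forall i,i'\in S\}$ ($R\in\sigma$, $S\subseteq[\operatorname{ar}(R)]$);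 binary $R_{\mathbf{i}}=\{(R(\mathbf{a}),\pi_{\mathbf{i}}\mathbf{a}):\mathbf{a}\in R^{\mathbf{A}}\}$ ($R\in\sigma$, $j\le k$, $\mathbf{i}\in[\operatorname{ar}(R)]^j$). For $k>1$, $\mathbf{A}\equiv_k\mathbf{B}$ means $\mathbf{A}^{*_k}\equiv_1\mathbf{B}^{*_k}$; for $k=1$, $\equiv_k$ is $\equiv_1$. -}

module Defs where

open import Data.Nat using (ℕ; zero; suc; _≤_; _<_; _∸_; _⊔_)
open import Data.Fin using (Fin; toℕ) renaming (zero to fz; suc to fs)
import Data.Fin.Properties as FinP
open import Data.Fin.Subset using (Subset; _∈_; ∣_∣)
open import Data.Vec using (Vec; []; _∷_; lookup)
import Data.Vec as Vec
import Data.Vec.Properties as VecP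
open import Data.List using (List; []; _∷_; length; filter; allFin; concatMap; foldr)
import Data.List as List
open import Data.Bool using (Bool; true; false; T; not; _∧_; _∨_; if_then_else_)
open import Data.Bool.Properties using (T-irrelevant)
open import Data.Product using (Σ; _×_; _,_; proj₁; proj₂; ∃)
import Data.Product.Properties as ProdP
open import Data.Sum using (_⊎_; inj₁; inj₂)
import Data.Sum.Properties as SumP
open import Data.Maybe using (Maybe; just; nothing)
open import Relation.Binary.PropositionalEquality using (_≡_; refl)
open import Relation.Binary.Definitions using (DecidableEquality)
open import Relation.Nullary using (yes; no; does)
open import Relation.Nullary.Decidable using (⌊_⌋)
open import Function.Bundles using (_↔_; Inverse)

record Signature : Set where
  field
    nsym : ℕ
    ar   : Fin nsym → ℕ
open Signature public

maxArity : Signature → ℕ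
maxArity σ = foldr (λ R m → ar σ R ⊔ m) 0 (allFin (nsym σ))

record Structure (σ : Signature) : Set where
  field
    size     : ℕ
    rel      : (R : Fin (nsym σ)) → Vec (Fin size) (ar σ R) → Bool
    nonempty : (R : Fin (nsym σ)) → ∃ λ (t : Vec (Fin size) (ar σ R)) → T (rel R t)
open Structure public

all : {X : Set} → (X → Bool) → List X → Bool
all p xs = foldr (λ x r → p x ∧ r) true xs

allVecs : (m n : ℕ) → List (Vec (Fin n) m)
allVecs zero    n = [] ∷ []
allVecs (suc m) n = concatMap (λ i → List.map (i ∷_) (allVecs m n)) (allFin n)

isHom : {σ : Signature} (X A : Structure σ) → Vec (Fin (size A)) (size X) → Bool
isHom {σ} X A h =
  all (λ R → all (λ t → not (rel X R t) ∨ rel A R (Vec.map (lookup h) t))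
                 (allVecs (ar σ R) (size X)))
      (allFin (nsym σ))

hom : {σ : Signature} (X A : Structure σ) → ℕ
hom X A = length (filter (λ h → T? (isHom X A h)) (allVecs (size X) (size A)))
  where
  open import Data.Bool.Properties using (T?)

-- A finite tree on the nodes Fin (suc N): node (fs i) is joined to its
-- parent, which is some node among fz … i (a recursive labelling of the
-- tree; every finite tree arises this way).
record Tree : Set where
  field
    N      : ℕ
    parent : (i : Fin N) → Fin (suc (toℕ i))
open Tree public

Node : Tree → Set
Node G = Fin (suc (N G))

Adj : (G : Tree) → Node G → Node G → Set
Adj G u v = (Σ (Fin (N G)) λ i → (u ≡ fs i) × (toℕ v ≡ toℕ (parent G i)))
          ⊎ (Σ (Fin (N G)) λ i → (v ≡ fs i) × (toℕ u ≡ toℕ (parent G i)))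

data Walk (G : Tree) (P : Node G → Set) : Node G → Node G → Set where
  stop : ∀ {u} → P u → Walk G P u u
  step : ∀ {u v w} → P u → Adj G u v → Walk G P v w → Walk G P u w

record TreeDecomposition {σ : Signature} (X : Structure σ) : Set where
  field
    tree  : Tree
    bag   : Node tree → Subset (size X)
    covers    : (R : Fin (nsym σ)) (t : Vec (Fin (size X)) (ar σ R)) → T (rel X R t) →
                Σ (Node tree) λ v → (i : Fin (ar σ R)) → lookup t i ∈ bag v
    connected : (x : Fin (size X)) (u v : Node tree) → x ∈ bag u → x ∈ bag v →
                Walk tree (λ w → x ∈ bag w) u v
open TreeDecomposition public

-- width = max_v |β(v)| - 1   (truncated subtraction: -1 is read as 0)
width : {σ : Signature} {X : Structure σ} → TreeDecomposition X → ℕ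
width D = foldr (λ v m → ∣ bag D v ∣ ⊔ m) 0 (allFin (suc (N (tree D)))) ∸ 1

TreewidthLess : {σ : Signature} → Structure σ → ℕ → Set
TreewidthLess X k = Σ (TreeDecomposition X) λ D → width D < k

data Formula (σ : Signature) (k : ℕ) : Set where
  atom  : (R : Fin (nsym σ)) → Vec (Fin k) (ar σ R) → Formula σ k
  equal : Fin k → Fin k → Formula σ k
  neg   : Formula σ k → Formula σ k
  conj  : Formula σ k → Formula σ k → Formula σ k
  disj  : Formula σ k → Formula σ k → Formula σ k
  ∃≥    : ℕ → Fin k → Formula σ k → Formula σ k

scoped : {σ : Signature} {k : ℕ} → (Fin k → Bool) → Formula σ k → Bool
scoped b (atom R xs)   = Vec.foldr _ (λ x r → b x ∧ r) true xs
scoped b (equal x y)   = b x ∧ b y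
scoped b (neg φ)       = scoped b φ
scoped b (conj φ ψ)    = scoped b φ ∧ scoped b ψ
scoped b (disj φ ψ)    = scoped b φ ∧ scoped b ψ
scoped b (∃≥ n x φ)    = scoped (λ y → ⌊ y FinP.≟ x ⌋ ∨ b y) φ

Sentence : {σ : Signature} {k : ℕ} → Formula σ k → Set
Sentence φ = T (scoped (λ _ → false) φ)

-- semantics under a partial assignment (unassigned variables make atoms false;
-- irrelevant for sentences)
module _ {σ : Signature} {k : ℕ} (A : Structure σ) where
  Assignment : Set
  Assignment = Fin k → Maybe (Fin (size A))

  private
    lookupAll : {m : ℕ} → Assignment → Vec (Fin k) m → Maybe (Vec (Fin (size A)) m)
    lookupAll ρ [] = just []
    lookupAll ρ (x ∷ xs) with ρ x | lookupAll ρ xs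
    ... | just a  | just as = just (a ∷ as)
    ... | _       | _       = nothing

    update : Assignment → Fin k → Fin (size A) → Assignment
    update ρ x a y = if ⌊ y FinP.≟ x ⌋ then just a else ρ y

  eval : Formula σ k → Assignment → Bool
  eval (atom R xs) ρ with lookupAll ρ xs
  ... | just as = rel A R as
  ... | nothing = false
  eval (equal x y) ρ with ρ x | ρ y
  ... | just a | just b = ⌊ a FinP.≟ b ⌋
  ... | _      | _      = false
  eval (neg φ) ρ    = not (eval φ ρ)
  eval (conj φ ψ) ρ = eval φ ρ ∧ eval ψ ρ
  eval (disj φ ψ) ρ = eval φ ρ ∨ eval ψ ρ
  eval (∃≥ n x φ) ρ =
    ⌊ n Data.Nat.≤? length (filter (λ a → T? (eval φ (update ρ x a))) (allFin (size A))) ⌋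
    where open import Data.Bool.Properties using (T?)
          import Data.Nat

  _⊨_ : Formula σ k → Set
  _⊨_ φ = T (eval φ (λ _ → nothing))

SameCk : {σ : Signature} (k : ℕ) (A B : Structure σ) → Set
SameCk {σ} k A B = (φ : Formula σ k) → Sentence φ → (A ⊨ φ → B ⊨ φ) × (B ⊨ φ → A ⊨ φ)

record GSig : Set₁ where
  field
    Sym   : Set
    arity : Sym → ℕ
open GSig public

record GStr (τ : GSig) : Set₁ where
  field
    U    : Set
    _≟U_ : DecidableEquality U
    grel : (R : Sym τ) → Vec U (arity τ R) → Bool
open GStr public

module _ {τ : GSig} (B : GStr τ) where
  Con : Set
  Con = Σ (Sym τ) λ R → Σ (Vec (U B) (arity τ R)) λ t → T (grel B R t)

  occurs : {m : ℕ} → U B → Vec (U B) m → Bool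
  occurs b []       = false
  occurs b (x ∷ xs) = ⌊ _≟U_ B x b ⌋ ∨ occurs b xs

  positions : {m : ℕ} → U B → Vec (U B) m → Vec Bool m
  positions b t = Vec.map (λ x → ⌊ _≟U_ B x b ⌋) t

  Vertex : Set
  Vertex = U B ⊎ Con

  isElement : Vertex → Bool
  isElement (inj₁ _) = true
  isElement (inj₂ _) = false

  Nbr : Vertex → Set
  Nbr (inj₁ b) = Σ Con λ c → T (occurs b (proj₁ (proj₂ c)))
  Nbr (inj₂ c) = Σ (U B) λ b → T (occurs b (proj₁ (proj₂ c)))

  target : (v : Vertex) → Nbr v → Vertex
  target (inj₁ b) (c , _) = inj₂ c
  target (inj₂ c) (b , _) = inj₁ b

Label : GSig → Set
Label τ = Σ (Sym τ) λ R → Vec Bool (arity τ R)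

label : {τ : GSig} (B : GStr τ) (v : Vertex B) → Nbr B v → Label τ
label B (inj₁ b) (c , _) = proj₁ c , positions B b (proj₁ (proj₂ c))
label B (inj₂ c) (b , _) = proj₁ c , positions B b (proj₁ (proj₂ c))

-- SameDeg j v w  ⟺  δ_j(v) = δ_j(w)  (v, w vertices of two factor graphs);
-- equality of multisets is witnessed by a bijection of the underlying index sets
SameDeg : {τ : GSig} (B B' : GStr τ) → ℕ → Vertex B → Vertex B' → Set
SameDeg B B' zero    v w = isElement B v ≡ isElement B' w
SameDeg B B' (suc j) v w =
  Σ (Nbr B v ↔ Nbr B' w) λ f → (e : Nbr B v) →
    (label B v e ≡ label B' w (Inverse.to f e)) ×
    SameDeg B B' j (target B v e) (target B' w (Inverse.to f e))

-- B ≡₁ B' : the multisets {{δ(v)}} of iterated degrees coincide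
_≡₁_ : {τ : GSig} → GStr τ → GStr τ → Set
B ≡₁ B' = Σ (Vertex B ↔ Vertex B') λ f →
  (v : Vertex B) (j : ℕ) → SameDeg B B' j v (Inverse.to f v)

toGSig : Signature → GSig
toGSig σ = record { Sym = Fin (nsym σ) ; arity = ar σ }

toGStr : {σ : Signature} → Structure σ → GStr (toGSig σ)
toGStr A = record { U = Fin (size A) ; _≟U_ = FinP._≟_ ; grel = rel A }

-- tuple lengths j ∈ {1,…,k} are encoded by j' : Fin k with j = suc (toℕ j')
len : {k : ℕ} → Fin k → ℕ
len j = suc (toℕ j)

data StarSym (σ : Signature) (k : ℕ) : Set where
  T-S : (j : Fin k) → Subset (len j) → StarSym σ k
  T-i : (j j' : Fin k) → Vec (Fin (len j)) (len j') → StarSym σ k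
  R-S : (R : Fin (nsym σ)) → Subset (ar σ R) → StarSym σ k
  R-i : (R : Fin (nsym σ)) (j : Fin k) → Vec (Fin (ar σ R)) (len j) → StarSym σ k

starArity : {σ : Signature} {k : ℕ} → StarSym σ k → ℕ
starArity (T-S _ _)   = 1
starArity (T-i _ _ _) = 2
starArity (R-S _ _)   = 1
starArity (R-i _ _ _) = 2

StarSig : Signature → ℕ → GSig
StarSig σ k = record { Sym = StarSym σ k ; arity = starArity }

module _ {σ : Signature} (k : ℕ) (A : Structure σ) where
  Tuples : Set
  Tuples = Σ (Fin k) λ j → Vec (Fin (size A)) (len j)

  StarU : Set
  StarU = Tuples ⊎ Con (toGStr A)

  private
    decT : ∀ {b} → DecidableEquality (T b)
    decT x y = yes (T-irrelevant x y)

    decCon : DecidableEquality (Con (toGStr A))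
    decCon = ProdP.≡-dec FinP._≟_ (ProdP.≡-dec (VecP.≡-dec FinP._≟_) decT)

  starDec : DecidableEquality StarU
  starDec = SumP.≡-dec (ProdP.≡-dec FinP._≟_ (VecP.≡-dec FinP._≟_)) decCon

  constOn : {m : ℕ} → Subset m → Vec (Fin (size A)) m → Bool
  constOn {m} S a = all (λ i → all (λ i' →
      not (lookup S i ∧ lookup S i') ∨ ⌊ lookup a i FinP.≟ lookup a i' ⌋)
      (allFin m)) (allFin m)

  isProj : {m l : ℕ} → Vec (Fin m) l → Vec (Fin (size A)) m → Vec (Fin (size A)) l → Bool
  isProj idx a b = ⌊ VecP.≡-dec FinP._≟_ b (Vec.map (lookup a) idx) ⌋

  starRel : (R : StarSym σ k) → Vec StarU (starArity R) → Bool
  starRel (T-S j S) (inj₁ (j₁ , a) ∷ []) with j FinP.≟ j₁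
  ... | yes refl = constOn S a
  ... | no _     = false
  starRel (T-S j S) (inj₂ _ ∷ []) = false
  starRel (T-i j j' idx) (inj₁ (j₁ , a) ∷ inj₁ (j₂ , b) ∷ []) with j FinP.≟ j₁ | j' FinP.≟ j₂
  ... | yes refl | yes refl = isProj idx a b
  ... | _        | _        = false
  starRel (T-i j j' idx) (_ ∷ _ ∷ []) = false
  starRel (R-S R S) (inj₂ (R₁ , t , _) ∷ []) with R FinP.≟ R₁
  ... | yes refl = constOn S t
  ... | no _     = false
  starRel (R-S R S) (inj₁ _ ∷ []) = false
  starRel (R-i R j idx) (inj₂ (R₁ , t , _) ∷ inj₁ (j₂ , b) ∷ []) with R FinP.≟ R₁ | j FinP.≟ j₂
  ... | yes refl | yes refl = isProj idx t b
  ... | _        | _        = false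
  starRel (R-i R j idx) (_ ∷ _ ∷ []) = false

  star : GStr (StarSig σ k)
  star = record { U = StarU ; _≟U_ = starDec ; grel = starRel }

≡[_] : {σ : Signature} → ℕ → Structure σ → Structure σ → Set
≡[ 1 ] A B = toGStr A ≡₁ toGStr B
≡[ k ] A B = star k A ≡₁ star k B

{-# OPTIONS --safe #-}
module Submission where

-- All three conditions are compared with a colouring of the tuples of length at most k over
-- A and over B that is stable under the bijective k-pebble game: equally coloured tuples have
-- the same atomic type, and each can be extended by a bijection A → B that preserves colours.
-- Such a colouring is reached by refinement, where a colour consists of the values of finitely
-- many tests (formulas with at most k variables in scope, valued in ℕ). If a position violates
-- stability, some test with one more quantifier splits it: were the numbers of extensions with
-- given test values to differ, then so would some moment of the test values, that is, the sum
-- of a product of tests. Interpreting quantifiers as sums, closed tests are the homomorphism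
-- counts from structures of treewidth < k; interpreting them as counting thresholds they are
-- sentences of C^k. Hence (2) and (3) each yield a stable colouring, which in turn gives (2),
-- by summing over the bags of a tree-decomposition in a running-intersection order, and (1),
-- by matching the neighbours in the factor graphs. Finally, iterated degrees are strategies
-- for boundedly many rounds of the game, which suffices for (3).

open import Defs
open import Data.Nat
open import Data.Nat.Properties
open import Data.Nat.Induction using (<-wellFounded; Acc; acc)
open import Data.Fin as Fin using (Fin; zero; suc; toℕ; fromℕ<; _↑ˡ_; _↑ʳ_; splitAt; combine; remQuot; punchIn; punchOut)
import Data.Fin.Properties as FinP
open import Data.Fin.Permutation as Perm using (Permutation; _⟨$⟩ʳ_; _⟨$⟩ˡ_; insert; insert-punchIn; inverseʳ)
open import Data.Fin.Subset as Subset using (Subset; ∣_∣; inside; outside; ⁅_⁆; _∪_)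
import Data.Fin.Subset.Properties as SubsetP
open import Data.Bool as Bool using (Bool; true; false; T; not; _∧_; _∨_; if_then_else_)
import Data.Bool.Properties as BoolP
open BoolP using (T?)
open import Data.Maybe as Maybe using (Maybe; just; nothing; maybe; fromMaybe)
import Data.Maybe.Properties as MaybeP
open import Data.Vec as Vec using (Vec; []; _∷_; lookup; _[_]≔_; fromList; take; drop; head; tail)
import Data.Vec.Properties as VecP
open import Data.List as List using (List; []; _∷_; length; filter; concat; concatMap; cartesianProduct; upTo; allFin; _++_; _ʳ++_)
import Data.List.Properties as ListP
open import Data.List.Relation.Unary.All as All using (All; []; _∷_)
import Data.List.Relation.Unary.All.Properties as AllP
open import Data.List.Relation.Unary.AllPairs using ([]; _∷_)
open import Data.List.Relation.Unary.Any as Any using (Any; here; there)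
open import Data.List.Relation.Unary.Any.Properties using (reverse⁺)
open import Data.List.Relation.Unary.Unique.Propositional using (Unique)
import Data.List.Relation.Unary.Unique.Propositional.Properties as UniqueP
open import Data.List.Membership.Propositional using (_∈_; _∉_; find; lose)
open import Data.List.Membership.Propositional.Properties
open import Data.Product
import Data.Product.Properties as ProdP
open import Data.Product.Properties.WithK using (,-injectiveʳ)
open import Data.Sum using (_⊎_; inj₁; inj₂; [_,_]′)
import Data.Sum.Properties as SumP
open import Data.Empty using (⊥-elim)
open import Data.Unit using (⊤; tt)
open import Relation.Nullary using (¬_; Dec; yes; no; ¬?)
open import Relation.Nullary.Decidable using (⌊_⌋)
open import Relation.Binary.Definitions using (DecidableEquality; tri<; tri≈; tri>)
open import Relation.Binary.PropositionalEquality hiding ([_])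
open import Function using (_∘_; id; case_of_)
open import Function.Bundles
open import Function.Construct.Composition using (_↔-∘_)
open import Function.Construct.Symmetry using (↔-sym)
open import Tactic.Cong using (cong!)
import Algebra.Properties.CommutativeMonoid.Sum +-0-commutativeMonoid as CM
import Algebra.Properties.Semiring.Sum +-*-semiring as SR

-- Homomorphism tests cannot compare elements for equality, whereas a stable colouring has to know
-- which entries of a tuple coincide. Colours therefore carry the equality pattern as a component of
-- its own, and extensions are counted separately for each pattern: extending by an entry already
-- present amounts to relabelling the shorter tuple, and the sum over new elements is the sum over
-- the whole universe minus those finitely many terms. Iterated degrees provide a matching of
-- neighbours for each depth, with no matching common to all depths. So (1) yields a game with a
-- counter of rounds instead of a colouring; a formula uses up boundedly many of them, and (2) is
-- reached from (1) through (3). Towards (1), a tuple is also the projection of longer or rearranged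
-- tuples. Its neighbours are then whole fibres of projections, and these have to be matched colour
-- by colour. For k = 1 the equivalence is defined on the factor graph of the structures themselves,
-- so this case has its own argument in both directions.

-- The lookup of variables in atoms

-- Evaluating an atom calls a private function of Defs that looks up a tuple of variables.
-- To reason about it for tuples of unknown length it is recovered by unification. First, on
-- the tuple x ∷ [], the type of b₁ keeps the unevaluated lookup whereas the with-abstraction
-- evaluates it in the type of b₂, so that cong! abstracts precisely this subterm and yields
-- the function applied to the result of the lookup.
data Box {V : Set} (v : V) : Set where
  box : Box v

box-≡ : {a b : Bool} → Box a → Box b → a ≡ b → a ≡ b
box-≡ _ _ p = p

data CongOf {V : Set} : {a b : Bool} → a ≡ b → Set where
  congOf : (F : V → Bool) {y y' : V} (e : y ≡ y') → CongOf (cong F e)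

congOf-function : ∀ {V a b} {e : a ≡ b} → CongOf {V} e → V → Bool
congOf-function (congOf F _) = F

AbstractedLookup : ∀ n m k (A : Structure (record { nsym = n ; ar = λ _ → m })) (R : Fin n) (xs : Vec (Fin k) m)
  (ρ : Fin k → Maybe (Fin (size A))) (a : Fin (size A)) → ρ ≡ (λ _ → just a) →
  ({y : Maybe (Vec (Fin (size A)) m)} → y ≡ y) → Box (eval A (atom R xs) ρ) → Box (eval A (atom R xs) ρ) → Set
AbstractedLookup n m k A R xs ρ a e r b₁ b₂ with tt
AbstractedLookup n zero k A R [] ρ a e r b₁ b₂ | _ = ⊤
AbstractedLookup n (suc m) k A R (x ∷ xs) ρ a e r b₁ b₂ | _ with b₁
AbstractedLookup n (suc zero) k A R (x ∷ []) ρ a refl r b₁ b₂ | _ | _ =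
  CongOf {Maybe (Vec (Fin (size A)) 1)} (box-≡ b₁ b₂ (cong! (r {just (a ∷ [])})))
AbstractedLookup n (suc (suc _)) k A R (x ∷ _ ∷ xs) ρ a e r b₁ b₂ | _ | _ = ⊤

abstractedLookup : ∀ n k (A : Structure (record { nsym = n ; ar = λ _ → 1 })) (R : Fin n) x a
  (r : {y : Maybe (Vec (Fin (size A)) 1)} → y ≡ y) → AbstractedLookup n 1 k A R (x ∷ []) (λ _ → just a) a refl r box box
abstractedLookup n k A R x a r = congOf _ r

data Fn (V : Set) : Set where
  fn : (V → Bool) → Fn V

unfn : ∀ {V} → Fn V → V → Bool
unfn (fn f) = f

singleton : ∀ {k} → Fin k → Vec (Fin k) 1
singleton x = x ∷ []

-- Second, the length 1 and the tuple are generalised by a with-abstraction.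
mutual
  afterLookup : ∀ n m k (A : Structure (record { nsym = n ; ar = λ _ → m })) (R : Fin n) (xs : Vec (Fin k) m)
    (ρ : Fin k → Maybe (Fin (size A))) → Fn (Maybe (Vec (Fin (size A)) m))
  afterLookup = _

  solve-afterLookup : ∀ n k (A : Structure (record { nsym = n ; ar = λ _ → 1 })) (R : Fin n) (x : Fin k) (a : Fin (size A)) →
    Box (fn (congOf-function (abstractedLookup n k A R x a refl))) → ⊤
  solve-afterLookup n k A R x a b with 1 | A | singleton x | (λ (_ : Fin k) → just a)
  ... | m | A′ | xs | ρ = unify b
    where
    unify : Box (afterLookup n m k A′ R xs ρ) → ⊤
    unify _ = tt

-- Third, abstracting afterLookup by a variable h leaves h applied to the lookup, whose
-- signature and length can now be generalised independently of each other.
mutual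
  lookupTuple : ∀ n (g : Fin n → ℕ) k (A : Structure (record { nsym = n ; ar = g })) m →
    (Fin k → Maybe (Fin (size A))) → Vec (Fin k) m → Maybe (Vec (Fin (size A)) m)
  lookupTuple = _

  solve-lookupTuple : ∀ n (f : ℕ → ℕ) u k (A : Structure (record { nsym = n ; ar = λ _ → f u })) (R : Fin n) (xs : Vec (Fin k) (f u))
    (ρ : Fin k → Maybe (Fin (size A))) → Box (eval A (atom R xs) ρ) → ⊤
  solve-lookupTuple n f u k A R xs ρ b with unfn (afterLookup n (f u) k A R xs ρ)
  ... | h with (λ (_ : Fin n) → f u) | A
  ... | g | A′ with f u | xs
  ... | m | xs′ = unify b
    where
    unify : Box (h (lookupTuple n g k A′ m ρ xs′)) → ⊤
    unify _ = tt

lookupAll : ∀ {σ k} (A : Structure σ) {m} → (Fin k → Maybe (Fin (size A))) → Vec (Fin k) m → Maybe (Vec (Fin (size A)) m)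
lookupAll {σ} {k} A {m} = lookupTuple (nsym σ) (ar σ) k A m

-- Later evaluations of atoms go through this equation. The outcome `y` is a separate argument so
-- that any proven value of the lookup can be supplied.
eval-lookupAll : ∀ {σ k} (A : Structure σ) R (xs : Vec (Fin k) (ar σ R)) ρ y → lookupAll A ρ xs ≡ y →
  eval A (atom R xs) ρ ≡ maybe (rel A R) false y
eval-lookupAll A R xs ρ y e with lookupAll A ρ xs
eval-lookupAll A R xs ρ y refl | just _ = refl
eval-lookupAll A R xs ρ y refl | nothing = refl

lookupAll-just : ∀ {σ k} (A : Structure σ) {m} (ρ : Fin k → Maybe (Fin (size A))) (xs : Vec (Fin k) m) as →
  (∀ i → ρ (lookup xs i) ≡ just (lookup as i)) → lookupAll A ρ xs ≡ just as
lookupAll-just A ρ [] [] p = refl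
lookupAll-just A ρ (x ∷ xs) (a ∷ as) p rewrite p zero | lookupAll-just A ρ xs as (p ∘ suc) = refl

-- Finite sums

[_] : Bool → ℕ
[ true ] = 1
[ false ] = 0

[∧] : ∀ a b → [ a ∧ b ] ≡ [ a ] * [ b ]
[∧] true b = sym (+-identityʳ _)
[∧] false b = refl

-- The library's sum is a fold that unfolds too eagerly for unification; this one does not.
sum : ∀ {n} → (Fin n → ℕ) → ℕ
sum {zero} f = 0
sum {suc n} f = f zero + sum (λ i → f (suc i))

sum-fold : ∀ {n} (f : Fin n → ℕ) → sum f ≡ CM.sum f
sum-fold {zero} f = refl
sum-fold {suc n} f = cong (f zero +_) (sum-fold (f ∘ suc))

sum-cong-≗ : ∀ {n} {f g : Fin n → ℕ} → (∀ i → f i ≡ g i) → sum f ≡ sum g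
sum-cong-≗ {zero} p = refl
sum-cong-≗ {suc n} p = cong₂ _+_ (p zero) (sum-cong-≗ (p ∘ suc))

∑-distrib-+ : ∀ {n} (f g : Fin n → ℕ) → sum (λ i → f i + g i) ≡ sum f + sum g
∑-distrib-+ {n} f g = trans (sum-fold (λ i → f i + g i))
  (trans (CM.∑-distrib-+ {n} f g) (sym (cong₂ _+_ (sum-fold f) (sum-fold g))))

*-distribˡ-sum : ∀ {n} x (f : Fin n → ℕ) → x * sum f ≡ sum (λ i → x * f i)
*-distribˡ-sum {n} x f = trans (cong (x *_) (sum-fold f))
  (trans (SR.*-distribˡ-sum {n} x f) (sym (sum-fold (λ i → x * f i))))

*-distribʳ-sum : ∀ {n} x (f : Fin n → ℕ) → sum f * x ≡ sum (λ i → f i * x)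
*-distribʳ-sum {n} x f = trans (cong (_* x) (sum-fold f))
  (trans (SR.*-distribʳ-sum {n} x f) (sym (sum-fold (λ i → f i * x))))

∑-comm : ∀ {m n} (f : Fin m → Fin n → ℕ) → sum (λ i → sum (f i)) ≡ sum (λ j → sum (λ i → f i j))
∑-comm {m} {n} f =
  trans (trans (sum-cong-≗ (λ i → sum-fold (f i))) (sum-fold (λ i → CM.sum (f i))))
  (trans (CM.∑-comm {m} {n} f)
  (sym (trans (sum-cong-≗ (λ j → sum-fold (λ i → f i j))) (sum-fold (λ j → CM.sum (λ i → f i j))))))

sum-remove : ∀ {n} (i : Fin (suc n)) (f : Fin (suc n) → ℕ) → sum f ≡ f i + sum (λ j → f (punchIn i j))
sum-remove {n} i f = trans (sum-fold f)
  (trans (CM.sum-remove {n} {i} f) (cong (f i +_) (sym (sum-fold (λ j → f (punchIn i j))))))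

sum-permute : ∀ {m n} (f : Fin n → ℕ) (π : Permutation m n) → sum f ≡ sum (λ i → f (π ⟨$⟩ʳ i))
sum-permute {m} {n} f π = trans (sum-fold f)
  (trans (CM.sum-permute {m} {n} f π) (sym (sum-fold (λ i → f (π ⟨$⟩ʳ i)))))

sum-zero : ∀ {n} (f : Fin n → ℕ) → (∀ i → f i ≡ 0) → sum f ≡ 0
sum-zero {zero} f p = refl
sum-zero {suc n} f p = cong₂ _+_ (p zero) (sum-zero (f ∘ suc) (p ∘ suc))

sum-δ : ∀ {n} (j : Fin n) (f : Fin n → ℕ) → sum (λ i → [ ⌊ i FinP.≟ j ⌋ ] * f i) ≡ f j
sum-δ zero f = trans (cong₂ _+_ (*-identityˡ (f zero)) (sum-zero {_} (λ i → 0 * f (suc i)) (λ i → refl))) (+-identityʳ _)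
sum-δ (suc j) f = trans (sum-cong-≗ lem) (sum-δ j (f ∘ suc))
  where
  lem : ∀ i → [ ⌊ suc i FinP.≟ suc j ⌋ ] * f (suc i) ≡ [ ⌊ i FinP.≟ j ⌋ ] * f (suc i)
  lem i with i FinP.≟ j
  ... | yes p = refl
  ... | no p = refl

ΣV : ∀ {n} m → (Vec (Fin n) m → ℕ) → ℕ
ΣV zero F = F []
ΣV (suc m) F = sum (λ c → ΣV m (λ v → F (c ∷ v)))

ΣV-cong : ∀ {n} m {F G : Vec (Fin n) m → ℕ} → (∀ v → F v ≡ G v) → ΣV m F ≡ ΣV m G
ΣV-cong zero p = p []
ΣV-cong (suc m) p = sum-cong-≗ (λ c → ΣV-cong m (λ v → p (c ∷ v)))

ΣV-sum : ∀ {n p} m (F : Vec (Fin n) m → Fin p → ℕ) → ΣV m (λ v → sum (F v)) ≡ sum (λ i → ΣV m (λ v → F v i))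
ΣV-sum zero F = refl
ΣV-sum (suc m) F = trans (sum-cong-≗ (λ c → ΣV-sum m (λ v → F (c ∷ v)))) (∑-comm (λ c i → ΣV m (λ v → F (c ∷ v) i)))

ΣV-*ˡ : ∀ {n} m x (F : Vec (Fin n) m → ℕ) → x * ΣV m F ≡ ΣV m (λ v → x * F v)
ΣV-*ˡ zero x F = refl
ΣV-*ˡ {n} (suc m) x F = trans (*-distribˡ-sum {n} x _) (sum-cong-≗ (λ c → ΣV-*ˡ m x (λ v → F (c ∷ v))))

ΣV-+ : ∀ {n} m (F G : Vec (Fin n) m → ℕ) → ΣV m (λ v → F v + G v) ≡ ΣV m F + ΣV m G
ΣV-+ zero F G = refl
ΣV-+ {n} (suc m) F G = trans (sum-cong-≗ (λ c → ΣV-+ m (λ v → F (c ∷ v)) (λ v → G (c ∷ v)))) (∑-distrib-+ {n} _ _)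

-- Distributivity over two disjoint blocks of variables; it brings a product of tests into prenex
-- form.
ΣV-take-drop : ∀ {n} l m (F : Vec (Fin n) l → ℕ) (G : Vec (Fin n) m → ℕ) →
               ΣV (l + m) (λ v → F (Vec.take l v) * G (Vec.drop l v)) ≡ ΣV l F * ΣV m G
ΣV-take-drop zero m F G = sym (ΣV-*ˡ m (F []) G)
ΣV-take-drop {n} (suc l) m F G =
  trans (sum-cong-≗ (λ c → ΣV-take-drop l m (λ v → F (c ∷ v)) G)) (sym (*-distribʳ-sum {n} (ΣV m G) _))

length-filter-T : ∀ {X : Set} (p : X → Bool) (xs ys : List X) →
  length (filter (λ x → T? (p x)) (xs ++ ys)) ≡ length (filter (λ x → T? (p x)) xs) + length (filter (λ x → T? (p x)) ys)
length-filter-T p xs ys = trans (cong length (ListP.filter-++ (λ x → T? (p x)) xs ys)) (ListP.length-++ (filter (λ x → T? (p x)) xs))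

length-filter-map : ∀ {X Y : Set} (p : Y → Bool) (f : X → Y) (xs : List X) →
  length (filter (λ y → T? (p y)) (List.map f xs)) ≡ length (filter (λ x → T? (p (f x))) xs)
length-filter-map p f [] = refl
length-filter-map p f (x ∷ xs) with p (f x)
... | true = cong suc (length-filter-map p f xs)
... | false = length-filter-map p f xs

length-filter-concatMap : ∀ {X : Set} {n} (p : X → Bool) (f : Fin n → List X) →
  length (filter (λ x → T? (p x)) (concatMap f (allFin n))) ≡ sum (λ i → length (filter (λ x → T? (p x)) (f i)))
length-filter-concatMap {n = n} p f = go n f id
  where
  go : ∀ m {j} (f : Fin j → List _) (e : Fin m → Fin j) →
     length (filter (λ x → T? (p x)) (concatMap f (List.tabulate e))) ≡ sum (λ i → length (filter (λ x → T? (p x)) (f (e i))))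
  go zero f e = refl
  go (suc m) f e = trans (length-filter-T p (f (e zero)) _) (cong (length (filter (λ x → T? (p x)) (f (e zero))) +_) (go m f (e ∘ suc)))

length-filter-allFin : ∀ {n} (p : Fin n → Bool) → length (filter (λ x → T? (p x)) (allFin n)) ≡ sum (λ i → [ p i ])
length-filter-allFin {n} p = go n id
  where
  go : ∀ m (e : Fin m → Fin n) → length (filter (λ x → T? (p x)) (List.tabulate e)) ≡ sum (λ i → [ p (e i) ])
  go zero e = refl
  go (suc m) e with p (e zero)
  ... | true = cong suc (go m (e ∘ suc))
  ... | false = go m (e ∘ suc)

length-filter-allVecs : ∀ {n} m (p : Vec (Fin n) m → Bool) → length (filter (λ v → T? (p v)) (allVecs m n)) ≡ ΣV m (λ v → [ p v ])
length-filter-allVecs zero p with p []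
... | true = refl
... | false = refl
length-filter-allVecs {n} (suc m) p =
  trans (length-filter-concatMap p (λ i → List.map (i ∷_) (allVecs m n)))
        (sum-cong-≗ (λ c → trans (length-filter-map p (c ∷_) (allVecs m n)) (length-filter-allVecs m (λ v → p (c ∷ v)))))

hom-ΣV : ∀ {σ} (X A : Structure σ) → hom X A ≡ ΣV (size X) (λ h → [ isHom X A h ])
hom-ΣV X A = length-filter-allVecs (size X) (isHom X A)

sum-split : ∀ n {p} (F : Fin (n + p) → ℕ) → sum F ≡ sum (λ i → F (i ↑ˡ p)) + sum (λ i → F (n ↑ʳ i))
sum-split zero F = refl
sum-split (suc n) F = trans (cong (F zero +_) (sum-split n (F ∘ suc))) (sym (+-assoc (F zero) _ _))

sum-combine : ∀ n {p} (F : Fin (n * p) → ℕ) → sum F ≡ sum (λ i → sum (λ j → F (combine {n} {p} i j)))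
sum-combine zero F = refl
sum-combine (suc n) {p} F = trans (sum-split p F) (cong (sum (λ i → F (i ↑ˡ (n * p))) +_) (sum-combine n (λ i → F (p ↑ʳ i))))

vec-code : ∀ n m → Fin (n ^ m) → Vec (Fin n) m
vec-code n zero i = []
vec-code n (suc m) i = let (c , j) = remQuot {n} (n ^ m) i in c ∷ vec-code n m j

code-vec : ∀ n m → Vec (Fin n) m → Fin (n ^ m)
code-vec n zero [] = zero
code-vec n (suc m) (c ∷ v) = combine c (code-vec n m v)

vec-code-vec : ∀ n m v → vec-code n m (code-vec n m v) ≡ v
vec-code-vec n zero [] = refl
vec-code-vec n (suc m) (c ∷ v) =
  trans (cong (λ z → proj₁ z ∷ vec-code n m (proj₂ z)) (FinP.remQuot-combine c (code-vec n m v)))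
        (cong (c ∷_) (vec-code-vec n m v))

code-vec-code : ∀ n m i → code-vec n m (vec-code n m i) ≡ i
code-vec-code n zero zero = refl
code-vec-code n (suc m) i = trans (cong (combine (proj₁ (remQuot {n} (n ^ m) i))) (code-vec-code n m (proj₂ (remQuot {n} (n ^ m) i)))) (FinP.combine-remQuot {n} (n ^ m) i)

Fin↔Vec : ∀ n m → Fin (n ^ m) ↔ Vec (Fin n) m
Fin↔Vec n m = mk↔ₛ′ (vec-code n m) (code-vec n m) (vec-code-vec n m) (code-vec-code n m)

-- Transports sums over tuples to sums over a `Fin`, so that matching by keys has to be proved for
-- families indexed by `Fin` only.
ΣV-code : ∀ {n} m (F : Vec (Fin n) m → ℕ) → ΣV m F ≡ sum (λ i → F (vec-code n m i))
ΣV-code zero F = sym (+-identityʳ _)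
ΣV-code {n} (suc m) F = sym (trans (sum-combine n (λ i → F (vec-code n (suc m) i)))
  (sum-cong-≗ (λ c → trans (sum-cong-≗ (λ j → cong (λ z → F (proj₁ z ∷ vec-code n m (proj₂ z))) (FinP.remQuot-combine c j)))
                           (sym (ΣV-code m (λ v → F (c ∷ v)))))))

-- Bijections between finite sets with keys

⌊⌋-true : ∀ {P : Set} (d : Dec P) → P → ⌊ d ⌋ ≡ true
⌊⌋-true (yes _) _ = refl
⌊⌋-true (no ¬p) p = ⊥-elim (¬p p)

⌊⌋-false : ∀ {P : Set} (d : Dec P) → ¬ P → ⌊ d ⌋ ≡ false
⌊⌋-false (yes p) ¬p = ⊥-elim (¬p p)
⌊⌋-false (no _) _ = refl

module Keyed {K : Set} (_≟_ : DecidableEquality K) where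

  count : ∀ {n} → (Fin n → K) → K → ℕ
  count κ k = sum (λ i → [ ⌊ κ i ≟ k ⌋ ])

  count-remove : ∀ {n} (j : Fin (suc n)) (κ : Fin (suc n) → K) k →
    count κ k ≡ [ ⌊ κ j ≟ k ⌋ ] + count (κ ∘ punchIn j) k
  count-remove j κ k = sum-remove j (λ i → [ ⌊ κ i ≟ k ⌋ ])

  count-self : ∀ {n} (κ : Fin (suc n) → K) → count κ (κ zero) ≢ 0
  count-self κ e rewrite ⌊⌋-true (κ zero ≟ κ zero) refl = 1+n≢0 e

  count-none : ∀ {n} (κ : Fin n → K) k → (∀ i → κ i ≢ k) → count κ k ≡ 0
  count-none κ k p = sum-zero _ (λ i → cong [_] (⌊⌋-false (κ i ≟ k) (p i)))

  KeyBijection : ∀ {n n'} → (Fin n → K) → (Fin n' → K) → Set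
  KeyBijection {n} {n'} κ κ' = Σ (Permutation n n') λ π → ∀ i → κ i ≡ κ' (π ⟨$⟩ʳ i)

  -- Greedy pairing: the first index takes any partner with its key, and if there is none, this key
  -- is counted differently. A key that fails for the remainder still fails afterwards, because the
  -- removed pair contributes equally to both counts.
  match : ∀ {n n'} (κ : Fin n → K) (κ' : Fin n' → K) →
    KeyBijection κ κ' ⊎ (∃ λ k → count κ k ≢ count κ' k)
  match {zero} {zero} κ κ' = inj₁ (Perm.id , λ ())
  match {zero} {suc n'} κ κ' = inj₂ (κ' zero , λ e → count-self κ' (sym e))
  match {suc n} {zero} κ κ' = inj₂ (κ zero , count-self κ)
  match {suc n} {suc n'} κ κ' with FinP.any? (λ j → κ' j ≟ κ zero)
  ... | no ¬j = inj₂ (κ zero , λ e → count-self κ (trans e (count-none κ' (κ zero) (λ j e → ¬j (j , e)))))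
  ... | yes (j , κj) with match (κ ∘ suc) (κ' ∘ punchIn j)
  ... | inj₂ (k , ≢) = inj₂ (k , λ e → ≢ (+-cancelˡ-≡ [ ⌊ κ zero ≟ k ⌋ ] _ _
          (trans e (trans (count-remove j κ' k) (cong (λ z → [ ⌊ z ≟ k ⌋ ] + count (κ' ∘ punchIn j) k) κj)))))
  ... | inj₁ (π , p) = inj₁ (insert zero j π , q)
    where
    q : ∀ i → κ i ≡ κ' (insert zero j π ⟨$⟩ʳ i)
    q zero = sym κj
    q (suc i) = trans (p i) (cong κ' (sym (insert-punchIn zero j π i)))

  matchEqual : ∀ {n n'} (κ : Fin n → K) (κ' : Fin n' → K) → (∀ k → count κ k ≡ count κ' k) → KeyBijection κ κ'
  matchEqual κ κ' e with match κ κ'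
  ... | inj₁ π = π
  ... | inj₂ (k , ≢) = ⊥-elim (≢ (e k))

  matchVec : ∀ {n n'} m (κ : Vec (Fin n) m → K) (κ' : Vec (Fin n') m → K) →
    (∀ k → ΣV m (λ v → [ ⌊ κ v ≟ k ⌋ ]) ≡ ΣV m (λ v → [ ⌊ κ' v ≟ k ⌋ ])) →
    Σ (Vec (Fin n) m ↔ Vec (Fin n') m) λ f → ∀ v → κ v ≡ κ' (Inverse.to f v)
  matchVec {n} {n'} m κ κ' e with matchEqual (κ ∘ vec-code n m) (κ' ∘ vec-code n' m)
                             (λ k → trans (sym (ΣV-code m _)) (trans (e k) (ΣV-code m _)))
  ... | π , p = (Fin↔Vec n' m ↔-∘ (π ↔-∘ ↔-sym (Fin↔Vec n m)))
              , λ v → trans (cong κ (sym (vec-code-vec n m v))) (p (code-vec n m v))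

-- Transposing the images makes a bijection send x to y, without changing the keys.
module _ {X Y : Set} (_≟_ : DecidableEquality Y) where
  transpose : Y → Y → Y → Y
  transpose y z w with w ≟ y
  ... | yes _ = z
  ... | no _ with w ≟ z
  ... | yes _ = y
  ... | no _ = w

  transpose-left : ∀ y z → transpose y z y ≡ z
  transpose-left y z with y ≟ y
  ... | yes _ = refl
  ... | no y≢y = ⊥-elim (y≢y refl)

  transpose-right : ∀ y z → transpose y z z ≡ y
  transpose-right y z with z ≟ y
  ... | yes z≡y = z≡y
  ... | no _ with z ≟ z
  ... | yes _ = refl
  ... | no z≢z = ⊥-elim (z≢z refl)

  transpose-other : ∀ {y z w} → w ≢ y → w ≢ z → transpose y z w ≡ w
  transpose-other {y} {z} {w} w≢y w≢z with w ≟ y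
  ... | yes w≡y = ⊥-elim (w≢y w≡y)
  ... | no _ with w ≟ z
  ... | yes w≡z = ⊥-elim (w≢z w≡z)
  ... | no _ = refl

  transpose-involutive : ∀ y z w → transpose y z (transpose y z w) ≡ w
  transpose-involutive y z w = go (w ≟ y) (w ≟ z)
    where
    go : Dec (w ≡ y) → Dec (w ≡ z) → transpose y z (transpose y z w) ≡ w
    go (yes refl) _ = trans (cong (transpose y z) (transpose-left y z)) (transpose-right y z)
    go (no _) (yes refl) = trans (cong (transpose y z) (transpose-right y z)) (transpose-left y z)
    go (no w≢y) (no w≢z) = trans (cong (transpose y z) (transpose-other w≢y w≢z)) (transpose-other w≢y w≢z)

  transpose-key : ∀ {K : Set} (κ : Y → K) y z w → κ y ≡ κ z → κ (transpose y z w) ≡ κ w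
  transpose-key κ y z w e with w ≟ y
  ... | yes refl = sym e
  ... | no _ with w ≟ z
  ... | yes refl = e
  ... | no _ = refl

  pin : ∀ {K : Set} (κ : X → K) (κ' : Y → K) (f : X ↔ Y) → (∀ x → κ x ≡ κ' (Inverse.to f x)) →
        ∀ x₀ y₀ → κ x₀ ≡ κ' y₀ →
        Σ (X ↔ Y) λ g → (∀ x → κ x ≡ κ' (Inverse.to g x)) × Inverse.to g x₀ ≡ y₀
  pin κ κ' f p x₀ y₀ e = mk↔ₛ′ (τ ∘ to) (from ∘ τ)
      (λ y → trans (cong τ (strictlyInverseˡ (τ y))) (transpose-involutive (to x₀) y₀ y))
      (λ x → trans (cong from (transpose-involutive (to x₀) y₀ (to x))) (strictlyInverseʳ x))
    , (λ x → trans (p x) (sym (transpose-key κ' (to x₀) y₀ (to x) (trans (sym (p x₀)) e))))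
    , transpose-left (to x₀) y₀
    where
    open Inverse f
    τ = transpose (to x₀) y₀

-- Weighted finite families are separated by their moments

module Moments {n n' : ℕ} (F : Fin n → ℕ) (F' : Fin n' → ℕ) where

  Differ : (ℕ → ℕ) → (Fin n → ℕ) → (Fin n' → ℕ) → Set
  Differ g w w' = sum (λ i → w i * g (F i)) ≢ sum (λ i → w' i * g (F' i))

  PowerDiffer : (Fin n → ℕ) → (Fin n' → ℕ) → Set
  PowerDiffer w w' = ∃ λ e → Differ (_^ e) w w'

  -- The quantification over all weights is essential: a factor of `g` can be moved into the
  -- weights, which gives closure under multiplication by x and by constants.
  Detectable : (ℕ → ℕ) → Set
  Detectable g = ∀ w w' → Differ g w w' → PowerDiffer w w'

  detect-one : Detectable (λ _ → 1)
  detect-one w w' d = 0 , d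

  detect-x : ∀ g → Detectable g → Detectable (λ x → x * g x)
  detect-x g dg w w' d
    with dg (λ i → w i * F i) (λ i → w' i * F' i)
            (λ e → d (trans (sum-cong-≗ (λ i → sym (*-assoc (w i) (F i) (g (F i)))))
                     (trans e (sum-cong-≗ (λ i → *-assoc (w' i) (F' i) (g (F' i)))))))
  ... | e , de = suc e , λ eq → de (trans (sum-cong-≗ (λ i → *-assoc (w i) (F i) (F i ^ e)))
                     (trans eq (sum-cong-≗ (λ i → sym (*-assoc (w' i) (F' i) (F' i ^ e))))))

  -- g + h = f on the values taken, so a g-moment is a difference of detectable ones.
  detect-minus : ∀ f g h → Detectable f → Detectable h →
    (∀ i → g (F i) + h (F i) ≡ f (F i)) → (∀ i → g (F' i) + h (F' i) ≡ f (F' i)) → Detectable g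
  detect-minus f g h df dh p p' w w' d
    -- If the sums of `h` differ, they are detected directly; otherwise they cancel and the sums of
    -- `f` differ. This replaces subtraction.
    with sum (λ i → w i * h (F i)) ≟ sum (λ i → w' i * h (F' i))
  ... | no ≢ = dh w w' ≢
  ... | yes eq = df w w' (λ e → d (+-cancelʳ-≡ (sum (λ i → w i * h (F i))) _ _
        (trans (join F w p) (trans e (trans (sym (join F' w' p')) (cong (sum (λ i → w' i * g (F' i)) +_) (sym eq)))))))
    where
    join : ∀ {m} (E : Fin m → ℕ) u → (∀ i → g (E i) + h (E i) ≡ f (E i)) →
           sum (λ i → u i * g (E i)) + sum (λ i → u i * h (E i)) ≡ sum (λ i → u i * f (E i))
    join {m} E u q = trans (sym (∑-distrib-+ {m} _ _))
      (sum-cong-≗ (λ i → trans (sym (*-distribˡ-+ (u i) (g (E i)) (h (E i)))) (cong (u i *_) (q i))))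

  detect-scale : ∀ c g → Detectable g → Detectable (λ x → c * g x)
  detect-scale c g dg w w' d
    with dg (λ i → w i * c) (λ i → w' i * c)
            (λ e → d (trans (sum-cong-≗ (λ i → sym (*-assoc (w i) c (g (F i)))))
                     (trans e (sum-cong-≗ (λ i → *-assoc (w' i) c (g (F' i)))))))
  ... | e , de = e , λ eq → de (trans (pull F w e) (trans (cong (c *_) eq) (sym (pull F' w' e))))
    where
    pull : ∀ {m} (E : Fin m → ℕ) u e → sum (λ i → u i * c * E i ^ e) ≡ c * sum (λ i → u i * E i ^ e)
    pull {m} E u e = trans (sum-cong-≗ (λ i → trans (cong (_* E i ^ e) (*-comm (u i) c)) (*-assoc c (u i) (E i ^ e))))
      (sym (*-distribˡ-sum {m} c _))

  -- The falling factorial x(x-1)...(x-v+1). With truncated subtraction it vanishes exactly at the x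
  -- below v.
  below : ℕ → ℕ → ℕ
  below zero x = 1
  below (suc v) x = (x ∸ v) * below v x

  below-zero : ∀ v {x} → x < v → below v x ≡ 0
  below-zero (suc v) {x} x<1+v with x <? v
  ... | yes x<v = trans (cong ((x ∸ v) *_) (below-zero v x<v)) (*-zeroʳ (x ∸ v))
  ... | no x≮v = cong (_* below v x) (m≤n⇒m∸n≡0 (s≤s⁻¹ x<1+v))

  below-pos : ∀ v {x} → v ≤ x → below v x ≢ 0
  below-pos zero _ ()
  below-pos (suc v) {x} v<x e with m*n≡0⇒m≡0∨n≡0 (x ∸ v) e
  ... | inj₁ z = m>n⇒m∸n≢0 v<x z
  ... | inj₂ z = below-pos v (<⇒≤ v<x) z

  -- Truncation spoils `(x ∸ v) + v = x` only for x below v, and there the common factor `below v x`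
  -- is already zero.
  below-step : ∀ v x → (x ∸ v) * below v x + v * below v x ≡ x * below v x
  below-step v x with v ≤? x
  ... | yes v≤x = trans (sym (*-distribʳ-+ (below v x) (x ∸ v) v)) (cong (_* below v x) (m∸n+n≡m v≤x))
  ... | no v≰x rewrite below-zero v (≰⇒> v≰x) = trans (cong₂ _+_ (*-zeroʳ (x ∸ v)) (*-zeroʳ v)) (sym (*-zeroʳ x))

  detect-below : ∀ v → Detectable (below v)
  detect-below zero = detect-one
  detect-below (suc v) = detect-minus (λ x → x * below v x) (below (suc v)) (λ x → v * below v x)
    (detect-x (below v) (detect-below v)) (detect-scale v (below v) (detect-below v))
    (λ i → below-step v (F i)) (λ i → below-step v (F' i))

  module _ (v : ℕ) where
    above : ℕ → (ℕ → ℕ) → ℕ → ℕ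
    above zero g = g
    above (suc d) g = above d (λ x → (v + suc d ∸ x) * g x)

    -- Multiplying by v + d ∸ x kills the largest value; repeating this leaves the value v alone.
    detect-value : ∀ d {g} → Detectable g → (∀ i → F i ≤ v + d ⊎ g (F i) ≡ 0) → (∀ i → F' i ≤ v + d ⊎ g (F' i) ≡ 0) →
      (∀ {x} → x < v → g x ≡ 0) → g v ≢ 0 →
      ∃ λ h → Detectable h × (∀ i → F i ≢ v → h (F i) ≡ 0) × (∀ i → F' i ≢ v → h (F' i) ≡ 0) × h v ≢ 0
    detect-value zero {g} dg p p' lo gv = g , dg , (λ i → off (F i) (p i)) , (λ i → off (F' i) (p' i)) , gv
      where
      off : ∀ x → x ≤ v + 0 ⊎ g x ≡ 0 → x ≢ v → g x ≡ 0
      off x (inj₂ z) ≢ = z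
      off x (inj₁ x≤v) ≢ = lo (≤∧≢⇒< (subst (x ≤_) (+-identityʳ v) x≤v) ≢)
    detect-value (suc d) {g} dg p p' lo gv =
      detect-value d {λ x → (v + suc d ∸ x) * g x}
        (detect-minus (λ x → (v + suc d) * g x) (λ x → (v + suc d ∸ x) * g x) (λ x → x * g x)
          (detect-scale (v + suc d) g dg) (detect-x g dg) (λ i → split (F i) (p i)) (λ i → split (F' i) (p' i)))
        (λ i → lower (F i) (p i)) (λ i → lower (F' i) (p' i))
        (λ {x} x<v → trans (cong ((v + suc d ∸ x) *_) (lo x<v)) (*-zeroʳ (v + suc d ∸ x)))
        (λ e → [ (λ z → m>n⇒m∸n≢0 (m<m+n v z<s) z) , gv ]′ (m*n≡0⇒m≡0∨n≡0 (v + suc d ∸ v) e))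
      where
      open import Data.Sum using ([_,_]′)
      split : ∀ x → x ≤ v + suc d ⊎ g x ≡ 0 → (v + suc d ∸ x) * g x + x * g x ≡ (v + suc d) * g x
      split x (inj₁ x≤) = trans (sym (*-distribʳ-+ (g x) (v + suc d ∸ x) x)) (cong (_* g x) (m∸n+n≡m x≤))
      split x (inj₂ z) rewrite z = trans (cong₂ _+_ (*-zeroʳ (v + suc d ∸ x)) (*-zeroʳ x)) (sym (*-zeroʳ (v + suc d)))
      lower : ∀ x → x ≤ v + suc d ⊎ g x ≡ 0 → x ≤ v + d ⊎ (v + suc d ∸ x) * g x ≡ 0
      lower x (inj₂ z) = inj₂ (trans (cong ((v + suc d ∸ x) *_) z) (*-zeroʳ (v + suc d ∸ x)))
      lower x (inj₁ x≤) with x ≟ v + suc d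
      ... | yes refl = inj₂ (cong (_* g x) (n∸n≡0 x))
      ... | no x≢ = inj₁ (s≤s⁻¹ (subst (x <_) (+-suc v d) (≤∧≢⇒< x≤ x≢)))

  bound : ∀ {m} (E : Fin m → ℕ) → ∃ λ b → ∀ i → E i ≤ b
  bound {zero} E = 0 , λ ()
  bound {suc m} E with bound (E ∘ suc)
  ... | b , p = E zero ⊔ b , λ { zero → m≤m⊔n (E zero) b ; (suc i) → ≤-trans (p i) (m≤n⊔m (E zero) b) }

  level : ∀ {m} (E : Fin m → ℕ) (u : Fin m → ℕ) v (h : ℕ → ℕ) → (∀ i → E i ≢ v → h (E i) ≡ 0) →
    sum (λ i → u i * h (E i)) ≡ h v * sum (λ i → u i * [ ⌊ E i ≟ v ⌋ ])
  level {m} E u v h p = trans (sum-cong-≗ q) (sym (*-distribˡ-sum {m} (h v) _))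
    where
    q : ∀ i → u i * h (E i) ≡ h v * (u i * [ ⌊ E i ≟ v ⌋ ])
    q i with E i ≟ v
    ... | yes refl = trans (*-comm (u i) (h (E i))) (cong (h (E i) *_) (sym (*-identityʳ (u i))))
    ... | no ≢ = trans (cong (u i *_) (p i ≢)) (trans (*-zeroʳ (u i)) (sym (trans (cong (h v *_) (*-zeroʳ (u i))) (*-zeroʳ (h v)))))

  -- Interpolation in ℕ: `detect-value` supplies a detectable `h` that among the values taken is
  -- nonzero at most at `v`. Its weighted sum is the weight of the level set of `v` times `h v`, and
  -- this nonzero factor can be cancelled.
  powers-separate : ∀ w w' v → sum (λ i → w i * [ ⌊ F i ≟ v ⌋ ]) ≢ sum (λ i → w' i * [ ⌊ F' i ≟ v ⌋ ]) → PowerDiffer w w'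
  powers-separate w w' v d with bound F | bound F'
  ... | b , p | b' , p'
    -- Both families are bounded by `b + b'`, hence by `v + (b + b')`, so this many upper factors
    -- suffice.
    with detect-value v (b + b') (detect-below v)
           (λ i → inj₁ (≤-trans (p i) (≤-trans (m≤m+n b b') (m≤n+m (b + b') v))))
           (λ i → inj₁ (≤-trans (p' i) (≤-trans (m≤n+m b' b) (m≤n+m (b + b') v))))
           (below-zero v) (below-pos v ≤-refl)
  ... | h , dh , off , off' , hv = dh w w' (λ e → d (*-cancelˡ-≡ _ _ (h v) {{≢-nonZero hv}}
        (trans (sym (level F w v h off)) (trans e (level F' w' v h off')))))

-- Tests and colour refinement

infixl 8 _⊙_
_⊙_ : ∀ {X : Set} {m l} → Vec X m → Vec (Fin m) l → Vec X l
a ⊙ s = Vec.map (lookup a) s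

lookup-⊙ : ∀ {X : Set} {m l} (a : Vec X m) (s : Vec (Fin m) l) i → lookup (a ⊙ s) i ≡ lookup a (lookup s i)
lookup-⊙ a s i = VecP.lookup-map i (lookup a) s

⊙-id : ∀ {X : Set} {m} (a : Vec X m) → a ⊙ Vec.allFin m ≡ a
⊙-id = VecP.map-lookup-allFin

vec-ext : ∀ {X : Set} {m} {u v : Vec X m} → (∀ i → lookup u i ≡ lookup v i) → u ≡ v
vec-ext {u = []} {[]} p = refl
vec-ext {u = x ∷ u} {y ∷ v} p = cong₂ _∷_ (p zero) (vec-ext (p ∘ suc))

⊙-⊙ : ∀ {X : Set} {m l n} (a : Vec X m) (s : Vec (Fin m) l) (t : Vec (Fin l) n) → (a ⊙ s) ⊙ t ≡ a ⊙ (s ⊙ t)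
⊙-⊙ a s t = vec-ext λ i → trans (lookup-⊙ (a ⊙ s) t i) (trans (lookup-⊙ a s (lookup t i))
  (sym (trans (lookup-⊙ a (s ⊙ t) i) (cong (lookup a) (lookup-⊙ s t i)))))

-- A colouring of the tuples of A and of B (the stable outcome of the k-pebble refinement),
-- whose equality is a back-and-forth system with bijective moves.
record Game {σ : Signature} (k : ℕ) (A B : Structure σ) : Set₁ where
  field
    Colour : ℕ → Set
    _≟C_ : ∀ {m} → DecidableEquality (Colour m)
    colA : ∀ {m} → Vec (Fin (size A)) m → Colour m
    colB : ∀ {m} → Vec (Fin (size B)) m → Colour m
    rename : ∀ {m l} {a : Vec _ m} {b : Vec _ m} → m ≤ k → l ≤ k → colA a ≡ colB b →
             (s : Vec (Fin m) l) → colA (a ⊙ s) ≡ colB (b ⊙ s)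
    atoms : ∀ {m} {a : Vec _ m} {b : Vec _ m} → m ≤ k → colA a ≡ colB b →
            ∀ R (xs : Vec (Fin m) (ar σ R)) → rel A R (a ⊙ xs) ≡ rel B R (b ⊙ xs)
    equalities : ∀ {m} {a : Vec _ m} {b : Vec _ m} → colA a ≡ colB b →
            ∀ i j → ⌊ lookup a i FinP.≟ lookup a j ⌋ ≡ ⌊ lookup b i FinP.≟ lookup b j ⌋
    extend : ∀ {m} {a : Vec _ m} {b : Vec _ m} → m < k → colA a ≡ colB b →
             Σ (Permutation (size A) (size B)) λ π → ∀ c → colA (c ∷ a) ≡ colB ((π ⟨$⟩ʳ c) ∷ b)
    start : colA [] ≡ colB []

-- `Q` is a set of quantifiers whose interpretation is left open, so that sums and counting
-- thresholds share one refinement. Equality of entries is not among the tests; the colours record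
-- it separately.
data Test (σ : Signature) (k : ℕ) (Q : Set) : ℕ → Set where
  one   : ∀ {m} → Test σ k Q m
  atom  : ∀ {m} R → Vec (Fin m) (ar σ R) → Test σ k Q m
  prod  : ∀ {m} → Test σ k Q m → Test σ k Q m → Test σ k Q m
  ex    : ∀ {m} → suc m ≤ k → Q → Test σ k Q (suc m) → Test σ k Q m
  relab : ∀ {m l} → Vec (Fin m) l → Test σ k Q l → Test σ k Q m

value : ∀ {σ k Q} → (Q → ℕ → ℕ) → (A : Structure σ) → ∀ {m} → Test σ k Q m → Vec (Fin (size A)) m → ℕ
value act A one a = 1
value act A (atom R xs) a = [ rel A R (a ⊙ xs) ]
value act A (prod t u) a = value act A t a * value act A u a
value act A (ex _ q t) a = act q (sum λ c → value act A t (c ∷ a))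
value act A (relab s t) a = value act A t (a ⊙ s)

-- The alternative `Q` does not depend on the index: one failure is enough, and in the refinement it
-- is a splitting test.
searchFin : ∀ {n} {P : Fin n → Set} {Q : Set} → (∀ i → P i ⊎ Q) → (∀ i → P i) ⊎ Q
searchFin {zero} f = inj₁ λ ()
searchFin {suc n} f with f zero | searchFin (f ∘ suc)
... | inj₂ q | _ = inj₂ q
... | inj₁ _ | inj₂ q = inj₂ q
... | inj₁ p | inj₁ ps = inj₁ λ { zero → p ; (suc i) → ps i }

searchVec : ∀ {n} m {P : Vec (Fin n) m → Set} {Q : Set} → (∀ v → P v ⊎ Q) → (∀ v → P v) ⊎ Q
searchVec zero f with f []
... | inj₁ p = inj₁ λ { [] → p }
... | inj₂ q = inj₂ q
searchVec (suc m) f with searchFin (λ c → searchVec m (λ v → f (c ∷ v)))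
... | inj₁ p = inj₁ λ { (c ∷ v) → p c v }
... | inj₂ q = inj₂ q

search≤ : ∀ k {P : ℕ → Set} {Q : Set} → (∀ l → l ≤ k → P l ⊎ Q) → (∀ l → l ≤ k → P l) ⊎ Q
search≤ zero f with f 0 z≤n
... | inj₁ p = inj₁ λ { zero z≤n → p }
... | inj₂ q = inj₂ q
search≤ (suc k) f with f 0 z≤n | search≤ k (λ l l≤k → f (suc l) (s≤s l≤k))
... | inj₂ q | _ = inj₂ q
... | inj₁ _ | inj₂ q = inj₂ q
... | inj₁ p | inj₁ ps = inj₁ λ { zero _ → p ; (suc l) (s≤s l≤k) → ps l l≤k }

map-or : ∀ {X Y : Set} {Q : Set} (f g : X → Y) (xs : List X) → (∀ x → f x ≡ g x ⊎ Q) → List.map f xs ≡ List.map g xs ⊎ Q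
map-or f g [] p = inj₁ refl
map-or f g (x ∷ xs) p with p x | map-or f g xs p
... | inj₂ q | _ = inj₂ q
... | inj₁ _ | inj₂ q = inj₂ q
... | inj₁ e | inj₁ es = inj₁ (cong₂ _∷_ e es)

allVecs-complete : ∀ {n} m (v : Vec (Fin n) m) → v ∈ allVecs m n
allVecs-complete zero [] = here refl
allVecs-complete {n} (suc m) (c ∷ v) =
  ∈-concat⁺′ (∈-map⁺ (c ∷_) (allVecs-complete m v)) (∈-map⁺ (λ i → List.map (i ∷_) (allVecs m n)) (∈-allFin c))

⌊⌋-cong : ∀ {P Q : Set} (d : Dec P) (e : Dec Q) → (P → Q) → (Q → P) → ⌊ d ⌋ ≡ ⌊ e ⌋
⌊⌋-cong (yes p) e f g = sym (⌊⌋-true e (f p))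
⌊⌋-cong (no ¬p) e f g = sym (⌊⌋-false e (¬p ∘ g))

⌊⌋-holds : ∀ {P : Set} (d : Dec P) → ⌊ d ⌋ ≡ true → P
⌊⌋-holds (yes p) _ = p

indicator-× : ∀ {P P₁ P₂ : Set} (d : Dec P) (d₁ : Dec P₁) (d₂ : Dec P₂) → (P → P₁ × P₂) → (P₁ → P₂ → P) →
  [ ⌊ d ⌋ ] ≡ [ ⌊ d₁ ⌋ ] * [ ⌊ d₂ ⌋ ]
indicator-× d (yes p₁) (yes p₂) f g = cong [_] (⌊⌋-true d (g p₁ p₂))
indicator-× d (yes p₁) (no ¬p₂) f g = cong [_] (⌊⌋-false d (¬p₂ ∘ proj₂ ∘ f))
indicator-× d (no ¬p₁) d₂ f g = cong [_] (⌊⌋-false d (¬p₁ ∘ proj₁ ∘ f))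

-- Equality types of tuples

EqT : ∀ {n n' m} → Vec (Fin n) m → Vec (Fin n') m → Set
EqT a b = ∀ i j → ⌊ lookup a i FinP.≟ lookup a j ⌋ ≡ ⌊ lookup b i FinP.≟ lookup b j ⌋

row : ∀ {n m} → Fin n → Vec (Fin n) m → Vec Bool m
row c a = Vec.map (λ x → ⌊ c FinP.≟ x ⌋) a

-- A finite code of the equality type. Unlike `EqT` it belongs to one tuple alone and can be
-- compared decidably, as a component of a colour must be.
equalityMatrix : ∀ {n m} → Vec (Fin n) m → Vec (Vec Bool m) m
equalityMatrix a = Vec.map (λ x → row x a) a

lookup-row : ∀ {n m} (c : Fin n) (a : Vec (Fin n) m) j → lookup (row c a) j ≡ ⌊ c FinP.≟ lookup a j ⌋
lookup-row c a j = VecP.lookup-map j _ a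

lookup-matrix : ∀ {n m} (a : Vec (Fin n) m) i j → lookup (lookup (equalityMatrix a) i) j ≡ ⌊ lookup a i FinP.≟ lookup a j ⌋
lookup-matrix a i j = trans (cong (λ r → lookup r j) (VecP.lookup-map i (λ x → row x a) a)) (lookup-row (lookup a i) a j)

matrix⇒EqT : ∀ {n n' m} (a : Vec (Fin n) m) (b : Vec (Fin n') m) → equalityMatrix a ≡ equalityMatrix b → EqT a b
matrix⇒EqT a b e i j = trans (sym (lookup-matrix a i j)) (trans (cong (λ M → lookup (lookup M i) j) e) (lookup-matrix b i j))

EqT⇒matrix : ∀ {n n' m} (a : Vec (Fin n) m) (b : Vec (Fin n') m) → EqT a b → equalityMatrix a ≡ equalityMatrix b
EqT⇒matrix a b e = vec-ext λ i → vec-ext λ j → trans (lookup-matrix a i j) (trans (e i j) (sym (lookup-matrix b i j)))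

EqT-⊙ : ∀ {n n' m l} (a : Vec (Fin n) m) (b : Vec (Fin n') m) → EqT a b → (s : Vec (Fin m) l) → EqT (a ⊙ s) (b ⊙ s)
EqT-⊙ a b e s i j rewrite lookup-⊙ a s i | lookup-⊙ a s j | lookup-⊙ b s i | lookup-⊙ b s j = e (lookup s i) (lookup s j)

EqT-∷ : ∀ {n n' m} (a : Vec (Fin n) m) (b : Vec (Fin n') m) c d → EqT a b → row c a ≡ row d b → EqT (c ∷ a) (d ∷ b)
EqT-∷ a b c d e r zero zero = trans (⌊⌋-true (c FinP.≟ c) refl) (sym (⌊⌋-true (d FinP.≟ d) refl))
EqT-∷ a b c d e r zero (suc j) = trans (sym (lookup-row c a j)) (trans (cong (λ v → lookup v j) r) (lookup-row d b j))
EqT-∷ a b c d e r (suc i) zero =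
  trans (⌊⌋-cong (lookup a i FinP.≟ c) (c FinP.≟ lookup a i) sym sym)
  (trans (EqT-∷ a b c d e r zero (suc i)) (⌊⌋-cong (d FinP.≟ lookup b i) (lookup b i FinP.≟ d) sym sym))
EqT-∷ a b c d e r (suc i) (suc j) = e i j

EqT-row : ∀ {n n' m} (a : Vec (Fin n) m) (b : Vec (Fin n') m) → EqT a b → ∀ j → row (lookup a j) a ≡ row (lookup b j) b
EqT-row a b e j = vec-ext λ i → trans (lookup-row (lookup a j) a i) (trans (e j i) (sym (lookup-row (lookup b j) b i)))

member : ∀ {n m} → Fin n → Vec (Fin n) m → Bool
member c [] = false
member c (x ∷ xs) = ⌊ c FinP.≟ x ⌋ ∨ member c xs

member-∷ : ∀ {n m} (c x : Fin n) (xs : Vec (Fin n) m) →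
  [ member c (x ∷ xs) ] ≡ [ member c xs ] + [ ⌊ c FinP.≟ x ⌋ ] * [ not (member x xs) ]
member-∷ c x xs with c FinP.≟ x
... | no _ = sym (+-identityʳ _)
... | yes refl with member c xs
... | true = refl
... | false = refl

member-row : ∀ {n n' m} (c : Fin n) (d : Fin n') (a : Vec (Fin n) m) (b : Vec (Fin n') m) → row c a ≡ row d b → member c a ≡ member d b
member-row c d [] [] e = refl
member-row c d (x ∷ a) (y ∷ b) e = cong₂ _∨_ (VecP.∷-injectiveˡ e) (member-row c d a b (VecP.∷-injectiveʳ e))

member-false : ∀ {n m} (c : Fin n) (a : Vec (Fin n) m) → member c a ≡ false → ∀ j → lookup (row c a) j ≡ false
member-false c (x ∷ a) e j with c FinP.≟ x
member-false c (x ∷ a) () j | yes _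
member-false c (x ∷ a) e zero | no _ = refl
member-false c (x ∷ a) e (suc j) | no _ = member-false c a e j

member-true : ∀ {n m} (c : Fin n) (a : Vec (Fin n) m) → member c a ≡ true → ∃ λ j → lookup (row c a) j ≡ true
member-true c (x ∷ a) e with c FinP.≟ x
... | yes _ = zero , refl
... | no _ = let (j , p) = member-true c a e in suc j , p

-- Each distinct entry is charged to its last occurrence. Tuples of the same equality type charge
-- the same positions, so the sums agree term by term.
sum-member : ∀ {n n' m} (a : Vec (Fin n) m) (b : Vec (Fin n') m) (F : Fin n → ℕ) (F' : Fin n' → ℕ) → EqT a b →
  (∀ j → F (lookup a j) ≡ F' (lookup b j)) →
  sum (λ c → [ member c a ] * F c) ≡ sum (λ d → [ member d b ] * F' d)
sum-member {n} {n'} [] [] F F' e p = trans (sum-zero {n} _ (λ _ → refl)) (sym (sum-zero {n'} _ (λ _ → refl)))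
sum-member {n} {n'} (x ∷ a) (y ∷ b) F F' e p = trans (expand x a F) (trans
  (cong₂ _+_ (sum-member a b F F' (λ i j → e (suc i) (suc j)) (p ∘ suc))
             (cong₂ _*_ (cong (λ z → [ not z ]) (member-row x y a b (VecP.∷-injectiveʳ (EqT-row (x ∷ a) (y ∷ b) e zero)))) (p zero)))
  (sym (expand y b F')))
  where
  expand : ∀ {q l} (z : Fin q) (u : Vec (Fin q) l) (G : Fin q → ℕ) →
    sum (λ c → [ member c (z ∷ u) ] * G c) ≡ sum (λ c → [ member c u ] * G c) + [ not (member z u) ] * G z
  expand {q} z u G =
    trans (sum-cong-≗ (λ c → trans (cong (_* G c) (member-∷ c z u))
            (trans (*-distribʳ-+ (G c) [ member c u ] _) (cong ([ member c u ] * G c +_) (*-assoc [ ⌊ c FinP.≟ z ⌋ ] [ not (member z u) ] (G c))))))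
    (trans (∑-distrib-+ {q} _ _) (cong (sum (λ c → [ member c u ] * G c) +_) (sum-δ z (λ c → [ not (member z u) ] * G c))))

_≟L_ : DecidableEquality (List ℕ)
_≟L_ = ListP.≡-dec _≟_

_≟R_ : ∀ {m} → DecidableEquality (Vec Bool m)
_≟R_ = VecP.≡-dec BoolP._≟_

-- Refinement until the colouring is stable

module Refine {σ : Signature} (k : ℕ) {Q : Set} (act : Q → ℕ → ℕ)
  (separate : ∀ x y → x ≢ y → ∃ λ q → act q x ≢ act q y) (A B : Structure σ) where

  T' = Test σ k Q

  vA : ∀ {m} → T' m → Vec (Fin (size A)) m → ℕ
  vA = value act A
  vB : ∀ {m} → T' m → Vec (Fin (size B)) m → ℕ
  vB = value act B

  Split : ∀ {m} → Vec (Fin (size A)) m → Vec (Fin (size B)) m → Set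
  Split {m} a b = ∃ λ (t : T' m) → vA t a ≢ vB t b

  Tests : Set
  Tests = List (∃ T')

  tested : ∀ (S : Structure σ) {m} → Vec (Fin (size S)) m → ∃ T' → ℕ
  tested S {m} a (l , t) with l ≟ m
  ... | yes refl = value act S t a
  -- The default is the same in both structures, so a test for another length splits nothing and one
  -- list of tests colours tuples of all lengths.
  ... | no _ = 0

  tests : ∀ (S : Structure σ) {m} → Tests → Vec (Fin (size S)) m → List ℕ
  tests S L a = List.map (tested S a) L

  Colour : ℕ → Set
  Colour m = Vec (Vec Bool m) m × List ℕ

  _≟C_ : ∀ {m} → DecidableEquality (Colour m)
  _≟C_ = ProdP.≡-dec (VecP.≡-dec _≟R_) _≟L_

  colour : ∀ (S : Structure σ) {m} → Tests → Vec (Fin (size S)) m → Colour m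
  colour S L a = equalityMatrix a , tests S L a

  pow : ∀ {m} → T' m → ℕ → T' m
  pow t zero = one
  pow t (suc e) = prod t (pow t e)

  value-pow : ∀ (S : Structure σ) {m} (t : T' m) e a → value act S (pow t e) a ≡ value act S t a ^ e
  value-pow S t zero a = refl
  value-pow S t (suc e) a = cong (value act S t a *_) (value-pow S t e a)

  module _ {m} (a : Vec (Fin (size A)) m) (b : Vec (Fin (size B)) m) where

    weighted : ∀ (S : Structure σ) → (Fin (size S) → ℕ) → Vec (Fin (size S)) m → T' (suc m) → ℕ
    weighted S w u t = sum λ c → w c * value act S t (c ∷ u)

    filtered : ∀ (S : Structure σ) → (Fin (size S) → ℕ) → Vec (Fin (size S)) m → T' (suc m) → Tests → List ℕ → ℕ
    filtered S w u s L vs = sum λ c → w c * value act S s (c ∷ u) * [ ⌊ _≟L_ (tests S L (c ∷ u)) vs ⌋ ]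

    -- Counting the extensions with prescribed test values is polynomial in the test values.
    monomial : ∀ w w' s L vs → filtered A w a s L vs ≢ filtered B w' b s L vs →
      ∃ λ t → weighted A w a t ≢ weighted B w' b t
    monomial w w' s [] [] d = s , λ e → d (trans (unit A w a) (trans e (sym (unit B w' b))))
      where
      unit : ∀ S (w : Fin (size S) → ℕ) u → filtered S w u s [] [] ≡ weighted S w u s
      unit S w u = sum-cong-≗ {size S} (λ c → *-identityʳ (w c * value act S s (c ∷ u)))
    monomial w w' s [] (v ∷ vs) d = ⊥-elim (d (trans (sum-zero _ (λ c → *-zeroʳ (w c * _))) (sym (sum-zero _ (λ c → *-zeroʳ (w' c * _))))))
    monomial w w' s (p ∷ L) [] d = ⊥-elim (d (trans (sum-zero _ (λ c → *-zeroʳ (w c * _))) (sym (sum-zero _ (λ c → *-zeroʳ (w' c * _))))))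
    monomial w w' s ((l , t) ∷ L) (v ∷ vs) d with l ≟ suc m
    ... | no _ = skip (0 ≟ v)
      where
      skip : Dec (0 ≡ v) → ∃ λ t → weighted A w a t ≢ weighted B w' b t
      skip (yes refl) = monomial w w' s L vs (λ e → d (trans (ignore A w a) (trans e (sym (ignore B w' b)))))
        where
        ignore : ∀ S (w : Fin (size S) → ℕ) u →
          sum (λ c → w c * value act S s (c ∷ u) * [ ⌊ _≟L_ (0 ∷ tests S L (c ∷ u)) (0 ∷ vs) ⌋ ]) ≡ filtered S w u s L vs
        ignore S w u = sum-cong-≗ (λ c → cong (λ z → w c * value act S s (c ∷ u) * [ z ])
          (⌊⌋-cong (_≟L_ (0 ∷ tests S L (c ∷ u)) (0 ∷ vs)) (_≟L_ (tests S L (c ∷ u)) vs) ListP.∷-injectiveʳ (cong (0 ∷_))))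
      skip (no 0≢v) = ⊥-elim (d (trans (none A w a) (sym (none B w' b))))
        where
        none : ∀ S (w : Fin (size S) → ℕ) u →
          sum (λ c → w c * value act S s (c ∷ u) * [ ⌊ _≟L_ (0 ∷ tests S L (c ∷ u)) (v ∷ vs) ⌋ ]) ≡ 0
        none S w u = sum-zero _ (λ c → trans (cong (λ z → w c * value act S s (c ∷ u) * [ z ])
          (⌊⌋-false (_≟L_ (0 ∷ tests S L (c ∷ u)) (v ∷ vs)) (0≢v ∘ ListP.∷-injectiveˡ))) (*-zeroʳ (w c * value act S s (c ∷ u))))
    -- The condition that `t` takes the value `v` is traded for a power of `t`, with all other
    -- factors regarded as weights. The power is multiplied into `s`, and `t` leaves the list of
    -- conditions.
    monomial w w' s ((l , t) ∷ L) (v ∷ vs) d | yes refl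
      with Moments.powers-separate (λ c → vA t (c ∷ a)) (λ c → vB t (c ∷ b))
             (λ c → w c * vA s (c ∷ a) * [ ⌊ _≟L_ (tests A L (c ∷ a)) vs ⌋ ])
             (λ c → w' c * vB s (c ∷ b) * [ ⌊ _≟L_ (tests B L (c ∷ b)) vs ⌋ ])
             v (λ e → d (trans (peel A w a) (trans e (sym (peel B w' b)))))
      where
      peel : ∀ S (w : Fin (size S) → ℕ) u →
        sum (λ c → w c * value act S s (c ∷ u) * [ ⌊ _≟L_ (value act S t (c ∷ u) ∷ tests S L (c ∷ u)) (v ∷ vs) ⌋ ]) ≡
        sum (λ c → w c * value act S s (c ∷ u) * [ ⌊ _≟L_ (tests S L (c ∷ u)) vs ⌋ ] * [ ⌊ value act S t (c ∷ u) ≟ v ⌋ ])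
      peel S w u = sum-cong-≗ (λ c → trans (cong (w c * value act S s (c ∷ u) *_)
        (trans (indicator-× (_≟L_ (value act S t (c ∷ u) ∷ tests S L (c ∷ u)) (v ∷ vs))
               (_≟L_ (tests S L (c ∷ u)) vs) (value act S t (c ∷ u) ≟ v)
               (λ e → ListP.∷-injectiveʳ e , ListP.∷-injectiveˡ e) (λ p q → cong₂ _∷_ q p)) refl))
        (sym (*-assoc (w c * value act S s (c ∷ u)) [ ⌊ _≟L_ (tests S L (c ∷ u)) vs ⌋ ] [ ⌊ value act S t (c ∷ u) ≟ v ⌋ ])))
    ... | e , de = monomial w w' (prod s (pow t e)) L vs (λ eq → de (trans (regroup A w a) (trans eq (sym (regroup B w' b)))))
      where
      regroup : ∀ S (w : Fin (size S) → ℕ) u →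
        sum (λ c → w c * value act S s (c ∷ u) * [ ⌊ _≟L_ (tests S L (c ∷ u)) vs ⌋ ] * value act S t (c ∷ u) ^ e) ≡
        filtered S w u (prod s (pow t e)) L vs
      regroup S w u = sum-cong-≗ λ c → let i = [ ⌊ _≟L_ (tests S L (c ∷ u)) vs ⌋ ] ; x = value act S s (c ∷ u) ; y = value act S t (c ∷ u) ^ e in
        trans (*-assoc (w c * x) i y) (trans (cong (w c * x *_) (*-comm i y)) (trans (sym (*-assoc (w c * x) y i))
          (cong (_* i) (trans (*-assoc (w c) x y) (cong (λ z → w c * (x * z)) (sym (value-pow S t e (c ∷ u))))))))

    onRow : ∀ (S : Structure σ) → Vec (Fin (size S)) m → Vec Bool m → Fin (size S) → ℕ
    onRow S u e c = [ ⌊ _≟R_ (row c u) e ⌋ ]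

    -- A true entry of the pattern forces `c` to be that entry of `u`, so at most one term survives.
    sum-row : ∀ (S : Structure σ) (u : Vec (Fin (size S)) m) (e : Vec Bool m) j → lookup e j ≡ true → (F : Fin (size S) → ℕ) →
      sum (λ c → [ ⌊ _≟R_ (row c u) e ⌋ ] * F c) ≡ [ ⌊ _≟R_ (row (lookup u j) u) e ⌋ ] * F (lookup u j)
    sum-row S u e j ej F = trans (sum-cong-≗ {size S} lem)
      (sum-δ (lookup u j) (λ c → [ ⌊ _≟R_ (row c u) e ⌋ ] * F c))
      where
      lem : ∀ c → [ ⌊ _≟R_ (row c u) e ⌋ ] * F c ≡
                  [ ⌊ c FinP.≟ lookup u j ⌋ ] * ([ ⌊ _≟R_ (row c u) e ⌋ ] * F c)
      lem c = go (c FinP.≟ lookup u j)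
        where
        go : (d : Dec (c ≡ lookup u j)) → [ ⌊ _≟R_ (row c u) e ⌋ ] * F c ≡
                  [ ⌊ d ⌋ ] * ([ ⌊ _≟R_ (row c u) e ⌋ ] * F c)
        go (yes _) = sym (+-identityʳ _)
        go (no c≢) = cong (λ z → [ z ] * F c) (⌊⌋-false (_≟R_ (row c u) e)
          (λ r → c≢ (⌊⌋-holds (c FinP.≟ lookup u j) (trans (sym (lookup-row c u j)) (trans (cong (λ v → lookup v j) r) ej)))))

    -- The all-false pattern describes precisely the elements that do not occur in `u`.
    sum-outside : ∀ (S : Structure σ) (u : Vec (Fin (size S)) m) (e : Vec Bool m) → (∀ j → lookup e j ≡ false) → (F : Fin (size S) → ℕ) →
      sum F ≡ sum (λ c → [ member c u ] * F c) + sum (λ c → [ ⌊ _≟R_ (row c u) e ⌋ ] * F c)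
    sum-outside S u e ef F = trans (sum-cong-≗ {size S} lem) (∑-distrib-+ {size S} _ _)
      where
      lem : ∀ c → F c ≡ [ member c u ] * F c + [ ⌊ _≟R_ (row c u) e ⌋ ] * F c
      lem c with member c u in eq
      ... | true rewrite ⌊⌋-false (_≟R_ (row c u) e) (λ r → let (j , p) = member-true c u eq in
                 case (trans (sym p) (trans (cong (λ v → lookup v j) r) (ef j))) of λ ())
            = sym (trans (+-identityʳ _) (+-identityʳ _))
      ... | false rewrite ⌊⌋-true (_≟R_ (row c u) e) (vec-ext (λ j → trans (member-false c u eq j) (sym (ef j))))
            = sym (+-identityʳ _)

    true-entry? : (e : Vec Bool m) → (∃ λ j → lookup e j ≡ true) ⊎ (∀ j → lookup e j ≡ false)
    true-entry? e with FinP.any? (λ j → lookup e j BoolP.≟ true)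
    ... | yes p = inj₁ p
    ... | no ¬p = inj₂ λ j → BoolP.¬-not (λ q → ¬p (j , q))

    repeat : EqT a b → ∀ j (t : T' (suc m)) → vA t (lookup a j ∷ a) ≢ vB t (lookup b j ∷ b) → Split a b
    repeat _ j t d = relab (j ∷ Vec.allFin m) t , λ e → d
      (trans (cong (λ z → vA t (lookup a j ∷ z)) (sym (⊙-id a))) (trans e (cong (λ z → vB t (lookup b j ∷ z)) (⊙-id b))))

    -- A pattern with a true entry admits a single extension, which a relabelling of `t` already
    -- sees. For the all-false pattern, either `t` differs at some entry of the tuples, or the parts
    -- of the sum contributed by the entries agree; then the sums over the universes must differ,
    -- and a quantifier detects this.
    split-extension : suc m ≤ k → EqT a b → ∀ e t →
      weighted A (onRow A a e) a t ≢ weighted B (onRow B b e) b t →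
      Split a b
    split-extension m<k eq e t d with true-entry? e
    ... | inj₁ (j , ej) = repeat eq j t λ x → d (trans (sum-row A a e j ej _) (trans
            (cong₂ (λ r z → [ ⌊ VecP.≡-dec BoolP._≟_ r e ⌋ ] * z) (EqT-row a b eq j) x) (sym (sum-row B b e j ej _))))
    ... | inj₂ ef with searchFin {P = λ j → vA t (lookup a j ∷ a) ≡ vB t (lookup b j ∷ b)} {Q = Split a b} test
      where
      test : ∀ j → vA t (lookup a j ∷ a) ≡ vB t (lookup b j ∷ b) ⊎ Split a b
      test j with vA t (lookup a j ∷ a) ≟ vB t (lookup b j ∷ b)
      ... | yes p = inj₁ p
      ... | no ≢ = inj₂ (repeat eq j t ≢)
    ... | inj₂ q = q
    ... | inj₁ same with sum (λ c → vA t (c ∷ a)) ≟ sum (λ d → vB t (d ∷ b))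
    ... | no ≢ = let (q , dq) = separate _ _ ≢ in ex m<k q t , dq
    ... | yes total = ⊥-elim (d (+-cancelˡ-≡ (sum (λ c → [ member c a ] * vA t (c ∷ a))) _ _
            (trans (sym (sum-outside A a e ef _)) (trans total (trans (sum-outside B b e ef _)
              (cong (_+ weighted B (onRow B b e) b t) (sym (sum-member a b _ _ eq same))))))))

    module _ (L : Tests) where
      Key = Vec Bool m × List ℕ

      _≟K_ : DecidableEquality Key
      _≟K_ = ProdP.≡-dec _≟R_ _≟L_

      key : ∀ (S : Structure σ) → Vec (Fin (size S)) m → Fin (size S) → Key
      key S u c = row c u , tests S L (c ∷ u)

      count-filtered : ∀ (S : Structure σ) u e vs → Keyed.count _≟K_ (key S u) (e , vs) ≡
        filtered S (onRow S u e) u one L vs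
      count-filtered S u e vs = sum-cong-≗ {size S} λ c →
        trans (indicator-× (key S u c ≟K (e , vs)) (_≟R_ (row c u) e) (_≟L_ (tests S L (c ∷ u)) vs)
                 (λ p → cong proj₁ p , cong proj₂ p) (cong₂ _,_))
              (cong (_* [ ⌊ _≟L_ (tests S L (c ∷ u)) vs ⌋ ]) (sym (*-identityʳ (onRow S u e c))))

      Extension : Set
      Extension = Σ (Permutation (size A) (size B)) λ π → ∀ c → colour A L (c ∷ a) ≡ colour B L ((π ⟨$⟩ʳ c) ∷ b)

      -- The keys consist of the equality pattern of the new element and the test values. A key
      -- counted differently gives, through `monomial`, a single test whose sum over this pattern
      -- differs.
      extension? : suc m ≤ k → EqT a b → Extension ⊎ Split a b
      extension? m<k eq with Keyed.match _≟K_ (key A a) (key B b)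
      ... | inj₁ (π , p) = inj₁ (π , λ c → cong₂ _,_ (EqT⇒matrix _ _ (EqT-∷ a b c (π ⟨$⟩ʳ c) eq (cong proj₁ (p c)))) (cong proj₂ (p c)))
      ... | inj₂ ((e , vs) , d) = let (t , dt) = monomial (onRow A a e) (onRow B b e) one L vs (λ x → d (trans (count-filtered A a e vs) (trans x (sym (count-filtered B b e vs)))))
                                  in inj₂ (split-extension m<k eq e t dt)

      record Good : Set where
        field
          good-rename : ∀ l → l ≤ k → (s : Vec (Fin m) l) → colour A L (a ⊙ s) ≡ colour B L (b ⊙ s)
          good-atoms : ∀ R (xs : Vec (Fin m) (ar σ R)) → rel A R (a ⊙ xs) ≡ rel B R (b ⊙ xs)
          good-extend : m < k → Extension

      tested-or : ∀ {l} (s : Vec (Fin m) l) p → tested A (a ⊙ s) p ≡ tested B (b ⊙ s) p ⊎ Split a b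
      tested-or {l} s (l' , t) with l' ≟ l
      ... | no _ = inj₁ refl
      ... | yes refl with vA t (a ⊙ s) ≟ vB t (b ⊙ s)
      ... | yes e = inj₁ e
      ... | no ≢ = inj₂ (relab s t , ≢)

      rename-or : EqT a b → ∀ {l} (s : Vec (Fin m) l) → colour A L (a ⊙ s) ≡ colour B L (b ⊙ s) ⊎ Split a b
      rename-or eq s with map-or (tested A (a ⊙ s)) (tested B (b ⊙ s)) L (tested-or s)
      ... | inj₁ e = inj₁ (cong₂ _,_ (EqT⇒matrix _ _ (EqT-⊙ a b eq s)) e)
      ... | inj₂ q = inj₂ q

      atom-or : ∀ R xs → rel A R (a ⊙ xs) ≡ rel B R (b ⊙ xs) ⊎ Split a b
      atom-or R xs with rel A R (a ⊙ xs) in eA | rel B R (b ⊙ xs) in eB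
      ... | true | true = inj₁ refl
      ... | false | false = inj₁ refl
      ... | true | false = inj₂ (atom R xs , λ e → case trans (sym (cong [_] eA)) (trans e (cong [_] eB)) of λ ())
      ... | false | true = inj₂ (atom R xs , λ e → case trans (sym (cong [_] eA)) (trans e (cong [_] eB)) of λ ())

      extend-or : EqT a b → (m < k → Extension) ⊎ Split a b
      extend-or eq with m <? k
      ... | no m≮k = inj₁ (λ m<k → ⊥-elim (m≮k m<k))
      ... | yes m<k with extension? m<k eq
      ... | inj₁ e = inj₁ (λ _ → e)
      ... | inj₂ q = inj₂ q

      good? : EqT a b → Good ⊎ Split a b
      good? eq with search≤ k (λ l _ → searchVec l (rename-or eq)) | searchFin (λ R → searchVec (ar σ R) (atom-or R)) | extend-or eq
      ... | inj₂ q | _ | _ = inj₂ q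
      ... | inj₁ _ | inj₂ q | _ = inj₂ q
      ... | inj₁ _ | inj₁ _ | inj₂ q = inj₂ q
      ... | inj₁ r | inj₁ at | inj₁ x = inj₁ record { good-rename = r ; good-atoms = at ; good-extend = x }

  Position : Set
  Position = ∃ λ m → Vec (Fin (size A)) m × Vec (Fin (size B)) m

  allPositions : List Position
  allPositions = List.concat (List.map (λ m → List.map (m ,_) (cartesianProduct (allVecs m (size A)) (allVecs m (size B)))) (upTo (suc k)))

  allPositions-complete : ∀ {m} a b → m ≤ k → (m , a , b) ∈ allPositions
  allPositions-complete {m} a b m≤k = ∈-concat⁺′
    (∈-map⁺ (m ,_) (∈-cartesianProduct⁺ (allVecs-complete m a) (allVecs-complete m b)))
    (∈-map⁺ (λ m → List.map (m ,_) (cartesianProduct (allVecs m (size A)) (allVecs m (size B)))) (∈-upTo⁺ (s≤s m≤k)))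

  Alike : Tests → Position → Set
  Alike L (m , a , b) = colour A L a ≡ colour B L b

  alike? : ∀ L p → Dec (Alike L p)
  alike? L (m , a , b) = colour A L a ≟C colour B L b

  Stable : Tests → Set
  Stable L = ∀ {m} (a : Vec (Fin (size A)) m) b → m ≤ k → colour A L a ≡ colour B L b → Good a b L

  tested-self : ∀ (S : Structure σ) {m} (u : Vec (Fin (size S)) m) t → tested S u (m , t) ≡ value act S t u
  tested-self S {m} u t with m ≟ m
  ... | yes refl = refl
  ... | no m≢m = ⊥-elim (m≢m refl)

  -- Each violated condition yields a test that splits a position, so the number of alike positions drops.
  refine : ∀ fuel L P → length P ≤ fuel → (∀ {m} (a : Vec (Fin (size A)) m) b → m ≤ k → colour A L a ≡ colour B L b → (m , a , b) ∈ P) →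
    ∃ Stable
  refine fuel L P P≤ inv with All.decide {P = λ p → Alike L p → Good (proj₁ (proj₂ p)) (proj₂ (proj₂ p)) L}
                                        {Q = λ p → Split (proj₁ (proj₂ p)) (proj₂ (proj₂ p)) × Alike L p} check P
    where
    check : ∀ p → (Alike L p → Good (proj₁ (proj₂ p)) (proj₂ (proj₂ p)) L) ⊎ (Split (proj₁ (proj₂ p)) (proj₂ (proj₂ p)) × Alike L p)
    check p@(m , a , b) with alike? L p
    ... | no ¬e = inj₁ (λ e → ⊥-elim (¬e e))
    ... | yes e with good? a b L (matrix⇒EqT a b (cong proj₁ e))
    ... | inj₁ g = inj₁ (λ _ → g)
    ... | inj₂ q = inj₂ (q , e)
  ... | inj₁ good = L , λ a b m≤k e → All.lookup good (inv a b m≤k e) e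
  ... | inj₂ bad with find bad
  refine zero L (_ ∷ _) () inv | inj₂ bad | _
  refine (suc fuel) L P P≤ inv | inj₂ bad | (m , a , b) , p∈P , (t , d) , e =
    -- The split position leaves the list, so it becomes strictly shorter. Positions alike under
    -- `L'` were alike under `L`, hence none of them is lost.
    refine fuel L' (filter (alike? L') P)
      (s≤s⁻¹ (≤-trans (ListP.filter-notAll (alike? L') P (lose p∈P split)) P≤))
      (λ a b m≤k e → ∈-filter⁺ (alike? L') (inv a b m≤k (cong₂ _,_ (cong proj₁ e) (ListP.∷-injectiveʳ (cong proj₂ e)))) e)
    where
    L' = (m , t) ∷ L
    split : ¬ Alike L' (m , a , b)
    split e' = d (trans (sym (tested-self A a t)) (trans (ListP.∷-injectiveˡ (cong proj₂ e')) (tested-self B b t)))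

  ClosedAgree : Set
  ClosedAgree = ∀ (t : T' 0) → vA t [] ≡ vB t []

  -- Agreement on closed tests enters only at `start`: it gives the empty tuples the same colour for
  -- whatever list of tests the refinement ends with.
  game : ClosedAgree → Game k A B
  game closed = record
    { Colour = Colour
    ; _≟C_ = _≟C_
    ; colA = colour A L
    ; colB = colour B L
    ; rename = λ m≤k l≤k e s → Good.good-rename (stable _ _ m≤k e) _ l≤k s
    ; atoms = λ m≤k e → Good.good-atoms (stable _ _ m≤k e)
    ; equalities = λ e → matrix⇒EqT _ _ (cong proj₁ e)
    ; extend = λ m<k e → Good.good-extend (stable _ _ (<⇒≤ m<k) e) m<k
    ; start = cong ([] ,_) (ListP.map-cong same L)
    }
    where
    outcome = refine (length allPositions) [] allPositions ≤-refl (λ a b m≤k _ → allPositions-complete a b m≤k)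
    L = proj₁ outcome
    stable = proj₂ outcome
    same : ∀ p → tested A [] p ≡ tested B [] p
    same (l , t) with l ≟ 0
    ... | yes refl = closed t
    ... | no _ = refl

-- Homomorphism counts from a stable colouring

sum-none : ∀ {n} (f : Fin n → ℕ) → n ≡ 0 → sum f ≡ 0
sum-none f refl = refl

ΣV-zero : ∀ {n} m (F : Vec (Fin n) m → ℕ) → (∀ v → F v ≡ 0) → ΣV m F ≡ 0
ΣV-zero zero F p = p []
ΣV-zero (suc m) F p = sum-zero _ (λ c → ΣV-zero m _ (λ v → p (c ∷ v)))

ΣV-δ : ∀ {n} m (g : Vec (Fin n) m) (φ : Vec (Fin n) m → ℕ) → ΣV m (λ v → [ ⌊ VecP.≡-dec FinP._≟_ g v ⌋ ] * φ v) ≡ φ g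
ΣV-δ zero [] φ = *-identityˡ (φ [])
ΣV-δ {n} (suc m) (x ∷ g) φ = trans (sum-cong-≗ {n} inner) (sum-δ x (λ c → φ (c ∷ g)))
  where
  inner : ∀ c → ΣV m (λ v → [ ⌊ VecP.≡-dec FinP._≟_ (x ∷ g) (c ∷ v) ⌋ ] * φ (c ∷ v)) ≡ [ ⌊ c FinP.≟ x ⌋ ] * φ (c ∷ g)
  inner c = trans (ΣV-cong m λ v → trans (cong (_* φ (c ∷ v)) (indicator-× (VecP.≡-dec FinP._≟_ (x ∷ g) (c ∷ v)) (c FinP.≟ x) (VecP.≡-dec FinP._≟_ g v)
                     (λ e → sym (VecP.∷-injectiveˡ e) , VecP.∷-injectiveʳ e) (λ p q → cong₂ _∷_ (sym p) q)))
                   (*-assoc [ ⌊ c FinP.≟ x ⌋ ] _ _))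
            (trans (sym (ΣV-*ˡ m [ ⌊ c FinP.≟ x ⌋ ] _)) (cong ([ ⌊ c FinP.≟ x ⌋ ] *_) (ΣV-δ m g (λ v → φ (c ∷ v)))))

indices : ∀ {X : Set} {m} (ys : List X) (t : Vec X m) → (∀ i → lookup t i ∈ ys) →
  ∃ λ (s : Vec (Fin (length ys)) m) → fromList ys ⊙ s ≡ t
indices ys [] p = [] , refl
indices ys (x ∷ t) p = let (s , e) = indices ys t (p ∘ suc) in
  Any.index (p zero) ∷ s , cong₂ _∷_ (at (p zero)) e
  where
  at : ∀ {y zs} (q : y ∈ zs) → lookup (fromList zs) (Any.index q) ≡ y
  at (here refl) = refl
  at (there q) = at q

lookup-fromList-∈ : ∀ {X : Set} (xs : List X) i → lookup (fromList xs) i ∈ xs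
lookup-fromList-∈ (x ∷ xs) zero = here refl
lookup-fromList-∈ (x ∷ xs) (suc i) = there (lookup-fromList-∈ xs i)

⊙-cong-∈ : ∀ {X : Set} {n} (g h : Vec X n) xs → (∀ {x} → x ∈ xs → lookup g x ≡ lookup h x) → g ⊙ fromList xs ≡ h ⊙ fromList xs
⊙-cong-∈ g h [] p = refl
⊙-cong-∈ g h (x ∷ xs) p = cong₂ _∷_ (p (here refl)) (⊙-cong-∈ g h xs (p ∘ there))

module Agreement {q n : ℕ} where

  agree? : ∀ D (g v : Vec (Fin q) n) → Dec (All (λ x → lookup g x ≡ lookup v x) D)
  agree? D g v = All.all? (λ x → lookup g x FinP.≟ lookup v x) D

  -- The sum over all completions of the partial map `g` restricted to `D`. Keeping `g` total avoids
  -- a type of partial maps; its values outside `D` do not affect the sum.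
  sumAgreeing : List (Fin n) → Vec (Fin q) n → (Vec (Fin q) n → ℕ) → ℕ
  sumAgreeing D g φ = ΣV n λ v → [ ⌊ agree? D g v ⌋ ] * φ v

  sumAgreeing-[] : ∀ g φ → sumAgreeing [] g φ ≡ ΣV n φ
  sumAgreeing-[] g φ = ΣV-cong n (λ v → *-identityˡ (φ v))

  sumAgreeing-⊆ : ∀ {D D'} g φ → (∀ {x} → x ∈ D → x ∈ D') → (∀ {x} → x ∈ D' → x ∈ D) → sumAgreeing D g φ ≡ sumAgreeing D' g φ
  sumAgreeing-⊆ {D} {D'} g φ f f' = ΣV-cong n λ v → cong (λ b → [ b ] * φ v)
    (⌊⌋-cong (agree? D g v) (agree? D' g v) (λ p → All.tabulate (All.lookup p ∘ f')) (λ p → All.tabulate (All.lookup p ∘ f)))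

  sumAgreeing-full : ∀ {D} g φ → (∀ x → x ∈ D) → sumAgreeing D g φ ≡ φ g
  sumAgreeing-full {D} g φ p = trans (ΣV-cong n λ v → cong (λ b → [ b ] * φ v)
      (⌊⌋-cong (agree? D g v) (VecP.≡-dec FinP._≟_ g v) (λ al → vec-ext (λ x → All.lookup al (p x))) (λ e → All.universal (λ x → cong (λ u → lookup u x) e) D)))
    (ΣV-δ n g φ)

  sumAgreeing-∷ : ∀ {D z} g φ → z ∉ D → sumAgreeing D g φ ≡ sum λ c → sumAgreeing (z ∷ D) (g [ z ]≔ c) φ
  sumAgreeing-∷ {D} {z} g φ z∉D = trans (ΣV-cong n λ v → trans (sym (sum-δ (lookup v z) (λ _ → [ ⌊ agree? D g v ⌋ ] * φ v)))
      (sum-cong-≗ {q} (λ c → trans (sym (*-assoc [ ⌊ c FinP.≟ lookup v z ⌋ ] _ _)) (cong (_* φ v) (sym (each v c))))))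
    (ΣV-sum n (λ v c → [ ⌊ agree? (z ∷ D) (g [ z ]≔ c) v ⌋ ] * φ v))
    where
    same : ∀ {c x} → x ∈ D → lookup (g [ z ]≔ c) x ≡ lookup g x
    same {c} {x} x∈D = VecP.lookup∘update′ (λ { refl → z∉D x∈D }) g c
    each : ∀ v c → [ ⌊ agree? (z ∷ D) (g [ z ]≔ c) v ⌋ ] ≡ [ ⌊ c FinP.≟ lookup v z ⌋ ] * [ ⌊ agree? D g v ⌋ ]
    each v c = indicator-× (agree? (z ∷ D) (g [ z ]≔ c) v) (c FinP.≟ lookup v z) (agree? D g v)
      (λ { (e ∷ al) → trans (sym (VecP.lookup∘update z g c)) e , All.tabulate (λ x∈ → trans (sym (same x∈)) (All.lookup al x∈)) })
      (λ e al → trans (VecP.lookup∘update z g c) e ∷ All.tabulate (λ x∈ → trans (same x∈) (All.lookup al x∈)))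

open Agreement

module Bags {σ : Signature} {k : ℕ} {A B : Structure σ} (G : Game k A B) {n : ℕ} where
  open Game G
  open import Data.List.Membership.DecPropositional (FinP._≟_ {n}) using (_∈?_)

  Bag = List (Fin n)

  Linked : Vec (Fin (size A)) n → Vec (Fin (size B)) n → Bag → Set
  Linked g g' xs = colA (g ⊙ fromList xs) ≡ colB (g' ⊙ fromList xs)

  linked-vec : ∀ g g' xs {m} (t : Vec (Fin n) m) → length xs ≤ k → m ≤ k → Linked g g' xs → (∀ i → lookup t i ∈ xs) →
    colA (g ⊙ t) ≡ colB (g' ⊙ t)
  linked-vec g g' xs t xs≤k m≤k e p with indices xs t p
  ... | s , refl = subst₂ (λ u v → colA u ≡ colB v) (⊙-⊙ g (fromList xs) s) (⊙-⊙ g' (fromList xs) s) (rename xs≤k m≤k e s)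

  linked-⊆ : ∀ g g' xs ys → length xs ≤ k → length ys ≤ k → (∀ {x} → x ∈ xs → x ∈ ys) → Linked g g' ys → Linked g g' xs
  linked-⊆ g g' xs ys xs≤k ys≤k p e = linked-vec g g' ys (fromList xs) ys≤k xs≤k e (λ i → p (lookup-fromList-∈ xs i))

  linked-cong : ∀ g g' h h' xs → (∀ {x} → x ∈ xs → lookup g x ≡ lookup h x) → (∀ {x} → x ∈ xs → lookup g' x ≡ lookup h' x) →
    Linked g g' xs → Linked h h' xs
  linked-cong g g' h h' xs p p' e = subst₂ (λ u v → colA u ≡ colB v) (⊙-cong-∈ g h xs p) (⊙-cong-∈ g' h' xs p') e

  linked-[] : ∀ {g g'} → Linked g g' []
  linked-[] = start

  -- The running intersection property of a list of bags, relative to earlier bags P.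
  RIP : List Bag → List Bag → Set
  RIP P [] = ⊤
  RIP P (b ∷ bs) = length b ≤ k × Unique b × (∃ λ p → p ∈ [] ∷ P × (∀ {x} → x ∈ b → x ∈ concat P → x ∈ p)) × RIP (b ∷ P) bs

  module _ (φ : Vec (Fin (size A)) n → ℕ) (φ' : Vec (Fin (size B)) n → ℕ) where

    -- Each vertex of `zs` is summed over in turn, and the bijection of the game reindexes the sum
    -- over B. The pebbles lie on `xs` only, not on all of `D`, which keeps their number within `k`.
    -- The continuation takes over once all of `zs` is placed.
    add-vertices : ∀ zs xs D g g' → All (_∉ D) zs → Unique zs → (∀ {x} → x ∈ xs → x ∈ D) → Linked g g' xs → length zs + length xs ≤ k →
      (∀ h h' → (∀ {x} → x ∈ D → lookup g x ≡ lookup h x) → (∀ {x} → x ∈ D → lookup g' x ≡ lookup h' x) → Linked h h' (zs ʳ++ xs) →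
         sumAgreeing (zs ʳ++ D) h φ ≡ sumAgreeing (zs ʳ++ D) h' φ') →
      sumAgreeing D g φ ≡ sumAgreeing D g' φ'
    add-vertices [] xs D g g' _ _ _ e _ cont = cont g g' (λ _ → refl) (λ _ → refl) e
    add-vertices (z ∷ zs) xs D g g' (z∉D ∷ zs∉D) (z∉zs ∷ uniq) sub e bound cont =
      trans (sumAgreeing-∷ g φ z∉D) (trans (sum-cong-≗ {size A} each)
        (trans (sym (sum-permute (λ d → sumAgreeing (z ∷ D) (g' [ z ]≔ d) φ') π)) (sym (sumAgreeing-∷ g' φ' z∉D))))
      where
      move = extend (≤-trans (s≤s (m≤n+m (length xs) (length zs))) bound) e
      π = proj₁ move
      keep : ∀ {q} (u : Vec (Fin q) n) c {x} → x ∈ D → lookup u x ≡ lookup (u [ z ]≔ c) x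
      keep u c x∈D = sym (VecP.lookup∘update′ (λ { refl → z∉D x∈D }) u c)
      front : ∀ {q} (u : Vec (Fin q) n) c → c ∷ (u ⊙ fromList xs) ≡ (u [ z ]≔ c) ⊙ fromList (z ∷ xs)
      front u c = cong₂ _∷_ (sym (VecP.lookup∘update z u c)) (⊙-cong-∈ u (u [ z ]≔ c) xs (keep u c ∘ sub))
      each : ∀ c → sumAgreeing (z ∷ D) (g [ z ]≔ c) φ ≡ sumAgreeing (z ∷ D) (g' [ z ]≔ (π ⟨$⟩ʳ c)) φ'
      each c = add-vertices zs (z ∷ xs) (z ∷ D) (g [ z ]≔ c) (g' [ z ]≔ (π ⟨$⟩ʳ c))
        (All.tabulate (λ w∈ → λ { (here refl) → All.lookup z∉zs w∈ refl ; (there w∈D) → All.lookup zs∉D w∈ w∈D }))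
        uniq (λ { (here refl) → here refl ; (there x∈) → there (sub x∈) })
        (subst₂ (λ u v → colA u ≡ colB v) (front g c) (front g' (π ⟨$⟩ʳ c)) (proj₂ move c))
        (subst (_≤ k) (sym (+-suc (length zs) (length xs))) bound)
        (λ h h' p p' l → cont h h' (λ x∈ → trans (keep g c x∈) (p (there x∈))) (λ x∈ → trans (keep g' (π ⟨$⟩ʳ c) x∈) (p' (there x∈))) l)

    -- By running intersection the vertices of `b` placed before lie in one earlier bag, so their
    -- images are linked by renaming. Pebbles are kept on these alone and the new vertices of `b`
    -- are added, so the size of `b` is never exceeded.
    sum-transfer : ∀ bs P g g' → RIP P bs → All (Linked g g') P → All (λ p → length p ≤ k) P →
      (∀ h h' → All (Linked h h') (bs ʳ++ P) → φ h ≡ φ' h') → (∀ x → x ∈ concat (bs ʳ++ P)) →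
      sumAgreeing (concat P) g φ ≡ sumAgreeing (concat P) g' φ'
    sum-transfer [] P g g' _ l _ final cover = trans (sumAgreeing-full g φ cover) (trans (final g g' l) (sym (sumAgreeing-full g' φ' cover)))
    sum-transfer (b ∷ bs) P g g' (b≤k , uniq , (p , p∈ , rip) , rest) l lens final cover =
      add-vertices new old D g g' (AllP.all-filter (λ x → ¬? (x ∈? D)) b) (UniqueP.filter⁺ (λ x → ¬? (x ∈? D)) uniq)
        (λ x∈ → proj₂ (∈-filter⁻ (_∈? D) {xs = b} x∈)) old-linked
        (≤-trans (≤-reflexive (trans (cong (_+ length old) refl) new+old)) b≤k) continue
      where
      D = concat P
      new = filter (λ x → ¬? (x ∈? D)) b
      old = filter (_∈? D) b
      new+old : length new + length old ≡ length b
      new+old = count b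
        where
        count : ∀ b → length (filter (λ x → ¬? (x ∈? D)) b) + length (filter (_∈? D) b) ≡ length b
        count [] = refl
        count (x ∷ b) with x ∈? D
        ... | yes _ = trans (+-suc _ _) (cong suc (count b))
        ... | no _ = cong suc (count b)
      all-lens : All (λ p → length p ≤ k) ([] ∷ P)
      all-lens = z≤n ∷ lens
      all-linked : All (Linked g g') ([] ∷ P)
      all-linked = linked-[] {g} {g'} ∷ l
      old-linked : Linked g g' old
      old-linked = linked-⊆ g g' old p (≤-trans (ListP.length-filter (_∈? D) b) b≤k) (All.lookup all-lens p∈)
        (λ x∈ → let (x∈b , x∈D) = ∈-filter⁻ (_∈? D) {xs = b} x∈ in rip x∈b x∈D) (All.lookup all-linked p∈)
      split : ∀ {x} → x ∈ b → x ∈ new ⊎ x ∈ old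
      split {x} x∈b with x ∈? D
      ... | yes x∈D = inj₂ (∈-filter⁺ (_∈? D) x∈b x∈D)
      ... | no x∉D = inj₁ (∈-filter⁺ (λ x → ¬? (x ∈? D)) x∈b x∉D)
      into : ∀ {x} zs ws → x ∈ zs ⊎ x ∈ ws → x ∈ zs ʳ++ ws
      into [] ws (inj₂ x∈) = x∈
      into (z ∷ zs) ws (inj₁ (here refl)) = into zs (z ∷ ws) (inj₂ (here refl))
      into (z ∷ zs) ws (inj₁ (there x∈)) = into zs (z ∷ ws) (inj₁ x∈)
      into (z ∷ zs) ws (inj₂ x∈) = into zs (z ∷ ws) (inj₂ (there x∈))
      out : ∀ {x} zs ws → x ∈ zs ʳ++ ws → x ∈ zs ⊎ x ∈ ws
      out [] ws x∈ = inj₂ x∈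
      out (z ∷ zs) ws x∈ with out zs (z ∷ ws) x∈
      ... | inj₁ x∈zs = inj₁ (there x∈zs)
      ... | inj₂ (here refl) = inj₁ (here refl)
      ... | inj₂ (there x∈ws) = inj₂ x∈ws
      to : ∀ {x} → x ∈ new ʳ++ D → x ∈ b ++ D
      to x∈ with out new D x∈
      ... | inj₁ x∈new = ∈-++⁺ˡ (proj₁ (∈-filter⁻ (λ x → ¬? (x ∈? D)) {xs = b} x∈new))
      ... | inj₂ x∈D = ∈-++⁺ʳ b x∈D
      from : ∀ {x} → x ∈ b ++ D → x ∈ new ʳ++ D
      from x∈ with ∈-++⁻ b x∈
      ... | inj₂ x∈D = into new D (inj₂ x∈D)
      ... | inj₁ x∈b with split x∈b
      ... | inj₁ x∈new = into new D (inj₁ x∈new)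
      ... | inj₂ x∈old = into new D (inj₂ (proj₂ (∈-filter⁻ (_∈? D) {xs = b} x∈old)))
      continue : ∀ h h' → (∀ {x} → x ∈ D → lookup g x ≡ lookup h x) → (∀ {x} → x ∈ D → lookup g' x ≡ lookup h' x) →
        Linked h h' (new ʳ++ old) → sumAgreeing (new ʳ++ D) h φ ≡ sumAgreeing (new ʳ++ D) h' φ'
      continue h h' e e' lk = trans (sumAgreeing-⊆ h φ to from) (trans
        (sum-transfer bs (b ∷ P) h h' rest
          (linked-⊆ h h' b (new ʳ++ old) b≤k (≤-trans (≤-reflexive (trans (ListP.length-ʳ++ new) new+old)) b≤k)
             (λ x∈ → into new old (split x∈)) lk
           ∷ All.tabulate (λ {p} p∈P → linked-cong g g' h h' p (λ x∈ → e (∈-concat⁺′ x∈ p∈P)) (λ x∈ → e' (∈-concat⁺′ x∈ p∈P)) (All.lookup l p∈P)))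
          (b≤k ∷ lens) final cover)
        (sym (sumAgreeing-⊆ h' φ' to from)))

-- From tree-decompositions to sequences of bags

elements : ∀ {n} → Subset n → List (Fin n)
elements [] = []
elements (inside ∷ p) = zero ∷ List.map suc (elements p)
elements (outside ∷ p) = List.map suc (elements p)

length-elements : ∀ {n} (p : Subset n) → length (elements p) ≡ ∣ p ∣
length-elements [] = refl
length-elements (inside ∷ p) = cong suc (trans (ListP.length-map suc (elements p)) (length-elements p))
length-elements (outside ∷ p) = trans (ListP.length-map suc (elements p)) (length-elements p)

∈-elements⁺ : ∀ {n} {x : Fin n} (p : Subset n) → x Subset.∈ p → x ∈ elements p
∈-elements⁺ (inside ∷ p) Vec.here = here refl
∈-elements⁺ (inside ∷ p) (Vec.there x∈) = there (∈-map⁺ suc (∈-elements⁺ p x∈))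
∈-elements⁺ (outside ∷ p) (Vec.there x∈) = ∈-map⁺ suc (∈-elements⁺ p x∈)

∈-elements⁻ : ∀ {n} {x : Fin n} (p : Subset n) → x ∈ elements p → x Subset.∈ p
∈-elements⁻ (inside ∷ p) (here refl) = Vec.here
∈-elements⁻ (inside ∷ p) (there x∈) with ∈-map⁻ suc x∈
... | _ , y∈ , refl = Vec.there (∈-elements⁻ p y∈)
∈-elements⁻ (outside ∷ p) x∈ with ∈-map⁻ suc x∈
... | _ , y∈ , refl = Vec.there (∈-elements⁻ p y∈)

elements-unique : ∀ {n} (p : Subset n) → Unique (elements p)
elements-unique [] = []
elements-unique (inside ∷ p) = All.tabulate (λ x∈ → λ { refl → case ∈-map⁻ suc x∈ of λ () }) ∷ UniqueP.map⁺ FinP.suc-injective (elements-unique p)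
elements-unique (outside ∷ p) = UniqueP.map⁺ FinP.suc-injective (elements-unique p)

data Below (G : Tree) (r : Node G) : Node G → Set where
  self  : Below G r r
  child : ∀ i v → toℕ v ≡ toℕ (parent G i) → Below G r v → Below G r (suc i)

below-≤ : ∀ {G : Tree} {r u : Node G} → Below G r u → toℕ r ≤ toℕ u
below-≤ self = ≤-refl
below-≤ {G} (child i v e b) = ≤-trans (below-≤ b) (≤-trans (≤-reflexive e) (≤-trans (s≤s⁻¹ (FinP.toℕ<n (parent G i))) (n≤1+n _)))

walk-head : ∀ {G P} {u w : Node G} → Walk G P u w → P u
walk-head (stop p) = p
walk-head (step p _ _) = p

-- The only edge leaving the subtree below `suc i` leads to its parent, so every walk out of the
-- subtree visits the parent.
walk-exit : ∀ {G P u w} i v → toℕ v ≡ toℕ (parent G i) → Walk G P u w → Below G (suc i) u → ¬ Below G (suc i) w → P v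
walk-exit i v e (stop _) b ¬b = ⊥-elim (¬b b)
walk-exit i v e (step _ (inj₂ (i' , refl , e')) w) b ¬b = walk-exit i v e w (child i' _ e' b) ¬b
walk-exit {P = P} i v e (step _ (inj₁ (i' , refl , e')) w) self ¬b = subst P (FinP.toℕ-injective (trans e' (sym e))) (walk-head w)
walk-exit {G} i v e (step _ (inj₁ (i' , refl , e')) w) (child .i' v' e'' b) ¬b =
  walk-exit i v e w (subst (Below G (suc i)) (FinP.toℕ-injective (trans e'' (sym e'))) b) ¬b

all-cong : ∀ {X : Set} {p q : X → Bool} (xs : List X) → (∀ x → p x ≡ q x) → all p xs ≡ all q xs
all-cong [] e = refl
all-cong (x ∷ xs) e = cong₂ _∧_ (e x) (all-cong xs e)

module _ {σ : Signature} {k : ℕ} (1≤k : 1 ≤ k) {A B : Structure σ} (G : Game k A B) where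
  open Game G

  size-equal : size A ≡ size B
  size-equal = sum-one (size A) (size B) (sum-permute (λ _ → 1) (proj₁ (extend {a = []} {b = []} 1≤k start)))
    where
    const : ∀ n → sum {n} (λ _ → 1) ≡ n
    const zero = refl
    const (suc n) = cong suc (const n)
    sum-one : ∀ m n → sum {n} (λ _ → 1) ≡ sum {m} (λ _ → 1) → m ≡ n
    sum-one m n e = sym (trans (sym (const n)) (trans e (const m)))

  module _ {n} (bs : List (List (Fin n))) (rip : Bags.RIP G [] bs) (cover : ∀ x → x ∈ concat (bs ʳ++ []))
    (φ : Vec (Fin (size A)) n → ℕ) (φ' : Vec (Fin (size B)) n → ℕ)
    (final : ∀ h h' → All (Bags.Linked G h h') (bs ʳ++ []) → φ h ≡ φ' h') where

    from-start : Vec (Fin (size A)) n → Vec (Fin (size B)) n → ΣV n φ ≡ ΣV n φ'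
    from-start g g' = trans (sym (sumAgreeing-[] g φ)) (trans
      (Bags.sum-transfer G φ φ' bs [] g g' rip [] [] final cover) (sumAgreeing-[] g' φ'))

  ΣV-transfer : ∀ {n} (bs : List (List (Fin n))) → Bags.RIP G [] bs → (∀ x → x ∈ concat (bs ʳ++ [])) →
    (φ : Vec (Fin (size A)) n → ℕ) (φ' : Vec (Fin (size B)) n → ℕ) →
    (∀ h h' → All (Bags.Linked G h h') (bs ʳ++ []) → φ h ≡ φ' h') → ΣV n φ ≡ ΣV n φ'
  ΣV-transfer {zero} bs rip cover φ φ' final = from-start bs rip cover φ φ' final [] []
  ΣV-transfer {suc n} bs rip cover φ φ' final = go (size A) refl
    where
    go : ∀ s → size A ≡ s → ΣV (suc n) φ ≡ ΣV (suc n) φ'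
    -- Over an empty universe there is no base vector to start from, but both sums are empty because
    -- the sizes agree.
    go zero e = trans (sum-none _ e) (sym (sum-none _ (trans (sym size-equal) e)))
    go (suc s) e = from-start bs rip cover φ φ' final
      (Vec.replicate (suc n) (subst Fin (sym e) zero)) (Vec.replicate (suc n) (subst Fin (trans (sym e) size-equal) zero))

  module _ (X : Structure σ) (D : TreeDecomposition X) (w<k : width D < k) where
    private
      n = size X
      V = Node (tree D)

      bagOf : V → List (Fin n)
      bagOf v = elements (bag D v)

      ⊔-bound : (vs : List V) → ∀ {v} → v ∈ vs → ∣ bag D v ∣ ≤ List.foldr (λ v m → ∣ bag D v ∣ ⊔ m) 0 vs
      ⊔-bound (v ∷ vs) (here refl) = m≤m⊔n _ _
      ⊔-bound (v ∷ vs) (there v∈) = ≤-trans (⊔-bound vs v∈) (m≤n⊔m _ _)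

      bag-≤ : ∀ v → length (bagOf v) ≤ k
      bag-≤ v = ≤-trans (≤-reflexive (length-elements (bag D v))) (≤-trans (⊔-bound (allFin _) (∈-allFin v)) (pred-bound _ w<k))
        where
        pred-bound : ∀ m → m ∸ 1 < k → m ≤ k
        pred-bound zero _ = z≤n
        pred-bound (suc m) m<k = m<k

      nodesFrom : ∀ r j → r + j ≡ suc (N (tree D)) → List V
      nodesFrom zero j e = []
      nodesFrom (suc r) j e = fromℕ< (subst (j <_) e (s≤s (m≤n+m j r))) ∷ nodesFrom r (suc j) (trans (+-suc r j) e)

      Before : ℕ → List V → Set
      Before j vs = ∀ v → (toℕ v < j → v ∈ vs) × (v ∈ vs → toℕ v < j)

      before-suc : ∀ {j vs} u → toℕ u ≡ j → Before j vs → Before (suc j) (u ∷ vs)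
      before-suc {j} {vs} u e bf v = to , λ { (here refl) → s≤s (≤-reflexive e) ; (there v∈) → m≤n⇒m≤1+n (proj₂ (bf v) v∈) }
        where
        to : toℕ v < suc j → v ∈ u ∷ vs
        to v<1+j with toℕ v ≟ j
        ... | yes p = here (FinP.toℕ-injective (trans p (sym e)))
        ... | no ≢ = there (proj₁ (bf v) (≤∧≢⇒< (s≤s⁻¹ v<1+j) ≢))

      -- The bag of the parent serves. Descendants have larger numbers, so an earlier node is not
      -- below `u`, and the walk to it through bags containing x passes the parent. The root has no
      -- earlier nodes and takes the empty bag.
      intersection : ∀ u vs → Before (toℕ u) vs →
        ∃ λ p → p ∈ [] ∷ List.map bagOf vs × (∀ {x} → x ∈ bagOf u → x ∈ concat (List.map bagOf vs) → x ∈ p)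
      intersection zero vs bf = [] , here refl , λ _ x∈ → case ∈-concat⁻′ (List.map bagOf vs) x∈ of λ { (_ , _ , p∈) →
        case ∈-map⁻ bagOf p∈ of λ { (v , v∈ , _) → case proj₂ (bf v) v∈ of λ () } }
      intersection u@(suc i) vs bf = bagOf pv , there (∈-map⁺ bagOf (proj₁ (bf pv) pv<u)) , sub
        where
        pv = fromℕ< (≤-trans (FinP.toℕ<n (parent (tree D) i)) (s≤s (<⇒≤ (FinP.toℕ<n i))))
        pv≡ : toℕ pv ≡ toℕ (parent (tree D) i)
        pv≡ = FinP.toℕ-fromℕ< _
        pv<u : toℕ pv < toℕ u
        pv<u = subst (_< toℕ u) (sym pv≡) (FinP.toℕ<n (parent (tree D) i))
        sub : ∀ {x} → x ∈ bagOf u → x ∈ concat (List.map bagOf vs) → x ∈ bagOf pv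
        sub {x} x∈u x∈ with ∈-concat⁻′ (List.map bagOf vs) x∈
        ... | _ , x∈p , p∈ with ∈-map⁻ bagOf p∈
        ... | v , v∈ , refl = ∈-elements⁺ (bag D pv) (walk-exit i pv pv≡
          (connected D x u v (∈-elements⁻ (bag D u) x∈u) (∈-elements⁻ (bag D v) x∈p)) self
          (λ b → <⇒≱ (proj₂ (bf v) v∈) (below-≤ b)))

      -- An element that occurs in no constraint may lie in no bag, yet it contributes to the count.
      -- Singleton bags at the end guarantee that every element is summed over.
      singles : List (List (Fin n))
      singles = List.map (_∷ []) (allFin n)

      rip-singles : ∀ ss P → All (λ b → length b ≡ 1) ss → Bags.RIP G P ss
      rip-singles [] P _ = tt
      rip-singles ((x ∷ []) ∷ ss) P (_ ∷ al) = 1≤k , [] ∷ [] , single , rip-singles ss ((x ∷ []) ∷ P) al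
        where
        open import Data.List.Membership.DecPropositional (FinP._≟_ {n}) using (_∈?_)
        single : ∃ λ p → p ∈ [] ∷ P × (∀ {y} → y ∈ x ∷ [] → y ∈ concat P → y ∈ p)
        single with x ∈? concat P
        ... | no x∉ = [] , here refl , λ { (here refl) x∈ → ⊥-elim (x∉ x∈) }
        ... | yes x∈ with ∈-concat⁻′ P x∈
        ... | p , x∈p , p∈ = p , there p∈ , λ { (here refl) _ → x∈p }

      schedule : ∀ r j e vs → Before j vs → Bags.RIP G (List.map bagOf vs) (List.map bagOf (nodesFrom r j e) ++ singles)
      schedule zero j e vs bf = rip-singles singles _ (AllP.map⁺ (All.universal (λ _ → refl) (allFin n)))
      schedule (suc r) j e vs bf = bag-≤ u , elements-unique (bag D u) , intersection u vs (subst (λ i → Before i vs) (sym u≡) bf) ,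
          schedule r (suc j) _ (u ∷ vs) (before-suc u u≡ bf)
        where
        u = fromℕ< (subst (j <_) e (s≤s (m≤n+m j r)))
        u≡ : toℕ u ≡ j
        u≡ = FinP.toℕ-fromℕ< _

      nodes-complete : ∀ r j e v → j ≤ toℕ v → v ∈ nodesFrom r j e
      nodes-complete zero j refl v j≤v = ⊥-elim (<⇒≱ (FinP.toℕ<n v) j≤v)
      nodes-complete (suc r) j e v j≤v with j ≟ toℕ v
      ... | yes p = here (FinP.toℕ-injective (trans (sym p) (sym (FinP.toℕ-fromℕ< _))))
      ... | no ≢ = there (nodes-complete r (suc j) _ v (≤∧≢⇒< j≤v ≢))

      nodes = nodesFrom (suc (N (tree D))) 0 (+-identityʳ _)
      bags = List.map bagOf nodes ++ singles

      ∈-bags : ∀ {b} → b ∈ bags → b ∈ bags ʳ++ []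
      ∈-bags {b} b∈ = subst (b ∈_) (sym (ListP.ʳ++-defn bags)) (∈-++⁺ˡ (reverse⁺ b∈))
        where open import Data.List.Relation.Unary.Any.Properties using (reverse⁺)

      homomorphic : ∀ h h' → All (Bags.Linked G h h') (bags ʳ++ []) → [ isHom X A h ] ≡ [ isHom X B h' ]
      homomorphic h h' links = cong [_] (all-cong (allFin _) λ R → all-cong (allVecs (ar σ R) n) (tuple R))
        where
        tuple : ∀ R t → (not (rel X R t) ∨ rel A R (h ⊙ t)) ≡ (not (rel X R t) ∨ rel B R (h' ⊙ t))
        tuple R t with rel X R t in eq
        ... | false = refl
        ... | true with covers D R t (subst T (sym eq) tt)
        ... | v , inside-v with indices (bagOf v) t (λ i → ∈-elements⁺ (bag D v) (inside-v i))
        ... | s , refl = subst₂ (λ a b → rel A R a ≡ rel B R b) (⊙-⊙ h (fromList (bagOf v)) s) (⊙-⊙ h' (fromList (bagOf v)) s)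
          (atoms (bag-≤ v) (All.lookup links (∈-bags (∈-++⁺ˡ (∈-map⁺ bagOf (nodes-complete (suc (N (tree D))) 0 (+-identityʳ _) v z≤n))))) R s)

    hom-equal : hom X A ≡ hom X B
    hom-equal = trans (hom-ΣV X A) (trans
      (ΣV-transfer bags (schedule (suc (N (tree D))) 0 (+-identityʳ _) [] (λ v → (λ ()) , λ ()))
        (λ x → ∈-concat⁺′ (here refl) (∈-bags (∈-++⁺ʳ (List.map bagOf nodes) (∈-map⁺ (_∷ []) (∈-allFin x)))))
        (λ h → [ isHom X A h ]) (λ h → [ isHom X B h ]) homomorphic)
      (sym (hom-ΣV X B)))

  game⇒hom : (X : Structure σ) → TreewidthLess X k → hom X A ≡ hom X B
  game⇒hom X (D , w<k) = hom-equal X D w<k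

-- Tests as homomorphism counts

T-∧⁺ : ∀ {a b} → T a → T b → T (a ∧ b)
T-∧⁺ p q = Equivalence.from BoolP.T-∧ (p , q)

T-∧⁻ : ∀ {a b} → T (a ∧ b) → T a × T b
T-∧⁻ = Equivalence.to BoolP.T-∧

T-⇔⇒≡ : ∀ {a b} → (T a → T b) → (T b → T a) → a ≡ b
T-⇔⇒≡ {true} {true} f g = refl
T-⇔⇒≡ {true} {false} f g = ⊥-elim (f tt)
T-⇔⇒≡ {false} {true} f g = ⊥-elim (g tt)
T-⇔⇒≡ {false} {false} f g = refl

T-all⁺ : ∀ {X : Set} {p : X → Bool} (xs : List X) → (∀ x → T (p x)) → T (all p xs)
T-all⁺ [] f = tt
T-all⁺ (x ∷ xs) f = T-∧⁺ (f x) (T-all⁺ xs f)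

T-all⁻ : ∀ {X : Set} {p : X → Bool} (xs : List X) → T (all p xs) → ∀ {x} → x ∈ xs → T (p x)
T-all⁻ (x ∷ xs) t (here refl) = proj₁ (T-∧⁻ t)
T-all⁻ (x ∷ xs) t (there x∈) = T-all⁻ xs (proj₂ (T-∧⁻ t)) x∈

T-imp⁺ : ∀ {a b} → (T a → T b) → T (not a ∨ b)
T-imp⁺ {true} f = f tt
T-imp⁺ {false} f = tt

T-imp⁻ : ∀ {a b} → T (not a ∨ b) → T a → T b
T-imp⁻ {true} t _ = t

isHom⁺ : ∀ {σ} (X A : Structure σ) h → (∀ R t → T (rel X R t) → T (rel A R (h ⊙ t))) → T (isHom X A h)
isHom⁺ {σ} X A h f = T-all⁺ (allFin _) (λ R → T-all⁺ (allVecs (ar σ R) (size X)) (λ t → T-imp⁺ (f R t)))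

isHom⁻ : ∀ {σ} (X A : Structure σ) h → T (isHom X A h) → ∀ R t → T (rel X R t) → T (rel A R (h ⊙ t))
isHom⁻ {σ} X A h p R t = T-imp⁻ (T-all⁻ (allVecs (ar σ R) (size X)) (T-all⁻ (allFin _) p (∈-allFin R)) (allVecs-complete _ t))

∣p∪q∣≤∣p∣+∣q∣ : ∀ {n} (p q : Subset n) → ∣ p ∪ q ∣ ≤ ∣ p ∣ + ∣ q ∣
∣p∪q∣≤∣p∣+∣q∣ [] [] = z≤n
∣p∪q∣≤∣p∣+∣q∣ (inside ∷ p) (inside ∷ q) = s≤s (≤-trans (∣p∪q∣≤∣p∣+∣q∣ p q) (+-monoʳ-≤ ∣ p ∣ (n≤1+n ∣ q ∣)))
∣p∪q∣≤∣p∣+∣q∣ (inside ∷ p) (outside ∷ q) = s≤s (∣p∪q∣≤∣p∣+∣q∣ p q)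
∣p∪q∣≤∣p∣+∣q∣ (outside ∷ p) (inside ∷ q) = ≤-trans (s≤s (∣p∪q∣≤∣p∣+∣q∣ p q)) (≤-reflexive (sym (+-suc ∣ p ∣ ∣ q ∣)))
∣p∪q∣≤∣p∣+∣q∣ (outside ∷ p) (outside ∷ q) = ∣p∪q∣≤∣p∣+∣q∣ p q

setOf : ∀ {n m} → Vec (Fin n) m → Subset n
setOf [] = Subset.⊥
setOf (x ∷ xs) = ⁅ x ⁆ ∪ setOf xs

∣setOf∣≤ : ∀ {n m} (xs : Vec (Fin n) m) → ∣ setOf xs ∣ ≤ m
∣setOf∣≤ {n} [] = ≤-reflexive (SubsetP.∣⊥∣≡0 n)
∣setOf∣≤ (x ∷ xs) = ≤-trans (∣p∪q∣≤∣p∣+∣q∣ ⁅ x ⁆ (setOf xs)) (+-mono-≤ (≤-reflexive (SubsetP.∣⁅x⁆∣≡1 x)) (∣setOf∣≤ xs))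

infix 4 _∈ᵛ_
_∈ᵛ_ : ∀ {X : Set} {m} → X → Vec X m → Set
y ∈ᵛ xs = ∃ λ j → lookup xs j ≡ y

∈-setOf⁺ : ∀ {n m} {y : Fin n} (xs : Vec (Fin n) m) → y ∈ᵛ xs → y Subset.∈ setOf xs
∈-setOf⁺ (x ∷ xs) (zero , refl) = SubsetP.p⊆p∪q (setOf xs) (SubsetP.x∈⁅x⁆ x)
∈-setOf⁺ (x ∷ xs) (suc j , e) = SubsetP.q⊆p∪q ⁅ x ⁆ (setOf xs) (∈-setOf⁺ xs (j , e))

∈-setOf⁻ : ∀ {n m} {y : Fin n} (xs : Vec (Fin n) m) → y Subset.∈ setOf xs → y ∈ᵛ xs
∈-setOf⁻ [] y∈ = ⊥-elim (SubsetP.∉⊥ y∈)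
∈-setOf⁻ (x ∷ xs) y∈ with SubsetP.x∈p∪q⁻ ⁅ x ⁆ (setOf xs) y∈
... | inj₁ y∈x = zero , sym (SubsetP.x∈⁅y⁆⇒x≡y x y∈x)
... | inj₂ y∈xs = let (j , e) = ∈-setOf⁻ xs y∈xs in suc j , e

lookup-take : ∀ {X : Set} l {m} (xs : Vec X (l + m)) y → lookup (take l xs) y ≡ lookup xs (y ↑ˡ m)
lookup-take (suc l) (x ∷ xs) zero = refl
lookup-take (suc l) (x ∷ xs) (suc y) = lookup-take l xs y

lookup-drop : ∀ {X : Set} l {m} (xs : Vec X (l + m)) y → lookup (drop l xs) y ≡ lookup xs (l ↑ʳ y)
lookup-drop zero xs y = refl
lookup-drop (suc l) (x ∷ xs) y = lookup-drop l xs y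

walk-append : ∀ {G P} {u v w : Node G} → Walk G P u v → Walk G P v w → Walk G P u w
walk-append (stop _) w = w
walk-append (step p a w) w' = step p a (walk-append w w')

walk-reverse : ∀ {G P} {u v : Node G} → Walk G P u v → Walk G P v u
walk-reverse (stop p) = stop p
walk-reverse {G} {P} (step p a w) = walk-append (walk-reverse w) (step (first w) (flip a) (stop p))
  where
  first : ∀ {u v} → Walk G P u v → P u
  first (stop p) = p
  first (step p _ _) = p
  flip : ∀ {u v} → Adj G u v → Adj G v u
  flip (inj₁ x) = inj₂ x
  flip (inj₂ x) = inj₁ x

module Canonical {σ : Signature} {k : ℕ} where

  HomTest = Test σ k ⊤

  count : ⊤ → ℕ → ℕ
  count _ x = x

  variables : ∀ {m} → HomTest m → ℕ
  variables one = 0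
  variables (atom _ _) = 0
  variables (prod t u) = variables t + variables u
  variables (ex _ _ t) = suc (variables t)
  variables (relab _ t) = variables t

  sat : (A : Structure σ) → ∀ {m} (t : HomTest m) → Vec (Fin (size A)) m → Vec (Fin (size A)) (variables t) → Bool
  sat A one a v = true
  sat A (atom R xs) a v = rel A R (a ⊙ xs)
  sat A (prod t u) a v = sat A t a (take (variables t) v) ∧ sat A u a (drop (variables t) v)
  sat A (ex _ _ t) a v = sat A t (head v ∷ a) (tail v)
  sat A (relab s t) a v = sat A t (a ⊙ s) v

  -- The prenex form of a test: all its sums move to the front, leaving the indicator of a
  -- conjunction of atoms.
  value-sat : ∀ A {m} (t : HomTest m) a → value count A t a ≡ ΣV (variables t) (λ v → [ sat A t a v ])
  value-sat A one a = refl
  value-sat A (atom R xs) a = refl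
  value-sat A (prod t u) a = trans (cong₂ _*_ (value-sat A t a) (value-sat A u a))
    (trans (sym (ΣV-take-drop (variables t) (variables u) _ _)) (ΣV-cong (variables t + variables u) (λ v → sym ([∧] (sat A t a (take (variables t) v)) _))))
  value-sat A (ex _ _ t) a = sum-cong-≗ {size A} (λ c → value-sat A t (c ∷ a))
  value-sat A (relab s t) a = value-sat A t (a ⊙ s)

  module _ {N : ℕ} where

    -- The atoms of `t` when `env` names the free variables and `ι` the quantified ones. With `ι`
    -- the identity they are the constraints of the canonical structure of a conjunctive query.
    related : ∀ {m} (t : HomTest m) → Vec (Fin N) m → Vec (Fin N) (variables t) → ∀ R → Vec (Fin N) (ar σ R) → Bool
    related one env ι R x = false
    related (atom R' xs) env ι R x with R' FinP.≟ R
    ... | yes refl = ⌊ VecP.≡-dec FinP._≟_ (env ⊙ xs) x ⌋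
    ... | no _ = false
    related (prod t u) env ι R x = related t env (take (variables t) ι) R x ∨ related u env (drop (variables t) ι) R x
    related (ex _ _ t) env ι R x = related t (head ι ∷ env) (tail ι) R x
    related (relab s t) env ι R x = related t (env ⊙ s) ι R x

    related-atom : ∀ {m} R (xs : Vec (Fin m) (ar σ R)) env ι → T (related (atom R xs) env ι R (env ⊙ xs))
    related-atom R xs env ι with R FinP.≟ R
    ... | yes refl = subst T (sym (⌊⌋-true (VecP.≡-dec FinP._≟_ (env ⊙ xs) (env ⊙ xs)) refl)) tt
    ... | no R≢R = ⊥-elim (R≢R refl)

    Preserves : ∀ A → Vec (Fin (size A)) N → ∀ {m} (t : HomTest m) → Vec (Fin N) m → Vec (Fin N) (variables t) → Set
    Preserves A h t env ι = ∀ R x → T (related t env ι R x) → T (rel A R (h ⊙ x))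

    ⊙-take : ∀ {q} (h : Vec (Fin q) N) l {m} (ι : Vec (Fin N) (l + m)) → h ⊙ take l ι ≡ take l (h ⊙ ι)
    ⊙-take h l ι = sym (VecP.take-map (lookup h) l ι)

    ⊙-drop : ∀ {q} (h : Vec (Fin q) N) l {m} (ι : Vec (Fin N) (l + m)) → h ⊙ drop l ι ≡ drop l (h ⊙ ι)
    ⊙-drop h l ι = sym (VecP.drop-map (lookup h) l ι)

    preserves⇒sat : ∀ A h {m} (t : HomTest m) env ι → Preserves A h t env ι → T (sat A t (h ⊙ env) (h ⊙ ι))
    preserves⇒sat A h one env ι p = tt
    preserves⇒sat A h (atom R xs) env ι p = subst (T ∘ rel A R) (sym (⊙-⊙ h env xs)) (p R (env ⊙ xs) (related-atom R xs env ι))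
    preserves⇒sat A h (prod t u) env ι p = T-∧⁺
      (subst (T ∘ sat A t (h ⊙ env)) (⊙-take h (variables t) ι)
        (preserves⇒sat A h t env _ (λ R x r → p R x (Equivalence.from BoolP.T-∨ (inj₁ r)))))
      (subst (T ∘ sat A u (h ⊙ env)) (⊙-drop h (variables t) ι)
        (preserves⇒sat A h u env _ (λ R x r → p R x (Equivalence.from (BoolP.T-∨ {related t env (take (variables t) ι) R x}) (inj₂ r)))))
    preserves⇒sat A h (ex _ _ t) env (x ∷ ι) p = preserves⇒sat A h t (x ∷ env) ι p
    preserves⇒sat A h (relab s t) env ι p = subst (λ e → T (sat A t e (h ⊙ ι))) (sym (⊙-⊙ h env s)) (preserves⇒sat A h t (env ⊙ s) ι p)

    sat⇒preserves : ∀ A h {m} (t : HomTest m) env ι → T (sat A t (h ⊙ env) (h ⊙ ι)) → Preserves A h t env ι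
    sat⇒preserves A h (atom R' xs) env ι s R x r with R' FinP.≟ R
    ... | yes refl with VecP.≡-dec FinP._≟_ (env ⊙ xs) x
    ... | yes refl = subst (T ∘ rel A R) (⊙-⊙ h env xs) s
    sat⇒preserves A h (prod t u) env ι s R x r with T-∧⁻ s | Equivalence.to (BoolP.T-∨ {related t env (take (variables t) ι) R x}) r
    ... | st , su | inj₁ rt = sat⇒preserves A h t env _ (subst (T ∘ sat A t (h ⊙ env)) (sym (⊙-take h (variables t) ι)) st) R x rt
    ... | st , su | inj₂ ru = sat⇒preserves A h u env _ (subst (T ∘ sat A u (h ⊙ env)) (sym (⊙-drop h (variables t) ι)) su) R x ru
    sat⇒preserves A h (ex _ _ t) env (x ∷ ι) s = sat⇒preserves A h t (x ∷ env) ι s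
    sat⇒preserves A h (relab s' t) env ι s = sat⇒preserves A h t (env ⊙ s') ι (subst (λ e → T (sat A t e (h ⊙ ι))) (⊙-⊙ h env s') s)

    VarBag : Set
    VarBag = ∃ λ m → Vec (Fin N) m

    -- The bag of a quantified variable consists of it and of the variables in scope there.
    bagOf : ∀ {m} (t : HomTest m) → Vec (Fin N) m → Vec (Fin N) (variables t) → Fin (variables t) → VarBag
    bagOf (prod t u) env ι x = [ bagOf t env (take (variables t) ι) , bagOf u env (drop (variables t) ι) ]′ (splitAt (variables t) x)
    bagOf (ex _ _ t) env ι zero = _ , head ι ∷ env
    bagOf (ex _ _ t) env ι (suc x) = bagOf t (head ι ∷ env) (tail ι) x
    bagOf (relab s t) env ι x = bagOf t (env ⊙ s) ι x

    bagOf-≤ : ∀ {m} (t : HomTest m) env ι x → proj₁ (bagOf t env ι x) ≤ k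
    bagOf-≤ (prod t u) env ι x with splitAt (variables t) x
    ... | inj₁ y = bagOf-≤ t env _ y
    ... | inj₂ y = bagOf-≤ u env _ y
    bagOf-≤ (ex m<k _ t) env ι zero = m<k
    bagOf-≤ (ex _ _ t) env ι (suc x) = bagOf-≤ t _ _ x
    bagOf-≤ (relab s t) env ι x = bagOf-≤ t _ _ x

    bagOf-own : ∀ {m} (t : HomTest m) env ι x → lookup ι x ∈ᵛ proj₂ (bagOf t env ι x)
    bagOf-own (prod t u) env ι x with splitAt (variables t) x | FinP.join-splitAt (variables t) (variables u) x
    ... | inj₁ y | refl = subst (_∈ᵛ proj₂ (bagOf t env (take (variables t) ι) y)) (lookup-take (variables t) ι y) (bagOf-own t env _ y)
    ... | inj₂ y | refl = subst (_∈ᵛ proj₂ (bagOf u env (drop (variables t) ι) y)) (lookup-drop (variables t) ι y) (bagOf-own u env _ y)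
    bagOf-own (ex _ _ t) env (z ∷ ι) zero = zero , refl
    bagOf-own (ex _ _ t) env (z ∷ ι) (suc x) = bagOf-own t (z ∷ env) ι x
    bagOf-own (relab s t) env ι x = bagOf-own t (env ⊙ s) ι x

    -- Index of the enclosing node: 0 is the root, suc x the node of the variable x;
    -- p is the enclosing node of the whole test and o the number of variables preceding it.
    parentOf : ∀ {m} (t : HomTest m) → ℕ → ℕ → Fin (variables t) → ℕ
    parentOf (prod t u) p o x = [ parentOf t p o , parentOf u p (o + variables t) ]′ (splitAt (variables t) x)
    parentOf (ex _ _ t) p o zero = p
    parentOf (ex _ _ t) p o (suc x) = parentOf t (suc o) (suc o) x
    parentOf (relab s t) p o x = parentOf t p o x

    -- The labelling of `Tree` requires that parents precede their children; variables are numbered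
    -- in preorder for this reason.
    parentOf-≤ : ∀ {m} (t : HomTest m) p o x → p ≤ o → parentOf t p o x ≤ o + toℕ x
    parentOf-≤ (prod t u) p o x p≤o with splitAt (variables t) x | FinP.join-splitAt (variables t) (variables u) x
    ... | inj₁ y | refl = ≤-trans (parentOf-≤ t p o y p≤o) (≤-reflexive (cong (o +_) (sym (FinP.toℕ-↑ˡ y (variables u)))))
    ... | inj₂ y | refl = ≤-trans (parentOf-≤ u p (o + variables t) y (≤-trans p≤o (m≤m+n o _)))
      (≤-reflexive (trans (+-assoc o (variables t) (toℕ y)) (cong (o +_) (sym (FinP.toℕ-↑ʳ (variables t) y)))))
    parentOf-≤ (ex _ _ t) p o zero p≤o = ≤-trans p≤o (m≤m+n o 0)
    parentOf-≤ (ex _ _ t) p o (suc x) p≤o = ≤-trans (parentOf-≤ t (suc o) (suc o) x ≤-refl) (≤-reflexive (sym (+-suc o (toℕ x))))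
    parentOf-≤ (relab s t) p o x p≤o = parentOf-≤ t p o x p≤o

    Inherited : ∀ {m} (t : HomTest m) → Vec (Fin N) m → Vec (Fin N) (variables t) → ℕ → ℕ → Fin N → ℕ → Set
    Inherited t env ι p o y q = (y ∈ᵛ env × q ≡ p) ⊎ (∃ λ x' → q ≡ suc (o + toℕ x') × y ∈ᵛ proj₂ (bagOf t env ι x'))

    -- A bag is its own variable plus what was in scope before, and the latter already lies in the
    -- parent bag. Climbing from any bag that contains y therefore stays among such bags until the
    -- node of y is reached, which gives connectedness.
    bagOf-parent : ∀ {m} (t : HomTest m) env ι p o x y → y ∈ᵛ proj₂ (bagOf t env ι x) →
      y ≡ lookup ι x ⊎ Inherited t env ι p o y (parentOf t p o x)
    bagOf-parent (prod t u) env ι p o x y y∈ with splitAt (variables t) x | FinP.join-splitAt (variables t) (variables u) x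
    bagOf-parent (prod t u) env ι p o x y y∈ | inj₁ z | refl with bagOf-parent t env (take (variables t) ι) p o z y y∈
    ... | inj₁ e = inj₁ (trans e (lookup-take (variables t) ι z))
    ... | inj₂ (inj₁ e) = inj₂ (inj₁ e)
    ... | inj₂ (inj₂ (x' , q , y∈')) = inj₂ (inj₂ (x' ↑ˡ variables u ,
      trans q (cong (λ z → suc (o + z)) (sym (FinP.toℕ-↑ˡ x' (variables u)))) ,
      subst (λ z → y ∈ᵛ proj₂ ([ bagOf t env (take (variables t) ι) , bagOf u env (drop (variables t) ι) ]′ z)) (sym (FinP.splitAt-↑ˡ (variables t) x' (variables u))) y∈'))
    bagOf-parent (prod t u) env ι p o x y y∈ | inj₂ z | refl with bagOf-parent u env (drop (variables t) ι) p (o + variables t) z y y∈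
    ... | inj₁ e = inj₁ (trans e (lookup-drop (variables t) ι z))
    ... | inj₂ (inj₁ e) = inj₂ (inj₁ e)
    ... | inj₂ (inj₂ (x' , q , y∈')) = inj₂ (inj₂ (variables t ↑ʳ x' ,
      trans q (cong suc (trans (+-assoc o (variables t) (toℕ x')) (cong (o +_) (sym (FinP.toℕ-↑ʳ (variables t) x'))))) ,
      subst (λ z → y ∈ᵛ proj₂ ([ bagOf t env (take (variables t) ι) , bagOf u env (drop (variables t) ι) ]′ z)) (sym (FinP.splitAt-↑ʳ (variables t) (variables u) x')) y∈'))
    bagOf-parent (ex _ _ t) env (z ∷ ι) p o zero y (zero , e) = inj₁ (sym e)
    bagOf-parent (ex _ _ t) env (z ∷ ι) p o zero y (suc j , e) = inj₂ (inj₁ ((j , e) , refl))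
    bagOf-parent (ex _ _ t) env (z ∷ ι) p o (suc x) y y∈ with bagOf-parent t (z ∷ env) ι (suc o) (suc o) x y y∈
    ... | inj₁ e = inj₁ e
    ... | inj₂ (inj₁ (y∈' , q)) = inj₂ (inj₂ (zero , trans q (cong suc (sym (+-identityʳ o))) , y∈'))
    ... | inj₂ (inj₂ (x' , q , y∈')) = inj₂ (inj₂ (suc x' , trans q (cong suc (sym (+-suc o (toℕ x')))) , y∈'))
    bagOf-parent (relab s t) env ι p o x y y∈ with bagOf-parent t (env ⊙ s) ι p o x y y∈
    ... | inj₁ e = inj₁ e
    ... | inj₂ (inj₁ ((j , e) , q)) = inj₂ (inj₁ ((lookup s j , trans (sym (lookup-⊙ env s j)) e) , q))
    ... | inj₂ (inj₂ r) = inj₂ (inj₂ r)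

    -- An atom uses only variables in scope, and these form the bag of the innermost enclosing
    -- quantifier, or `env` if there is none.
    related-covered : ∀ {m} (t : HomTest m) env ι R x → T (related t env ι R x) →
      (∀ i → lookup x i ∈ᵛ env) ⊎ (∃ λ z → ∀ i → lookup x i ∈ᵛ proj₂ (bagOf t env ι z))
    related-covered (atom R' xs) env ι R x r with R' FinP.≟ R
    ... | yes refl with VecP.≡-dec FinP._≟_ (env ⊙ xs) x
    ... | yes refl = inj₁ (λ i → lookup xs i , sym (lookup-⊙ env xs i))
    related-covered (prod t u) env ι R x r with Equivalence.to (BoolP.T-∨ {related t env (take (variables t) ι) R x}) r
    related-covered (prod t u) env ι R x r | inj₁ rt with related-covered t env _ R x rt
    ... | inj₁ e = inj₁ e
    ... | inj₂ (z , c) = inj₂ (z ↑ˡ variables u , λ i →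
      subst (λ w → lookup x i ∈ᵛ proj₂ ([ bagOf t env (take (variables t) ι) , bagOf u env (drop (variables t) ι) ]′ w)) (sym (FinP.splitAt-↑ˡ (variables t) z (variables u))) (c i))
    related-covered (prod t u) env ι R x r | inj₂ ru with related-covered u env _ R x ru
    ... | inj₁ e = inj₁ e
    ... | inj₂ (z , c) = inj₂ (variables t ↑ʳ z , λ i →
      subst (λ w → lookup x i ∈ᵛ proj₂ ([ bagOf t env (take (variables t) ι) , bagOf u env (drop (variables t) ι) ]′ w)) (sym (FinP.splitAt-↑ʳ (variables t) (variables u) z)) (c i))
    related-covered (ex _ _ t) env (z ∷ ι) R x r with related-covered t (z ∷ env) ι R x r
    ... | inj₁ c = inj₂ (zero , c)
    ... | inj₂ (w , c) = inj₂ (suc w , c)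
    related-covered (relab s t) env ι R x r with related-covered t (env ⊙ s) ι R x r
    ... | inj₁ c = inj₁ (λ i → let (j , e) = c i in lookup s j , trans (sym (lookup-⊙ env s j)) e)
    ... | inj₂ c = inj₂ c

    -- A syntactic guarantee, independent of the names of the variables, that R is non-empty in the
    -- canonical structure.
    data Mentions (R : Fin (nsym σ)) : ∀ {m} → HomTest m → Set where
      here  : ∀ {m xs} → Mentions R {m} (atom R xs)
      left  : ∀ {m} {t u : HomTest m} → Mentions R t → Mentions R (prod t u)
      right : ∀ {m} {t u : HomTest m} → Mentions R u → Mentions R (prod t u)
      under : ∀ {m p} {t : HomTest (suc m)} → Mentions R t → Mentions R (ex p tt t)

    mentioned : ∀ {R m} {t : HomTest m} → Mentions R t → ∀ env ι → ∃ λ x → T (related t env ι R x)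
    mentioned {R} (here {xs = xs}) env ι = env ⊙ xs , related-atom R xs env ι
    mentioned {t = prod t u} (left p) env ι = let (x , r) = mentioned p env (take (variables t) ι) in x , Equivalence.from BoolP.T-∨ (inj₁ r)
    mentioned {R} {t = prod t u} (right p) env ι = let (x , r) = mentioned p env (drop (variables t) ι) in
      x , Equivalence.from (BoolP.T-∨ {related t env (take (variables t) ι) R x}) (inj₂ r)
    mentioned (under p) env ι = mentioned p (head ι ∷ env) (tail ι)

  module _ (t : HomTest 0) (mentions : ∀ R → Mentions {variables t} R t) where
    private
      N' = variables t
      ι = Vec.allFin N'

    canonical : Structure σ
    canonical = record
      { size = N'
      ; rel = related t [] ι
      ; nonempty = λ R → mentioned (mentions R) [] ι
      }

    -- The Chandra-Merlin correspondence with multiplicities: a map of the variables is a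
    -- homomorphism precisely when it satisfies all atoms of the test.
    hom-canonical : ∀ A → hom canonical A ≡ value count A t []
    hom-canonical A = trans (hom-ΣV canonical A) (trans (ΣV-cong N' λ h → cong [_] (T-⇔⇒≡
        (λ p → subst (T ∘ sat A t []) (⊙-id h) (preserves⇒sat A h t [] ι (isHom⁻ canonical A h p)))
        (λ p → isHom⁺ canonical A h (sat⇒preserves A h t [] ι (subst (T ∘ sat A t []) (sym (⊙-id h)) p)))))
      (sym (value-sat A t [])))

    private
      canonicalTree : Tree
      canonicalTree = record { N = N' ; parent = λ x → fromℕ< (s≤s (parentOf-≤ {N'} t 0 0 x z≤n)) }

      bagAt : Node canonicalTree → Subset N'
      bagAt zero = Subset.⊥
      bagAt (suc x) = setOf (proj₂ (bagOf t [] ι x))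

      bagAt-≤ : ∀ v → ∣ bagAt v ∣ ≤ k
      bagAt-≤ zero = ≤-trans (≤-reflexive (SubsetP.∣⊥∣≡0 N')) z≤n
      bagAt-≤ (suc x) = ≤-trans (∣setOf∣≤ (proj₂ (bagOf t [] ι x))) (bagOf-≤ t [] ι x)

      ascend : ∀ y u → Acc _<_ (toℕ u) → y Subset.∈ bagAt u → Walk canonicalTree (λ w → y Subset.∈ bagAt w) u (suc y)
      ascend y zero _ y∈ = ⊥-elim (SubsetP.∉⊥ y∈)
      ascend y (suc x) (acc rs) y∈ with bagOf-parent t [] ι 0 0 x y (∈-setOf⁻ (proj₂ (bagOf t [] ι x)) y∈)
      ... | inj₁ e = subst (λ z → Walk canonicalTree _ (suc z) (suc y)) (trans e (VecP.lookup-allFin x)) (stop (own y))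
        where
        own : ∀ y → y Subset.∈ bagAt (suc y)
        own y = ∈-setOf⁺ (proj₂ (bagOf t [] ι y)) (subst (_∈ᵛ proj₂ (bagOf t [] ι y)) (VecP.lookup-allFin y) (bagOf-own t [] ι y))
      ... | inj₂ (inj₁ ((() , _) , _))
      ... | inj₂ (inj₂ (x' , q , y∈')) = step y∈ (inj₁ (x , refl , sym (trans (FinP.toℕ-fromℕ< _) q)))
            (ascend y (suc x') (rs (s≤s (subst (_≤ toℕ x) q (parentOf-≤ {N'} t 0 0 x z≤n)))) (∈-setOf⁺ (proj₂ (bagOf t [] ι x')) y∈'))

    canonicalDecomposition : TreeDecomposition canonical
    canonicalDecomposition = record
      { tree = canonicalTree
      ; bag = bagAt
      ; covers = λ R x r → case related-covered t [] ι R x r of λ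
          -- An atom outside all quantifiers is nullary, so even the empty bag of the root covers
          -- it.
          { (inj₁ c) → zero , λ i → case c i of λ { (() , _) }
          ; (inj₂ (z , c)) → suc z , λ i → ∈-setOf⁺ (proj₂ (bagOf t [] ι z)) (c i) }
      ; connected = λ y u v y∈u y∈v → walk-append (ascend y u (<-wellFounded _) y∈u) (walk-reverse (ascend y v (<-wellFounded _) y∈v))
      }

    canonical-treewidth : 1 ≤ k → TreewidthLess canonical k
    canonical-treewidth 1≤k = canonicalDecomposition , shrink (max (allFin (suc N')))
      where
      max : ∀ vs → List.foldr (λ v m → ∣ bagAt v ∣ ⊔ m) 0 vs ≤ k
      max [] = z≤n
      max (v ∷ vs) = ⊔-lub (bagAt-≤ v) (max vs)
      shrink : ∀ {m} → m ≤ k → m ∸ 1 < k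
      shrink {zero} _ = 1≤k
      shrink {suc m} m≤k = m≤k

  closure : ∀ m → m ≤ k → HomTest m → HomTest 0
  closure zero _ t = t
  closure (suc m) m<k t = closure m (<⇒≤ m<k) (ex m<k tt t)

  sum-positive : ∀ {n} (f : Fin n → ℕ) i → f i ≢ 0 → sum f ≢ 0
  sum-positive f zero p e = p (m+n≡0⇒m≡0 _ e)
  sum-positive f (suc i) p e = sum-positive (f ∘ suc) i p (m+n≡0⇒n≡0 (f zero) e)

  closure-positive : ∀ A m p (t : HomTest m) v → value count A t v ≢ 0 → value count A (closure m p t) [] ≢ 0
  closure-positive A zero p t [] q = q
  closure-positive A (suc m) p t (c ∷ v) q = closure-positive A m (<⇒≤ p) (ex p tt t) v (sum-positive (λ c → value count A t (c ∷ v)) c q)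

  closure-mentions : ∀ {N} m p (t : HomTest m) R → Mentions {N} R t → Mentions {N} R (closure m p t)
  closure-mentions zero p t R q = q
  closure-mentions (suc m) p t R q = closure-mentions m (<⇒≤ p) _ R (under q)

  module _ (ar≤k : ∀ R → ar σ R ≤ k) where

    someTuple : Fin (nsym σ) → HomTest 0
    someTuple R = closure (ar σ R) (ar≤k R) (atom R (Vec.allFin _))

    someTuples : List (Fin (nsym σ)) → HomTest 0
    someTuples [] = one
    someTuples (R ∷ Rs) = prod (someTuple R) (someTuples Rs)

    -- Structures have non-empty relations, so the auxiliary factor is nonzero and can be cancelled.
    someTuples-positive : ∀ A Rs → value count A (someTuples Rs) [] ≢ 0
    someTuples-positive A [] ()
    someTuples-positive A (R ∷ Rs) e with m*n≡0⇒m≡0∨n≡0 (value count A (someTuple R) []) e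
    ... | inj₂ z = someTuples-positive A Rs z
    ... | inj₁ z with nonempty A R
    ... | x , r = closure-positive A (ar σ R) (ar≤k R) (atom R (Vec.allFin _)) x (λ z → case trans (sym (cong [_] (trans (cong (rel A R) (⊙-id x)) (T-true r)))) z of λ ()) z
      where
      T-true : ∀ {b} → T b → b ≡ true
      T-true {true} _ = refl

    someTuples-mentions : ∀ {N R} Rs → R ∈ Rs → Mentions {N} R (someTuples Rs)
    someTuples-mentions {R = R} (R ∷ Rs) (here refl) = left (closure-mentions (ar σ R) (ar≤k R) _ R here)
    someTuples-mentions (_ ∷ Rs) (there R∈) = right (someTuples-mentions Rs R∈)

    -- Multiplying by the number of tuples makes all relations of the canonical structure non-empty.
    hom⇒closed : 1 ≤ k → (A B : Structure σ) → ((X : Structure σ) → TreewidthLess X k → hom X A ≡ hom X B) →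
      ∀ (t : HomTest 0) → value count A t [] ≡ value count B t []
    -- The factor takes the same value in A and B by the same argument with `one` in place of `t`.
    hom⇒closed 1≤k A B h t = *-cancelʳ-≡ _ _ (value count A Z []) {{≢-nonZero (someTuples-positive A (allFin _))}}
        (trans (both t) (cong (value count B t [] *_) (sym tuples)))
      where
      Z = someTuples (allFin _)
      both : ∀ u → value count A u [] * value count A Z [] ≡ value count B u [] * value count B Z []
      both u = trans (sym (hom-canonical (prod u Z) mentions A)) (trans
          (h (canonical (prod u Z) mentions) (canonical-treewidth (prod u Z) mentions 1≤k)) (hom-canonical (prod u Z) mentions B))
        where
        mentions : ∀ R → Mentions R (prod u Z)
        mentions R = right (someTuples-mentions (allFin _) (∈-allFin R))
      tuples : value count A Z [] ≡ value count B Z []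
      tuples = trans (sym (+-identityʳ _)) (trans (both one) (+-identityʳ _))

-- Tests as formulas, and evaluation along the pebble game

threshold : ℕ → ℕ → ℕ
threshold q x = [ ⌊ q ≤? x ⌋ ]

threshold-separates : ∀ x y → x ≢ y → ∃ λ q → threshold q x ≢ threshold q y
threshold-separates x y x≢y with <-cmp x y
... | tri< x<y _ _ = y , λ e → case trans (sym (cong [_] (⌊⌋-false (y ≤? x) (<⇒≱ x<y)))) (trans e (cong [_] (⌊⌋-true (y ≤? y) ≤-refl))) of λ ()
... | tri≈ _ x≡y _ = ⊥-elim (x≢y x≡y)
... | tri> _ _ y<x = x , λ e → case trans (sym (cong [_] (⌊⌋-true (x ≤? x) ≤-refl))) (trans e (cong [_] (⌊⌋-false (x ≤? y) (<⇒≱ y<x)))) of λ ()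

module _ {σ : Signature} {k : ℕ} (A : Structure σ) where

  assign : (Fin k → Maybe (Fin (size A))) → Fin k → Fin (size A) → Fin k → Maybe (Fin (size A))
  assign ρ x c y = if ⌊ y FinP.≟ x ⌋ then just c else ρ y

  assign-self : ∀ ρ x c → assign ρ x c x ≡ just c
  assign-self ρ x c rewrite ⌊⌋-true (x FinP.≟ x) refl = refl

  assign-other : ∀ ρ x c y → y ≢ x → assign ρ x c y ≡ ρ y
  assign-other ρ x c y y≢x rewrite ⌊⌋-false (y FinP.≟ x) y≢x = refl

  eval-∃≥ : ∀ q x (φ : Formula σ k) ρ → eval A (∃≥ q x φ) ρ ≡ ⌊ q ≤? sum (λ c → [ eval A φ (assign ρ x c) ]) ⌋
  eval-∃≥ q x φ ρ = cong (λ z → ⌊ q ≤? z ⌋) (length-filter-allFin (λ c → eval A φ (assign ρ x c)))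

-- Pigeonhole: fewer than k variables in scope leave one free for requantification. Here the bound
-- on the scope of tests becomes a bound on the number of variables.
fresh : ∀ {k m} → m < k → (env : Vec (Fin k) m) → ∃ λ y → ∀ i → lookup env i ≢ y
fresh {k} {m} m<k env with FinP.any? (λ y → FinP.all? (λ i → ¬? (lookup env i FinP.≟ y)))
... | yes p = p
... | no none = ⊥-elim (<⇒≱ m<k (FinP.injective⇒≤ {f = proj₁ ∘ occurrence} (λ {y} {z} e →
      trans (sym (proj₂ (occurrence y))) (trans (cong (lookup env) e) (proj₂ (occurrence z))))))
  where
  occurrence : ∀ y → ∃ λ i → lookup env i ≡ y
  occurrence y with FinP.any? (λ i → lookup env i FinP.≟ y)
  ... | yes p = p
  ... | no ¬p = ⊥-elim (none (y , λ i e → ¬p (i , e)))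

module _ {σ : Signature} {k : ℕ} (x₀ : Fin k) where

  formula : ∀ {m} → Test σ k ℕ m → Vec (Fin k) m → Formula σ k
  -- At least zero elements satisfy anything, so this is true; the quantifier binds `x₀`, so it is
  -- closed.
  formula one env = ∃≥ 0 x₀ (equal x₀ x₀)
  formula (atom R xs) env = atom R (env ⊙ xs)
  formula (prod t u) env = conj (formula t env) (formula u env)
  formula (ex m<k q t) env = ∃≥ q (proj₁ (fresh m<k env)) (formula t (proj₁ (fresh m<k env) ∷ env))
  formula (relab s t) env = formula t (env ⊙ s)

  scoped-atom : ∀ {l} (b : Fin k → Bool) (xs : Vec (Fin k) l) → (∀ i → T (b (lookup xs i))) → T (Vec.foldr (λ _ → Bool) (λ x r → b x ∧ r) true xs)
  scoped-atom b [] p = tt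
  scoped-atom b (x ∷ xs) p = T-∧⁺ (p zero) (scoped-atom b xs (p ∘ suc))

  T-bound : ∀ y x (b : Fin k → Bool) → y ≡ x ⊎ T (b y) → T (⌊ y FinP.≟ x ⌋ ∨ b y)
  T-bound y x b (inj₁ e) rewrite ⌊⌋-true (y FinP.≟ x) e = tt
  T-bound y x b (inj₂ p) with ⌊ y FinP.≟ x ⌋
  ... | true = tt
  ... | false = p

  formula-scoped : ∀ {m} (t : Test σ k ℕ m) env (b : Fin k → Bool) → (∀ i → T (b (lookup env i))) → T (scoped b (formula t env))
  formula-scoped one env b p = T-∧⁺ (T-bound x₀ x₀ b (inj₁ refl)) (T-bound x₀ x₀ b (inj₁ refl))
  formula-scoped (atom R xs) env b p = scoped-atom b (env ⊙ xs) (λ i → subst (T ∘ b) (sym (lookup-⊙ env xs i)) (p (lookup xs i)))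
  formula-scoped (prod t u) env b p = T-∧⁺ (formula-scoped t env b p) (formula-scoped u env b p)
  formula-scoped (ex m<k q t) env b p = formula-scoped t (y ∷ env) _ λ
      { zero → T-bound y y b (inj₁ refl) ; (suc i) → T-bound (lookup env i) y b (inj₂ (p i)) }
    where y = proj₁ (fresh m<k env)
  formula-scoped (relab s t) env b p = formula-scoped t (env ⊙ s) b (λ i → subst (T ∘ b) (sym (lookup-⊙ env s i)) (p (lookup s i)))

  formula-value : ∀ A {m} (t : Test σ k ℕ m) env ρ a → (∀ i → ρ (lookup env i) ≡ just (lookup a i)) →
    value threshold A t a ≡ [ eval A (formula t env) ρ ]
  formula-value A one env ρ a p = refl
  formula-value A (atom R xs) env ρ a p = cong [_] (sym (eval-lookupAll A R (env ⊙ xs) ρ (just (a ⊙ xs)) (lookupAll-just A ρ (env ⊙ xs) (a ⊙ xs)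
    (λ i → trans (cong ρ (lookup-⊙ env xs i)) (trans (p (lookup xs i)) (cong just (sym (lookup-⊙ a xs i))))))))
  formula-value A (prod t u) env ρ a p = trans (cong₂ _*_ (formula-value A t env ρ a p) (formula-value A u env ρ a p)) (sym ([∧] (eval A (formula t env) ρ) _))
  formula-value A (ex m<k q t) env ρ a p = trans
      (cong (threshold q) (sum-cong-≗ {size A} (λ c → formula-value A t (y ∷ env) (assign A ρ y c) (c ∷ a) λ
        { zero → assign-self A ρ y c ; (suc i) → trans (assign-other A ρ y c (lookup env i) (proj₂ (fresh m<k env) i)) (p i) })))
      (cong [_] (sym (eval-∃≥ A q y (formula t (y ∷ env)) ρ)))
    where y = proj₁ (fresh m<k env)
  formula-value A (relab s t) env ρ a p = formula-value A t (env ⊙ s) ρ (a ⊙ s)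
    (λ i → trans (cong ρ (lookup-⊙ env s i)) (trans (p (lookup s i)) (cong just (sym (lookup-⊙ a s i)))))

  sameCk⇒closed : (A B : Structure σ) → SameCk k A B → ∀ (t : Test σ k ℕ 0) → value threshold A t [] ≡ value threshold B t []
  sameCk⇒closed A B same t = trans (formula-value A t [] _ [] (λ ())) (trans (cong [_] (T-⇔⇒≡ (proj₁ agree) (proj₂ agree)))
      (sym (formula-value B t [] _ [] (λ ()))))
    where agree = same (formula t []) (formula-scoped t [] _ (λ ()))

-- The first argument of E is the number of rounds that remain to be played.
record RoundGame {σ : Signature} (k : ℕ) (A B : Structure σ) : Set₁ where
  field
    E : ℕ → ∀ {m} → Vec (Fin (size A)) m → Vec (Fin (size B)) m → Set
    rename : ∀ {n m l} {a : Vec _ m} {b : Vec _ m} → m ≤ k → l ≤ k → E (suc n) a b → (s : Vec (Fin m) l) → E n (a ⊙ s) (b ⊙ s)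
    atoms : ∀ {n} R {a : Vec _ (ar σ R)} {b : Vec _ (ar σ R)} → E n a b → rel A R a ≡ rel B R b
    equalities : ∀ {n m} {a : Vec _ m} {b : Vec _ m} → m ≤ k → E n a b →
                 ∀ i j → ⌊ lookup a i FinP.≟ lookup a j ⌋ ≡ ⌊ lookup b i FinP.≟ lookup b j ⌋
    extend : ∀ {n m} {a : Vec _ m} {b : Vec _ m} → m < k → E (suc n) a b →
             Σ (Permutation (size A) (size B)) λ π → ∀ c → E n (c ∷ a) ((π ⟨$⟩ʳ c) ∷ b)
    start : ∀ n → E n [] []

module Evaluation {σ : Signature} {k' : ℕ} (ar≤k : ∀ R → ar σ R ≤ suc k') {A B : Structure σ} (G : RoundGame (suc k') A B) where
  open RoundGame G

  private
    k = suc k'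

  -- An atom takes one renaming; a quantifier takes a renaming that frees a pebble and then an
  -- extension.
  rounds : Formula σ k → ℕ
  rounds (atom _ _) = 1
  rounds (equal _ _) = 0
  rounds (neg φ) = rounds φ
  rounds (conj φ ψ) = rounds φ ⊔ rounds ψ
  rounds (disj φ ψ) = rounds φ ⊔ rounds ψ
  rounds (∃≥ _ _ φ) = 2 + rounds φ

  collect : ∀ {m l} → (Fin k → Maybe (Fin m)) → Vec (Fin k) l → Maybe (Vec (Fin m) l)
  collect s [] = just []
  collect s (x ∷ xs) = Maybe.zipWith _∷_ (s x) (collect s xs)

  -- The map `s` tells which pebble carries each variable, with `nothing` for unassigned ones. It is
  -- shared by both structures, so only the tuples differ.
  Reads : ∀ {q m} → (Fin k → Maybe (Fin q)) → (Fin k → Maybe (Fin m)) → Vec (Fin q) m → Set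
  Reads ρ s a = ∀ x → ρ x ≡ Maybe.map (lookup a) (s x)

  lookupAll-collect : ∀ (S : Structure σ) {m l} ρ (s : Fin k → Maybe (Fin m)) a → Reads ρ s a → (xs : Vec (Fin k) l) →
    lookupAll S ρ xs ≡ Maybe.map (a ⊙_) (collect s xs)
  lookupAll-collect S ρ s a p [] = refl
  lookupAll-collect S ρ s a p (x ∷ xs) rewrite p x with s x
  ... | nothing = refl
  ... | just i rewrite lookupAll-collect S ρ s a p xs with collect s xs
  ... | nothing = refl
  ... | just _ = refl

  -- After requantifying x, the pebbles on the other variables are moved to a shorter tuple.
  record Release {m} (s : Fin k → Maybe (Fin m)) (x : Fin k) : Set where
    field
      {m'} : ℕ
      m'<k : m' < k
      kept : Vec (Fin m) m'
      new  : Fin k → Maybe (Fin (suc m'))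
      new-x : new x ≡ just zero
      new-other : ∀ y → y ≢ x → (s y ≡ nothing × new y ≡ nothing) ⊎ (∃ λ j → s y ≡ just (lookup kept j) × new y ≡ just (suc j))

  release : ∀ {m} (s : Fin k → Maybe (Fin m)) x → Release s x
  release {zero} s x = record
    { m'<k = s≤s z≤n ; kept = [] ; new = λ y → if ⌊ y FinP.≟ x ⌋ then just zero else nothing
    ; new-x = cong (λ z → if z then just zero else nothing) (⌊⌋-true (x FinP.≟ x) refl)
    ; new-other = λ y y≢x → inj₁ (none (s y) , cong (λ z → if z then just zero else nothing) (⌊⌋-false (y FinP.≟ x) y≢x)) }
    where
    none : (z : Maybe (Fin 0)) → z ≡ nothing
    none nothing = refl
  release {suc m} s x = record
    { m'<k = ≤-refl ; kept = kept ; new = new ; new-x = new-x ; new-other = new-other }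
    where
    -- One pebble for each variable other than `x`, which makes fewer than `k`. An unassigned
    -- variable receives the dummy pebble `zero`, which `new` never refers to.
    kept = Vec.tabulate (λ j → fromMaybe zero (s (punchIn x j)))
    new : Fin k → Maybe (Fin k)
    new y with x FinP.≟ y
    ... | yes _ = just zero
    ... | no x≢y = Maybe.map (λ _ → suc (punchOut x≢y)) (s y)
    new-x : new x ≡ just zero
    new-x with x FinP.≟ x
    ... | yes _ = refl
    ... | no x≢x = ⊥-elim (x≢x refl)
    new-other : ∀ y → y ≢ x → (s y ≡ nothing × new y ≡ nothing) ⊎ (∃ λ j → s y ≡ just (lookup kept j) × new y ≡ just (suc j))
    new-other y y≢x with x FinP.≟ y
    ... | yes x≡y = ⊥-elim (y≢x (sym x≡y))
    ... | no x≢y with s y in eq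
    ... | nothing = inj₁ (refl , refl)
    ... | just i = inj₂ (punchOut x≢y , cong just (sym (trans (VecP.lookup∘tabulate _ (punchOut x≢y))
              (trans (cong (λ z → fromMaybe zero (s z)) (FinP.punchIn-punchOut x≢y)) (cong (fromMaybe zero) eq)))) , refl)

  release-reads : ∀ (S : Structure σ) {m} ρ (s : Fin k → Maybe (Fin m)) a x c (r : Release s x) → Reads ρ s a →
    Reads (assign S ρ x c) (Release.new r) (c ∷ (a ⊙ Release.kept r))
  release-reads S ρ s a x c r p y = go (y FinP.≟ x)
    where
    open Release r
    go : Dec (y ≡ x) → assign S ρ x c y ≡ Maybe.map (lookup (c ∷ (a ⊙ kept))) (new y)
    go (yes refl) = trans (assign-self S ρ x c) (sym (cong (Maybe.map (lookup (c ∷ (a ⊙ kept)))) new-x))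
    go (no y≢x) with new-other y y≢x
    ... | inj₁ (e , e') = trans (assign-other S ρ x c y y≢x) (trans (p y) (trans (cong (Maybe.map (lookup a)) e) (sym (cong (Maybe.map (lookup (c ∷ (a ⊙ kept)))) e'))))
    ... | inj₂ (j , e , e') = trans (assign-other S ρ x c y y≢x) (trans (p y) (trans (cong (Maybe.map (lookup a)) e)
            (trans (cong just (sym (lookup-⊙ a kept j))) (sym (cong (Maybe.map (lookup (c ∷ (a ⊙ kept)))) e')))))

  eval-equal : ∀ φ n → rounds φ ≤ n → ∀ {m} (a : Vec (Fin (size A)) m) b → m ≤ k → E n a b →
    ∀ ρ ρ' (s : Fin k → Maybe (Fin m)) → Reads ρ s a → Reads ρ' s b → eval A φ ρ ≡ eval B φ ρ'
  eval-equal (atom R xs) (suc n) _ a b m≤k e ρ ρ' s p p' = trans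
      (eval-lookupAll A R xs ρ _ (lookupAll-collect A ρ s a p xs)) (trans (go (collect s xs))
      (sym (eval-lookupAll B R xs ρ' _ (lookupAll-collect B ρ' s b p' xs))))
    where
    go : ∀ z → maybe (rel A R) false (Maybe.map (a ⊙_) z) ≡ maybe (rel B R) false (Maybe.map (b ⊙_) z)
    go nothing = refl
    go (just t) = atoms R (rename m≤k (ar≤k R) e t)
  eval-equal (equal x y) n _ a b m≤k e ρ ρ' s p p' rewrite p x | p y | p' x | p' y with s x | s y
  ... | just i | just j = equalities m≤k e i j
  ... | just _ | nothing = refl
  ... | nothing | _ = refl
  eval-equal (neg φ) n r a b m≤k e ρ ρ' s p p' = cong not (eval-equal φ n r a b m≤k e ρ ρ' s p p')
  eval-equal (conj φ ψ) n r a b m≤k e ρ ρ' s p p' = cong₂ _∧_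
    (eval-equal φ n (m⊔n≤o⇒m≤o (rounds φ) (rounds ψ) r) a b m≤k e ρ ρ' s p p') (eval-equal ψ n (m⊔n≤o⇒n≤o (rounds φ) (rounds ψ) r) a b m≤k e ρ ρ' s p p')
  eval-equal (disj φ ψ) n r a b m≤k e ρ ρ' s p p' = cong₂ _∨_
    (eval-equal φ n (m⊔n≤o⇒m≤o (rounds φ) (rounds ψ) r) a b m≤k e ρ ρ' s p p') (eval-equal ψ n (m⊔n≤o⇒n≤o (rounds φ) (rounds ψ) r) a b m≤k e ρ ρ' s p p')
  eval-equal (∃≥ q x φ) (suc (suc n)) (s≤s (s≤s r)) a b m≤k e ρ ρ' s p p' = trans (eval-∃≥ A q x φ ρ) (trans
      (cong (λ z → ⌊ q ≤? z ⌋) (trans (sum-cong-≗ {size A} λ c → cong [_] (eval-equal φ n r (c ∷ (a ⊙ kept)) ((π ⟨$⟩ʳ c) ∷ (b ⊙ kept)) m'<k (proj₂ move c) _ _ new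
          (release-reads A ρ s a x c rs p) (release-reads B ρ' s b x (π ⟨$⟩ʳ c) rs p')))
        (sym (sum-permute (λ d → [ eval B φ (assign B ρ' x d) ]) π))))
      (sym (eval-∃≥ B q x φ ρ')))
    where
    rs = release s x
    open Release rs
    -- All `k` pebbles may be placed already, so the tuple is first renamed to `kept`; only then is
    -- a further element allowed.
    move = extend m'<k (rename m≤k (<⇒≤ m'<k) e kept)
    π = proj₁ move

  game⇒sameCk : SameCk k A B
  game⇒sameCk φ _ = subst T same , subst T (sym same)
    where
    same : eval A φ (λ _ → nothing) ≡ eval B φ (λ _ → nothing)
    same = eval-equal φ (rounds φ) ≤-refl [] [] z≤n (start _) _ _ (λ _ → nothing) (λ _ → refl) (λ _ → refl)

-- Pebble games from iterated degrees

T-⌊⌋⁺ : ∀ {P : Set} (d : Dec P) → P → T ⌊ d ⌋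
T-⌊⌋⁺ (yes _) _ = tt
T-⌊⌋⁺ (no ¬p) p = ¬p p

T-⌊⌋⁻ : ∀ {P : Set} (d : Dec P) → T ⌊ d ⌋ → P
T-⌊⌋⁻ (yes p) _ = p

-- Bijections obtained by restricting others are awkward to give as functions. As relations, both
-- inverse laws follow from uniqueness alone.
record OneToOne {P Q : Set} (Rel : P → Q → Set) : Set where
  field
    total   : ∀ p → ∃ λ q → Rel p q
    cototal : ∀ q → ∃ λ p → Rel p q
    unique   : ∀ {p q q'} → Rel p q → Rel p q' → q ≡ q'
    counique : ∀ {p p' q} → Rel p q → Rel p' q → p ≡ p'

  bijection : P ↔ Q
  bijection = mk↔ₛ′ (proj₁ ∘ total) (proj₁ ∘ cototal)
    (λ q → unique (proj₂ (total _)) (proj₂ (cototal q)))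
    (λ p → counique (proj₂ (cototal _)) (proj₂ (total p)))

  related : ∀ p → Rel p (Inverse.to bijection p)
  related p = proj₂ (total p)

module _ {τ : GSig} (B : GStr τ) where

  occurs⁺ : ∀ {m} (t : Vec (U B) m) i → T (occurs B (lookup t i) t)
  occurs⁺ (x ∷ t) zero with _≟U_ B x x
  ... | yes _ = tt
  ... | no x≢x = ⊥-elim (x≢x refl)
  occurs⁺ (x ∷ t) (suc i) with ⌊ _≟U_ B x (lookup t i) ⌋
  ... | true = tt
  ... | false = occurs⁺ t i

  occurs⁻ : ∀ {m b} (t : Vec (U B) m) → T (occurs B b t) → ∃ λ i → lookup t i ≡ b
  occurs⁻ {b = b} (x ∷ t) o with _≟U_ B x b
  ... | yes e = zero , e
  ... | no _ = let (i , e) = occurs⁻ t o in suc i , e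

  lookup-positions : ∀ {m} b (t : Vec (U B) m) i → lookup (positions B b t) i ≡ ⌊ _≟U_ B (lookup t i) b ⌋
  lookup-positions b t i = VecP.lookup-map i _ t

  con-≡ : {c c' : Con B} (e : proj₁ c ≡ proj₁ c') → subst (λ R → Vec (U B) (arity τ R)) e (proj₁ (proj₂ c)) ≡ proj₁ (proj₂ c') → c ≡ c'
  con-≡ {_ , _ , p} {_ , _ , q} refl refl = cong (λ r → _ , _ , r) (BoolP.T-irrelevant p q)

  nbr-≡ : ∀ {u} {e e' : Nbr B (inj₁ u)} → proj₁ e ≡ proj₁ e' → e ≡ e'
  nbr-≡ {e = _ , p} {_ , q} refl = cong (_ ,_) (BoolP.T-irrelevant p q)

module _ {τ : GSig} {B B' : GStr τ} where

  positions-hit : ∀ {m} {u w} (t : Vec (U B) m) (t' : Vec (U B') m) → positions B u t ≡ positions B' w t' → ∀ i → lookup t i ≡ u → lookup t' i ≡ w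
  positions-hit {u = u} {w} t t' e i h = ⌊⌋-holds (_≟U_ B' (lookup t' i) w) (trans (sym (lookup-positions B' w t' i))
    (trans (cong (λ v → lookup v i) (sym e)) (trans (lookup-positions B u t i) (⌊⌋-true (_≟U_ B (lookup t i) u) h))))

  -- Labels contain the symbol and the places of the element, so the matching constraint has the
  -- same symbol and carries `w` where `t` carries `u`.
  sameDeg-constraint : ∀ d {u w} (f : SameDeg B B' (suc d) (inj₁ u) (inj₁ w)) R t p i (h : lookup t i ≡ u) (o : T (occurs B u t)) →
    ∃ λ t' → ∃ λ p' → ∃ λ o' → Inverse.to (proj₁ f) ((R , t , p) , o) ≡ ((R , t' , p') , o') × lookup t' i ≡ w × SameDeg B B' d (inj₂ (R , t , p)) (inj₂ (R , t' , p'))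
  sameDeg-constraint d (f , g) R t p i h o with Inverse.to f ((R , t , p) , o) in eq | g ((R , t , p) , o)
  ... | (R' , t' , p') , o' | l , sd with cong proj₁ l
  ... | refl = t' , p' , o' , refl , positions-hit t t' (,-injectiveʳ l) i h , sd

  sameDeg-element : ∀ d R t p t' p' (f : SameDeg B B' (suc d) (inj₂ (R , t , p)) (inj₂ (R , t' , p'))) i →
    SameDeg B B' d (inj₁ (lookup t i)) (inj₁ (lookup t' i))
  sameDeg-element d R t p t' p' (f , g) i with g (lookup t i , occurs⁺ B t i)
  ... | l , sd = subst (λ w → SameDeg B B' d (inj₁ (lookup t i)) (inj₁ w)) (sym (positions-hit t t' (,-injectiveʳ l) i refl)) sd

sameDeg-sym : ∀ {τ} (B B' : GStr τ) d v w → SameDeg B B' d v w → SameDeg B' B d w v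
sameDeg-sym B B' zero v w e = sym e
sameDeg-sym B B' (suc d) v w (f , g) = mk↔ₛ′ (from) (to) strictlyInverseʳ strictlyInverseˡ , λ e →
    let (l , sd) = g (from e) in
    trans (cong (label B' w) (sym (strictlyInverseˡ e))) (sym l) ,
    subst (λ z → SameDeg B' B d (target B' w z) (target B v (from e))) (strictlyInverseˡ e) (sameDeg-sym B B' d _ _ sd)
  where open Inverse f

module _ {σ : Signature} (k : ℕ) where

  tupleLength : StarSym σ k → ℕ
  tupleLength (T-S j _) = len j
  tupleLength (T-i j _ _) = len j
  tupleLength (R-S R _) = ar σ R
  tupleLength (R-i R _ _) = ar σ R

  module StarOf (S : Structure σ) where

    -- A constraint of the star structure is determined by its symbol and by the one tuple of the
    -- original structure behind its first entry; `valid` singles out the tuples that occur.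
    valid : ∀ s → Vec (Fin (size S)) (tupleLength s) → Bool
    valid (T-S j P) a = constOn k S P a
    valid (T-i j j' idx) a = true
    valid (R-S R P) a = rel S R a ∧ constOn k S P a
    valid (R-i R j idx) a = rel S R a

    entries : ∀ s a → T (valid s a) → Vec (StarU k S) (starArity s)
    entries (T-S j P) a p = inj₁ (j , a) ∷ []
    entries (T-i j j' idx) a p = inj₁ (j , a) ∷ inj₁ (j' , a ⊙ idx) ∷ []
    entries (R-S R P) a p = inj₂ (R , a , proj₁ (T-∧⁻ p)) ∷ []
    entries (R-i R j idx) a p = inj₂ (R , a , p) ∷ inj₁ (j , a ⊙ idx) ∷ []

    entries-related : ∀ s a p → T (starRel k S s (entries s a p))
    entries-related (T-S j P) a p with j FinP.≟ j
    ... | yes refl = p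
    ... | no j≢j = j≢j refl
    entries-related (T-i j j' idx) a p with j FinP.≟ j | j' FinP.≟ j'
    ... | yes refl | yes refl = T-⌊⌋⁺ (VecP.≡-dec FinP._≟_ (a ⊙ idx) (a ⊙ idx)) refl
    ... | yes _ | no j≢j = ⊥-elim (j≢j refl)
    ... | no j≢j | _ = ⊥-elim (j≢j refl)
    entries-related (R-S R P) a p with R FinP.≟ R
    ... | yes refl = proj₂ (T-∧⁻ {rel S R a} p)
    ... | no R≢R = R≢R refl
    entries-related (R-i R j idx) a p with R FinP.≟ R | j FinP.≟ j
    ... | yes refl | yes refl = T-⌊⌋⁺ (VecP.≡-dec FinP._≟_ (a ⊙ idx) (a ⊙ idx)) refl
    ... | yes _ | no j≢j = ⊥-elim (j≢j refl)
    ... | no R≢R | _ = ⊥-elim (R≢R refl)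

    conOf : ∀ s a → T (valid s a) → Con (star k S)
    conOf s a p = s , entries s a p , entries-related s a p

    conOf-≡ : ∀ s a {p} (t : Vec (StarU k S) (starArity s)) q → entries s a p ≡ t → (s , t , q) ≡ conOf s a p
    conOf-≡ s a _ q refl = con-≡ (star k S) refl refl

    entries-view : ∀ s t → T (starRel k S s t) → ∃ λ a → ∃ λ p → entries s a p ≡ t
    entries-view (T-S j P) (inj₁ (j₁ , a) ∷ []) q with j FinP.≟ j₁
    ... | yes refl = a , q , refl
    entries-view (T-i j j' idx) (inj₁ (j₁ , a) ∷ inj₁ (j₂ , b) ∷ []) q with j FinP.≟ j₁ | j' FinP.≟ j₂
    ... | yes refl | yes refl = a , tt , cong (λ z → inj₁ (j , a) ∷ inj₁ (j' , z) ∷ []) (sym (T-⌊⌋⁻ (VecP.≡-dec FinP._≟_ b (a ⊙ idx)) q))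
    entries-view (R-S R P) (inj₂ (R₁ , a , r) ∷ []) q with R FinP.≟ R₁
    ... | yes refl = a , T-∧⁺ r q , cong (λ z → inj₂ (R , a , z) ∷ []) (BoolP.T-irrelevant _ r)
    entries-view (R-i R j idx) (inj₂ (R₁ , a , r) ∷ inj₁ (j₂ , b) ∷ []) q with R FinP.≟ R₁ | j FinP.≟ j₂
    ... | yes refl | yes refl = a , r , cong (λ z → inj₂ (R , a , r) ∷ inj₁ (j , z) ∷ []) (sym (T-⌊⌋⁻ (VecP.≡-dec FinP._≟_ b (a ⊙ idx)) q))

    view : ∀ s t (q : T (starRel k S s t)) → ∃ λ a → ∃ λ p → (s , t , q) ≡ conOf s a p
    view s t q = let (a , p , e) = entries-view s t q in a , p , conOf-≡ s a t q e

    constOn⁺ : ∀ {m} (P : Subset m) (a : Vec (Fin (size S)) m) → (∀ i i' → i Subset.∈ P → i' Subset.∈ P → lookup a i ≡ lookup a i') → T (constOn k S P a)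
    constOn⁺ P a f = T-all⁺ (allFin _) λ i → T-all⁺ (allFin _) λ i' → T-imp⁺ λ q → let (x , y) = T-∧⁻ q in
      T-⌊⌋⁺ (lookup a i FinP.≟ lookup a i') (f i i' (true-∈ i x) (true-∈ i' y))
      where
      true-∈ : ∀ i → T (lookup P i) → i Subset.∈ P
      true-∈ i t with lookup P i in eq
      ... | true = VecP.lookup⇒[]= i P eq

    constOn⁻ : ∀ {m} (P : Subset m) (a : Vec (Fin (size S)) m) → T (constOn k S P a) → ∀ i i' → i Subset.∈ P → i' Subset.∈ P → lookup a i ≡ lookup a i'
    constOn⁻ P a t i i' p p' = T-⌊⌋⁻ (lookup a i FinP.≟ lookup a i') (T-imp⁻ (T-all⁻ (allFin _) (T-all⁻ (allFin _) t (∈-allFin i)) (∈-allFin i'))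
      (T-∧⁺ (∈-true i p) (∈-true i' p')))
      where
      ∈-true : ∀ i → i Subset.∈ P → T (lookup P i)
      ∈-true i q = subst T (sym (VecP.[]=⇒lookup q)) tt

  open StarOf

  head-entry : ∀ {U : Set} (s : StarSym σ k) → Vec U (starArity s) → U
  head-entry (T-S _ _) (x ∷ _) = x
  head-entry (T-i _ _ _) (x ∷ _) = x
  head-entry (R-S _ _) (x ∷ _) = x
  head-entry (R-i _ _ _) (x ∷ _) = x

castVec : ∀ {X : Set} {m l} → m ≡ l → Vec X m → Vec X l
castVec refl a = a

identityAt : ∀ {m l} → m ≡ l → Vec (Fin m) l
identityAt refl = Vec.allFin _

⊙-identityAt : ∀ {X : Set} {m l} (e : m ≡ l) (a : Vec X m) → a ⊙ identityAt e ≡ castVec e a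
⊙-identityAt refl a = ⊙-id a

castVec-injective : ∀ {X : Set} {m l} (e : m ≡ l) {a b : Vec X m} → castVec e a ≡ castVec e b → a ≡ b
castVec-injective refl p = p

-- The index vector that forgets the first entry. As a symbol `T-i` it joins each tuple to its
-- extensions by one element.
tailAt : ∀ {m l} → suc m ≡ l → Vec (Fin l) m
tailAt refl = Vec.map suc (Vec.allFin _)

⊙-suc : ∀ {X : Set} {m l} (c : X) (a : Vec X m) (s : Vec (Fin m) l) → (c ∷ a) ⊙ Vec.map suc s ≡ a ⊙ s
⊙-suc c a s = sym (VecP.map-∘ (lookup (c ∷ a)) suc s)

castVec-tail : ∀ {X : Set} {m l} (e : suc m ≡ l) (c : X) (a : Vec X m) → castVec e (c ∷ a) ⊙ tailAt e ≡ a
castVec-tail refl c a = trans (⊙-suc c a (Vec.allFin _)) (⊙-id a)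

castVec-∷ : ∀ {X : Set} {m l} (e : suc m ≡ l) (u : Vec X l) → ∃ λ c → u ≡ castVec e (c ∷ (u ⊙ tailAt e))
castVec-∷ refl (c ∷ a) = c , cong (c ∷_) (sym (castVec-tail refl c a))

asLength : ∀ {k} l → l ≤ k → l ≡ 0 ⊎ ∃ λ (j : Fin k) → l ≡ len j
asLength zero _ = inj₁ refl
asLength (suc l) l<k = inj₂ (fromℕ< l<k , cong suc (sym (FinP.toℕ-fromℕ< l<k)))

vec-zero : ∀ {X : Set} {m} → m ≡ 0 → (u v : Vec X m) → u ≡ v
vec-zero refl [] [] = refl

-- There is only one empty tuple and relations are non-empty. Nullary constraints need this argument
-- because no entry of a tuple leads to them.
nullary-holds : ∀ {σ} (S : Structure σ) R → ar σ R ≡ 0 → ∀ a → T (rel S R a)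
nullary-holds S R e a = let (t , p) = nonempty S R in subst (T ∘ rel S R) (vec-zero e t a) p

module StarRounds {σ : Signature} {k : ℕ} (1≤k : 1 ≤ k) (ar≤k : ∀ R → ar σ R ≤ k) {A B : Structure σ} where

  module Hop (A B : Structure σ) where
    private
      module SA = StarOf k A
      module SB = StarOf k B

    _~[_]_ : ∀ {j} → Vec (Fin (size A)) (len j) → ℕ → Vec (Fin (size B)) (len j) → Set
    _~[_]_ {j} a d b = SameDeg (star k A) (star k B) d (inj₁ (inj₁ (j , a))) (inj₁ (inj₁ (j , b)))

    hop : ∀ d {j} (a : Vec _ (len j)) b → _~[_]_ {j} a (suc d) b → ∀ s a' p i → lookup (SA.entries s a' p) i ≡ inj₁ (j , a) →
      ∃ λ b' → ∃ λ p' → lookup (SB.entries s b' p') i ≡ inj₁ (j , b) × SameDeg (star k A) (star k B) d (inj₂ (SA.conOf s a' p)) (inj₂ (SB.conOf s b' p'))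
    hop d {j} a b f s a' p i h with sameDeg-constraint d f s (SA.entries s a' p) (SA.entries-related s a' p) i h
                                     (subst (λ u → T (occurs (star k A) u (SA.entries s a' p))) h (occurs⁺ (star k A) (SA.entries s a' p) i))
    ... | t' , q' , _ , _ , h' , sd with SB.entries-view s t' q'
    ... | b' , p' , refl = b' , p' , h' , subst (λ c → SameDeg (star k A) (star k B) d (inj₂ (SA.conOf s a' p)) (inj₂ c))
                                            (con-≡ (star k B) refl refl) sd

    -- Read off from `T-S` at the set of the two positions: the constraint at `a` exists because the
    -- entries agree, and its partner at `b` says the same of `b`.
    hop-equal : ∀ d {j} (a : Vec _ (len j)) b → _~[_]_ {j} a (suc d) b → ∀ i i' → lookup a i ≡ lookup a i' → lookup b i ≡ lookup b i'
    hop-equal d {j} a b f i i' e with hop d a b f (T-S j P) a (SA.constOn⁺ P a same) zero refl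
      where
      P = ⁅ i ⁆ ∪ ⁅ i' ⁆
      value-at : ∀ {x} → x Subset.∈ P → lookup a x ≡ lookup a i
      value-at x∈ with SubsetP.x∈p∪q⁻ ⁅ i ⁆ ⁅ i' ⁆ x∈
      ... | inj₁ x∈i = cong (lookup a) (SubsetP.x∈⁅y⁆⇒x≡y i x∈i)
      ... | inj₂ x∈i' = trans (cong (lookup a) (SubsetP.x∈⁅y⁆⇒x≡y i' x∈i')) (sym e)
      same : ∀ x x' → x Subset.∈ P → x' Subset.∈ P → lookup a x ≡ lookup a x'
      same x x' p p' = trans (value-at p) (sym (value-at p'))
    ... | b' , p' , refl , _ = SB.constOn⁻ (⁅ i ⁆ ∪ ⁅ i' ⁆) b p' i i' (SubsetP.p⊆p∪q ⁅ i' ⁆ (SubsetP.x∈⁅x⁆ i)) (SubsetP.q⊆p∪q ⁅ i ⁆ ⁅ i' ⁆ (SubsetP.x∈⁅x⁆ i'))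

    -- The symbol `R-i` with the identity projection joins R(a) to the tuple a itself.
    hop-atom : ∀ d R j (e : ar σ R ≡ len j) a b → _~[_]_ {j} (castVec e a) (suc d) (castVec e b) → T (rel A R a) → T (rel B R b)
    hop-atom d R j e a b f r with hop d (castVec e a) (castVec e b) f (R-i R j (identityAt e)) a r (suc zero) (cong (λ z → inj₁ (j , z)) (⊙-identityAt e a))
    ... | b' , p' , h , _ = subst (T ∘ rel B R) (castVec-injective e (trans (sym (⊙-identityAt e b')) (,-injectiveʳ (SumP.inj₁-injective h)))) p'

    hop-rename : ∀ d {j} (a : Vec _ (len j)) b → _~[_]_ {j} a (2 + d) b → ∀ j' (s : Vec (Fin (len j)) (len j')) → _~[_]_ {j'} (a ⊙ s) d (b ⊙ s)
    hop-rename d {j} a b f j' s with hop (suc d) a b f (T-i j j' s) a tt zero refl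
    ... | b' , p' , refl , sd = sameDeg-element d (T-i j j' s) _ (SA.entries-related (T-i j j' s) a tt) _ (SB.entries-related (T-i j j' s) b tt) sd (suc zero)

    -- The constraint through which a tuple sees its extension by c.
    extension : ∀ {j j'} → suc (len j) ≡ len j' → Vec (Fin (size A)) (len j) → Fin (size A) → Con (star k A)
    extension {j} {j'} e a c = SA.conOf (T-i j' j (tailAt e)) (castVec e (c ∷ a)) tt

    extension-entry : ∀ {j j'} (e : suc (len j) ≡ len j') a c → lookup (proj₁ (proj₂ (extension e a c))) (suc zero) ≡ inj₁ (j , a)
    extension-entry {j} e a c = cong (λ z → inj₁ (j , z)) (castVec-tail e c a)

    extension-nbr : ∀ {j j'} (e : suc (len j) ≡ len j') a c → Nbr (star k A) (inj₁ (inj₁ (j , a)))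
    extension-nbr e a c = extension e a c , subst (λ u → T (occurs (star k A) u (proj₁ (proj₂ (extension e a c)))))
      (extension-entry e a c) (occurs⁺ (star k A) (proj₁ (proj₂ (extension e a c))) (suc zero))

    extension-injective : ∀ {j j'} (e : suc (len j) ≡ len j') a c c' → extension {j} {j'} e a c ≡ extension e a c' → c ≡ c'
    extension-injective e a c c' eq = VecP.∷-injectiveˡ (castVec-injective e
      (,-injectiveʳ (SumP.inj₁-injective (cong (λ c → head-entry k (proj₁ c) (proj₁ (proj₂ c))) eq))))

    -- The label keeps the symbol and the place of `b`, so the partner of an extension of `a`
    -- projects to `b` and is an extension of `b`.
    extension-match : ∀ d {j j'} (e : suc (len j) ≡ len j') a b (f : _~[_]_ {j} a (suc d) b) c →
      ∃ λ c' → proj₁ (Inverse.to (proj₁ f) (extension-nbr e a c)) ≡ SB.conOf (T-i j' j (tailAt e)) (castVec e (c' ∷ b)) tt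
    extension-match d {j} {j'} e a b f c
      with sameDeg-constraint d f (T-i j' j (tailAt e)) _ _ (suc zero) (extension-entry e a c) (proj₂ (extension-nbr e a c))
    ... | t' , q' , o' , eq , h' , _ with SB.view (T-i j' j (tailAt e)) t' q'
    ... | b' , tt , refl with castVec-∷ e b'
    ... | c' , eq' = c' , trans (cong proj₁ eq) (cong (λ z → SB.conOf (T-i j' j (tailAt e)) z tt)
          (trans eq' (cong (λ z → castVec e (c' ∷ z)) (,-injectiveʳ (SumP.inj₁-injective h')))))

    single : ∀ {j} → 1 ≡ len j → Fin (size A) → Vertex (star k A)
    single {j} e c = inj₁ (inj₁ (j , castVec e (c ∷ [])))

    -- The symbol `T-S` with the empty set holds at all tuples of its length and at nothing else, so
    -- depth 1 recognises the tuples of length 1.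
    single-match : ∀ {j} (e : 1 ≡ len j) c w → (∀ d → SameDeg (star k A) (star k B) d (single e c) w) →
      ∃ λ c' → w ≡ inj₁ (inj₁ (j , castVec e (c' ∷ [])))
    single-match e c (inj₂ _) f = case f 0 of λ ()
    single-match {j} e c (inj₁ u) f
      with sameDeg-constraint 0 (f 1) (T-S j Subset.⊥) (inj₁ (j , castVec e (c ∷ [])) ∷ [])
             (SA.entries-related (T-S j Subset.⊥) (castVec e (c ∷ [])) (SA.constOn⁺ {len j} Subset.⊥ (castVec e (c ∷ [])) (λ _ _ p _ → ⊥-elim (SubsetP.∉⊥ p))))
             zero refl (occurs⁺ (star k A) (inj₁ (j , castVec e (c ∷ [])) ∷ []) zero)
    ... | t' , q' , _ , _ , h' , _ with SB.entries-view (T-S j Subset.⊥) t' q'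
    ... | b' , p' , refl with castVec-∷ e b'
    ... | c' , eq' = c' , cong inj₁ (trans (sym h') (cong (λ z → inj₁ (j , z)) (trans eq' (cong (λ z → castVec e (c' ∷ z)) (vec-zero refl (b' ⊙ tailAt e) [])))))

  open Hop A B

  -- Each round passes from an element to a constraint and on to an element, which costs depth 2.
  -- The last unit serves to read atoms and equalities.
  rounds-degree : ℕ → ℕ
  rounds-degree zero = 1
  rounds-degree (suc n) = 2 + rounds-degree n

  -- The empty tuple is not an element of the star structure. It is related unconditionally, and
  -- moves from it use the global bijection of vertices.
  E : ℕ → ∀ {m} → Vec (Fin (size A)) m → Vec (Fin (size B)) m → Set
  E n {m} a b = m ≡ 0 ⊎ ∃ λ (j : Fin k) → Σ (m ≡ len j) λ e → _~[_]_ {j = j} (castVec e a) (rounds-degree n) (castVec e b)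

  odd : ∀ n → ∃ λ d → rounds-degree n ≡ suc d
  odd zero = 0 , refl
  odd (suc n) = suc (rounds-degree n) , refl

  E-rename : ∀ {n m l} {a : Vec _ m} {b : Vec _ m} → m ≤ k → l ≤ k → E (suc n) a b → (s : Vec (Fin m) l) → E n (a ⊙ s) (b ⊙ s)
  E-rename {l = l} _ l≤k x s with asLength l l≤k
  E-rename _ _ _ _ | inj₁ e = inj₁ e
  E-rename _ _ (inj₁ refl) (() ∷ _) | inj₂ (j' , refl)
  E-rename {n} {a = a} {b} _ _ (inj₂ (j , refl , f)) s | inj₂ (j' , refl) = inj₂ (j' , refl , hop-rename (rounds-degree n) {j} a b f j' s)

  E-atoms : ∀ {n} R {a : Vec _ (ar σ R)} {b : Vec _ (ar σ R)} → E n a b → rel A R a ≡ rel B R b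
  E-atoms R {a} {b} (inj₁ e) = T-⇔⇒≡ (λ _ → nullary-holds B R e b) (λ _ → nullary-holds A R e a)
  E-atoms {n} R {a} {b} (inj₂ (j , e , f)) with odd n
  ... | d , eq rewrite eq = T-⇔⇒≡ (hop-atom d R j e a b f) (Hop.hop-atom B A d R j e b a (sameDeg-sym (star k A) (star k B) (suc d) _ _ f))

  E-equalities : ∀ {n m} {a : Vec _ m} {b : Vec _ m} → m ≤ k → E n a b →
                 ∀ i j → ⌊ lookup a i FinP.≟ lookup a j ⌋ ≡ ⌊ lookup b i FinP.≟ lookup b j ⌋
  E-equalities _ (inj₁ refl) ()
  E-equalities {n} {a = a} {b} _ (inj₂ (l , refl , f)) i j with odd n
  ... | d , eq rewrite eq = ⌊⌋-cong (lookup a i FinP.≟ lookup a j) (lookup b i FinP.≟ lookup b j)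
    (hop-equal d {l} a b f i j) (Hop.hop-equal B A d {l} b a (sameDeg-sym (star k A) (star k B) (suc d) _ _ f) i j)

  -- Among the neighbours of `a`, the constraints for its extensions correspond to the elements of
  -- A. The matching of neighbours respects them in both directions and so induces a bijection of
  -- universes.
  extend-tuple : ∀ d {j j' : Fin k} (e : suc (len j) ≡ len j') a b → _~[_]_ {j = j} a (2 + d) b →
    Σ (Permutation (size A) (size B)) λ π → ∀ c → _~[_]_ {j = j'} (castVec e (c ∷ a)) d (castVec e ((π ⟨$⟩ʳ c) ∷ b))
  extend-tuple d {j} {j'} e a b f = OneToOne.bijection matching , λ c → sameDeg-element d _ _ (proj₂ (proj₂ (extension e a c))) _ (proj₂ (proj₂ (Hop.extension B A e b (OneToOne.bijection matching ⟨$⟩ʳ c))))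
      (subst (λ z → SameDeg (star k A) (star k B) (suc d) (inj₂ (extension e a c)) (inj₂ z)) (OneToOne.related matching c)
        (proj₂ (proj₂ f (extension-nbr e a c)))) zero
    where
    open Inverse (proj₁ f) using (to; from; strictlyInverseˡ; strictlyInverseʳ)
    f⁻¹ = sameDeg-sym (star k A) (star k B) (2 + d) _ _ f
    Rel : Fin (size A) → Fin (size B) → Set
    Rel c c' = proj₁ (to (extension-nbr e a c)) ≡ Hop.extension B A e b c'
    matching : OneToOne Rel
    matching = record
      { total = extension-match (suc d) e a b f
      ; cototal = λ c' → let (c , eq) = Hop.extension-match B A (suc d) e b a f⁻¹ c' in
          c , cong proj₁ (trans (cong to (sym (nbr-≡ (star k A) {e = from (Hop.extension-nbr B A e b c')} {extension-nbr e a c} eq))) (strictlyInverseˡ _))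
      ; unique = λ {_} {q} {q'} r r' → Hop.extension-injective B A e b q q' (trans (sym r) r')
      ; counique = λ {p} {p'} r r' → extension-injective e a p p' (cong proj₁ (trans (sym (strictlyInverseʳ (extension-nbr e a p)))
          (trans (cong from (nbr-≡ (star k B) {e = to (extension-nbr e a p)} {to (extension-nbr e a p')} (trans r (sym r')))) (strictlyInverseʳ _))))
      }

  module _ (equivalent : star k A ≡₁ star k B) where
    private
      F = proj₁ equivalent
      open Inverse F using (to; from; strictlyInverseˡ; strictlyInverseʳ)

    extend-empty : ∀ {j : Fin k} (e : 1 ≡ len j) → Σ (Permutation (size A) (size B)) λ π → ∀ c d →
      _~[_]_ {j = j} (castVec e (c ∷ [])) d (castVec e ((π ⟨$⟩ʳ c) ∷ []))
    extend-empty {j} e = OneToOne.bijection matching , λ c d → subst (SameDeg (star k A) (star k B) d (single e c)) (OneToOne.related matching c) (proj₂ equivalent (single e c) d)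
      where
      single-injective : ∀ S T {c c'} → Hop.single S T {j} e c ≡ Hop.single S T e c' → c ≡ c'
      single-injective S T eq = VecP.∷-injectiveˡ (castVec-injective e (,-injectiveʳ (SumP.inj₁-injective (SumP.inj₁-injective eq))))
      matching : OneToOne (λ c c' → to (single e c) ≡ Hop.single B A e c')
      matching = record
        { total = λ c → single-match e c (to (single e c)) (proj₂ equivalent (single e c))
        ; cototal = λ c' → let v = from (Hop.single B A e c')
                               (c , eq) = Hop.single-match B A e c' v (λ d → sameDeg-sym (star k A) (star k B) d v (Hop.single B A e c')
                                  (subst (SameDeg (star k A) (star k B) d v) (strictlyInverseˡ _) (proj₂ equivalent v d)))
                           in c , trans (cong to (sym eq)) (strictlyInverseˡ _)
        ; unique = λ r r' → single-injective B A (trans (sym r) r')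
        ; counique = λ {p} {p'} r r' → single-injective A B (trans (sym (strictlyInverseʳ (single e p)))
            (trans (cong from (trans r (sym r'))) (strictlyInverseʳ (single e p'))))
        }

    E-extend : ∀ {n m} {a : Vec _ m} {b : Vec _ m} → m < k → E (suc n) a b →
               Σ (Permutation (size A) (size B)) λ π → ∀ c → E n (c ∷ a) ((π ⟨$⟩ʳ c) ∷ b)
    E-extend {n} {m} m<k x with asLength (suc m) m<k
    E-extend {n} {a = []} {[]} _ (inj₁ refl) | inj₂ (j' , e) = let (π , p) = extend-empty e in π , λ c → inj₂ (j' , e , p c (rounds-degree n))
    E-extend {n} {a = a} {b} _ (inj₂ (j , refl , f)) | inj₂ (j' , e) = let (π , p) = extend-tuple (rounds-degree n) {j} {j'} e a b f in π , λ c → inj₂ (j' , e , p c)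

    starRounds : RoundGame k A B
    starRounds = record
      { E = E
      ; rename = λ {n} → E-rename {n}
      ; atoms = λ {n} R {a} {b} → E-atoms {n} R {a} {b}
      ; equalities = λ {n} → E-equalities {n}
      ; extend = λ {n} → E-extend {n}
      ; start = λ n → inj₁ refl
      }

-- The game for a single pebble

module FlatRounds {σ : Signature} (ar≤1 : ∀ R → ar σ R ≤ 1) where

  collapse : ∀ {m} → m ≤ 1 → (i j : Fin m) → i ≡ j
  collapse (s≤s z≤n) zero zero = refl

  module Link (A B : Structure σ) where
    -- The number of rounds does not matter: with one pebble every extension starts from the empty
    -- tuple, where the global bijection works for all depths. Depth 1 suffices to read the unary
    -- relations.
    E : ℕ → ∀ {m} → Vec (Fin (size A)) m → Vec (Fin (size B)) m → Set
    E _ a b = ∀ i → SameDeg (toGStr A) (toGStr B) 1 (inj₁ (lookup a i)) (inj₁ (lookup b i))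

    atom-transfer : ∀ R a b → E 0 {ar σ R} a b → T (rel A R a) → T (rel B R b)
    atom-transfer R a b f r with ar σ R ≟ 0
    ... | yes e = nullary-holds B R e b
    ... | no e with fromℕ< (n≢0⇒n>0 e)
    ... | i with sameDeg-constraint 0 (f i) R a r i refl (occurs⁺ (toGStr A) a i)
    ... | t' , p' , _ , _ , h , _ = subst (T ∘ rel B R) (vec-ext (λ x → subst (λ x → lookup t' x ≡ lookup b x) (collapse (ar≤1 R) i x) h)) p'

    element-match : ∀ c w → SameDeg (toGStr A) (toGStr B) 0 (inj₁ c) w → ∃ λ c' → w ≡ inj₁ c'
    element-match c (inj₁ c') _ = c' , refl

  module _ {A B : Structure σ} (equivalent : toGStr A ≡₁ toGStr B) where
    open Link A B
    private
      F = proj₁ equivalent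
      open Inverse F using (to; from; strictlyInverseˡ; strictlyInverseʳ)

    matching : OneToOne (λ c c' → to (inj₁ c) ≡ inj₁ c')
    matching = record
      { total = λ c → element-match c (to (inj₁ c)) (proj₂ equivalent (inj₁ c) 0)
      ; cototal = λ c' → let v = from (inj₁ c')
                             (c , eq) = Link.element-match B A c' v (sym (trans (proj₂ equivalent v 0) (cong (isElement (toGStr B)) (strictlyInverseˡ (inj₁ c')))))
                         in c , trans (cong to (sym eq)) (strictlyInverseˡ _)
      ; unique = λ r r' → SumP.inj₁-injective (trans (sym r) r')
      ; counique = λ {p} {p'} r r' → SumP.inj₁-injective (trans (sym (strictlyInverseʳ (inj₁ p))) (trans (cong from (trans r (sym r'))) (strictlyInverseʳ (inj₁ p'))))
      }

    flatRounds : RoundGame 1 A B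
    flatRounds = record
      { E = E
      ; rename = λ {n} {m} {l} {a} {b} _ _ f s i → subst₂ (λ u v → SameDeg (toGStr A) (toGStr B) 1 (inj₁ u) (inj₁ v))
          (sym (lookup-⊙ a s i)) (sym (lookup-⊙ b s i)) (f (lookup s i))
      ; atoms = λ R {a} {b} f → T-⇔⇒≡ (atom-transfer R a b f)
          (Link.atom-transfer B A R b a (λ i → sameDeg-sym (toGStr A) (toGStr B) 1 _ _ (f i)))
      ; equalities = λ {n} {m} {a} {b} m≤1 f i j → trans (⌊⌋-true (lookup a i FinP.≟ lookup a j) (cong (lookup a) (collapse m≤1 i j)))
          (sym (⌊⌋-true (lookup b i FinP.≟ lookup b j) (cong (lookup b) (collapse m≤1 i j))))
      ; extend = λ { {a = []} {[]} _ _ → OneToOne.bijection matching , λ { c zero →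
          subst (SameDeg (toGStr A) (toGStr B) 1 (inj₁ c)) (OneToOne.related matching c) (proj₂ equivalent (inj₁ c) 1) }
                   ; {a = _ ∷ _} (s≤s ()) _ }
      ; start = λ n ()
      }

-- Fibres of projections under a stable colouring

⌊⌋⇔ : ∀ {P P' : Set} (d : Dec P) (d' : Dec P') → ⌊ d ⌋ ≡ ⌊ d' ⌋ → (P → P') × (P' → P)
⌊⌋⇔ d d' e = (λ p → ⌊⌋-holds d' (trans (sym e) (⌊⌋-true d p))) , (λ p → ⌊⌋-holds d (trans e (⌊⌋-true d' p)))

module Bisimulation {τ : GSig} {B B' : GStr τ} (VRel : Vertex B → Vertex B' → Set)
  (same-kind : ∀ {v w} → VRel v w → isElement B v ≡ isElement B' w)
  (move : ∀ {v w} → VRel v w → Σ (Nbr B v ↔ Nbr B' w) λ f → ∀ e →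
     label B v e ≡ label B' w (Inverse.to f e) × VRel (target B v e) (target B' w (Inverse.to f e))) where

  sameDeg : ∀ j {v w} → VRel v w → SameDeg B B' j v w
  sameDeg zero r = same-kind r
  sameDeg (suc j) r = let (f , p) = move r in f , λ e → proj₁ (p e) , sameDeg j (proj₂ (p e))

module _ {τ : GSig} {B B' : GStr τ} where

  -- The neighbours of a constraint are its distinct entries. Equal equality patterns make the
  -- pairing of entries at the same place well defined and injective.
  constraint-nbrs : ∀ R t p t' p' → (∀ i i' → (lookup t i ≡ lookup t i' → lookup t' i ≡ lookup t' i') × (lookup t' i ≡ lookup t' i' → lookup t i ≡ lookup t i')) →
    (Rel : U B → U B' → Set) → (∀ i → Rel (lookup t i) (lookup t' i)) →
    Σ (Nbr B (inj₂ (R , t , p)) ↔ Nbr B' (inj₂ (R , t' , p'))) λ f → ∀ e →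
      label B (inj₂ (R , t , p)) e ≡ label B' (inj₂ (R , t' , p')) (Inverse.to f e) × Rel (proj₁ e) (proj₁ (Inverse.to f e))
  constraint-nbrs R t p t' p' iff Rel holds = OneToOne.bijection matching , λ e → describe e (Inverse.to (OneToOne.bijection matching) e) (OneToOne.related matching e)
    where
    Same : Nbr B (inj₂ (R , t , p)) → Nbr B' (inj₂ (R , t' , p')) → Set
    Same (b , _) (b' , _) = ∃ λ i → lookup t i ≡ b × lookup t' i ≡ b'
    matching : OneToOne Same
    matching = record
      { total = λ { (b , o) → let (i , e) = occurs⁻ B t o in (lookup t' i , occurs⁺ B' t' i) , i , e , refl }
      ; cototal = λ { (b , o) → let (i , e) = occurs⁻ B' t' o in (lookup t i , occurs⁺ B t i) , i , refl , e }
      ; unique = λ { {_} {_ , o} {_ , o'} (i , refl , refl) (i' , e , refl) → same-entry B' t' (proj₁ (iff i i') (sym e)) o o' }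
      ; counique = λ { {_ , o} {_ , o'} (i , refl , refl) (i' , refl , e) → same-entry B t (proj₂ (iff i i') (sym e)) o o' }
      }
      where
      same-entry : ∀ (S : GStr τ) {m} (t : Vec (U S) m) {x y} → x ≡ y → (o : T (occurs S x t)) (o' : T (occurs S y t)) → (x , o) ≡ (y , o')
      same-entry S t {x} refl o o' = cong (x ,_) (BoolP.T-irrelevant o o')
    describe : ∀ e e' → Same e e' → label B (inj₂ (R , t , p)) e ≡ label B' (inj₂ (R , t' , p')) e' × Rel (proj₁ e) (proj₁ e')
    describe _ _ (i , refl , refl) = cong (R ,_) (vec-ext λ x → trans (lookup-positions B (lookup t i) t x)
        (trans (⌊⌋-cong (_≟U_ B (lookup t x) (lookup t i)) (_≟U_ B' (lookup t' x) (lookup t' i)) (proj₁ (iff x i)) (proj₂ (iff x i)))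
               (sym (lookup-positions B' (lookup t' i) t' x)))) , holds i

module StableColouring {σ : Signature} {k : ℕ} (1≤k : 1 ≤ k) (ar≤k : ∀ R → ar σ R ≤ k) {A B : Structure σ} (G : Game k A B) where
  open Game G

  infix 4 _≈_
  _≈_ : ∀ {m} → Vec (Fin (size A)) m → Vec (Fin (size B)) m → Set
  a ≈ b = colA a ≡ colB b

  rel-transfer : ∀ R {t : Vec _ (ar σ R)} {t' : Vec _ (ar σ R)} → t ≈ t' → rel A R t ≡ rel B R t'
  rel-transfer R {t} {t'} e = subst₂ (λ u v → rel A R u ≡ rel B R v) (⊙-id t) (⊙-id t') (atoms (ar≤k R) e R (Vec.allFin _))

  equal-entries : ∀ {m} {a : Vec _ m} {b : Vec _ m} → a ≈ b → ∀ i j → (lookup a i ≡ lookup a j → lookup b i ≡ lookup b j) × (lookup b i ≡ lookup b j → lookup a i ≡ lookup a j)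
  equal-entries {a = a} {b} e i j = ⌊⌋⇔ (lookup a i FinP.≟ lookup a j) (lookup b i FinP.≟ lookup b j) (equalities e i j)

  fixed-transfer : ∀ {m l} {a : Vec _ m} {b : Vec _ m} → a ≈ b → (s t : Vec (Fin m) l) → (a ⊙ s ≡ a ⊙ t → b ⊙ s ≡ b ⊙ t) × (b ⊙ s ≡ b ⊙ t → a ⊙ s ≡ a ⊙ t)
  fixed-transfer {a = a} {b} e s t = go a b (λ i j → proj₁ (equal-entries e i j)) , go b a (λ i j → proj₂ (equal-entries e i j))
    where
    go : ∀ {q q'} (u : Vec (Fin q) _) (v : Vec (Fin q') _) → (∀ i j → lookup u i ≡ lookup u j → lookup v i ≡ lookup v j) → u ⊙ s ≡ u ⊙ t → v ⊙ s ≡ v ⊙ t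
    go u v f eq = vec-ext λ i → trans (lookup-⊙ v s i) (trans (f _ _ (trans (sym (lookup-⊙ u s i))
      (trans (cong (λ z → lookup z i) eq) (lookup-⊙ u t i)))) (sym (lookup-⊙ v t i)))

  all-linked : ∀ {m} → m ≤ k → ∀ h h' → Bags.Linked G h h' (allFin m) → h ≈ h'
  all-linked {m} m≤k h h' l = subst₂ _≈_ (⊙-id h) (⊙-id h')
    (Bags.linked-vec G h h' (allFin m) (Vec.allFin m) (subst (_≤ k) (sym (ListP.length-tabulate {n = m} id)) m≤k) m≤k l (λ i → ∈-allFin _))

  whole-bag : ∀ {m} → m ≤ k → length (allFin m) ≤ k
  whole-bag {m} m≤k = subst (_≤ k) (sym (ListP.length-tabulate {n = m} id)) m≤k

  -- A single bag contains all `m` positions, as `m ≤ k`.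
  sum-all : ∀ {m} → m ≤ k → (φ : Vec (Fin (size A)) m → ℕ) (φ' : Vec (Fin (size B)) m → ℕ) → (∀ h h' → h ≈ h' → φ h ≡ φ' h') → ΣV m φ ≡ ΣV m φ'
  sum-all {m} m≤k φ φ' resp = ΣV-transfer 1≤k G (allFin m ∷ []) (whole-bag m≤k , UniqueP.allFin⁺ m , ([] , here refl , λ _ ()) , tt)
    (λ x → ∈-++⁺ˡ (∈-allFin x)) φ φ' (λ { h h' (l ∷ []) → resp h h' (all-linked m≤k h h' l) })

  module Fiber {m l : ℕ} (m≤k : m ≤ k) (l≤k : l ≤ k) (r₀ : Fin l) (idx : Vec (Fin m) l) {a : Vec (Fin (size A)) l} {b : Vec (Fin (size B)) l} (e : a ≈ b) where

    preimage : ∀ i → (∃ λ r → lookup idx r ≡ i) ⊎ (∀ r → lookup idx r ≢ i)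
    preimage i with FinP.any? (λ r → lookup idx r FinP.≟ i)
    ... | yes p = inj₁ p
    ... | no ¬p = inj₂ (λ r q → ¬p (r , q))

    -- A right inverse of `idx` on its image. Elsewhere `r₀` is a dummy, since the entries at those
    -- positions are summed over.
    section : Vec (Fin l) m
    section = Vec.tabulate (λ i → [ proj₁ , (λ _ → r₀) ]′ (preimage i))

    section-idx : ∀ r → lookup idx (lookup section (lookup idx r)) ≡ lookup idx r
    section-idx r = trans (cong (lookup idx) (VecP.lookup∘tabulate _ (lookup idx r))) (go (preimage (lookup idx r)))
      where
      go : ∀ p → lookup idx ([ proj₁ , (λ _ → r₀) ]′ p) ≡ lookup idx r
      go (inj₁ (r' , q)) = q
      go (inj₂ none) = ⊥-elim (none r refl)

    consistent : ∀ {q} (u : Vec (Fin q) l) v → v ⊙ idx ≡ u → (u ⊙ section) ⊙ idx ≡ u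
    consistent u v refl = vec-ext λ r → trans (lookup-⊙ (u ⊙ section) idx r) (trans (lookup-⊙ u section (lookup idx r))
      (trans (lookup-⊙ v idx _) (trans (cong (lookup v) (section-idx r)) (sym (lookup-⊙ v idx r)))))

    over : ∀ {q} (u : Vec (Fin q) l) (v : Vec (Fin q) m) → Dec (v ⊙ idx ≡ u)
    over u v = VecP.≡-dec FinP._≟_ (v ⊙ idx) u

    -- The fibre is non-empty exactly when `a ⊙ section` lies in it, an equality condition on `a`
    -- that transfers to `b`. A non-empty fibre consists of the completions of a partial map on the
    -- image of `idx`; this image acts as an earlier bag that is already linked.
    sum-over : (φ : Vec (Fin (size A)) m → ℕ) (φ' : Vec (Fin (size B)) m → ℕ) → (∀ h h' → h ≈ h' → φ h ≡ φ' h') →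
      ΣV m (λ v → [ ⌊ over a v ⌋ ] * φ v) ≡ ΣV m (λ v → [ ⌊ over b v ⌋ ] * φ' v)
    sum-over φ φ' resp with over a (a ⊙ section)
    ... | no bad = trans (ΣV-zero m _ (λ v → cong (λ z → [ z ] * φ v) (⌊⌋-false (over a v) (bad ∘ consistent a v))))
                   (sym (ΣV-zero m _ (λ v → cong (λ z → [ z ] * φ' v) (⌊⌋-false (over b v) (bad ∘ back ∘ consistent b v)))))
      where
      back : (b ⊙ section) ⊙ idx ≡ b → (a ⊙ section) ⊙ idx ≡ a
      back p = trans (⊙-⊙ a section idx) (trans (proj₂ (fixed-transfer e (section ⊙ idx) (Vec.allFin l))
        (trans (sym (⊙-⊙ b section idx)) (trans p (sym (⊙-id b))))) (⊙-id a))
    ... | yes good = trans (agreeing a good φ) (trans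
          (Bags.sum-transfer G φ φ' (allFin m ∷ []) (D ∷ []) (a ⊙ section) (b ⊙ section)
            (whole-bag m≤k , UniqueP.allFin⁺ m , (D , there (here refl) , λ _ x∈ → subst (_ ∈_) (ListP.++-identityʳ D) x∈) , tt)
            (linked ∷ []) (D≤k ∷ []) (λ { h h' (l ∷ _) → resp h h' (all-linked m≤k h h' l) }) (λ x → ∈-++⁺ˡ (∈-allFin x)))
          (sym (agreeing b forth φ')))
      where
      forth : (b ⊙ section) ⊙ idx ≡ b
      forth = trans (⊙-⊙ b section idx) (trans (proj₁ (fixed-transfer e (section ⊙ idx) (Vec.allFin l))
        (trans (sym (⊙-⊙ a section idx)) (trans good (sym (⊙-id a))))) (⊙-id b))
      D = List.map (lookup idx) (allFin l)
      D≤k : length D ≤ k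
      D≤k = subst (_≤ k) (sym (trans (ListP.length-map (lookup idx) (allFin l)) (ListP.length-tabulate {n = l} id))) l≤k
      linked : Bags.Linked G (a ⊙ section) (b ⊙ section) D
      linked = subst₂ _≈_ (sym (⊙-⊙ a section (fromList D))) (sym (⊙-⊙ b section (fromList D))) (rename l≤k D≤k e (section ⊙ fromList D))
      agreeing : ∀ {q} (u : Vec (Fin q) l) → (u ⊙ section) ⊙ idx ≡ u → (ψ : Vec (Fin q) m → ℕ) →
        ΣV m (λ v → [ ⌊ over u v ⌋ ] * ψ v) ≡ Agreement.sumAgreeing (D List.++ []) (u ⊙ section) ψ
      agreeing u eq ψ = ΣV-cong m λ v → cong (λ z → [ z ] * ψ v) (⌊⌋-cong (over u v) (Agreement.agree? (D List.++ []) (u ⊙ section) v)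
        (λ p → All.tabulate λ x∈ → case ∈-map⁻ (lookup idx) (subst (_ ∈_) (ListP.++-identityʳ D) x∈) of λ { (r , _ , refl) →
           trans (sym (lookup-⊙ (u ⊙ section) idx r)) (trans (cong (λ z → lookup z r) (trans eq (sym p))) (lookup-⊙ v idx r)) })
        (λ al → trans (vec-ext λ r → trans (lookup-⊙ v idx r) (trans (sym (All.lookup al (∈-++⁺ˡ (∈-map⁺ (lookup idx) (∈-allFin r))))) (sym (lookup-⊙ (u ⊙ section) idx r)))) eq))

    _≟M_ : DecidableEquality (Maybe (Colour m))
    _≟M_ = MaybeP.≡-dec _≟C_

    key : ∀ {q} → (Vec (Fin q) m → Colour m) → Vec (Fin q) l → Vec (Fin q) m → Maybe (Colour m)
    key col u v with over u v
    ... | yes _ = just (col v)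
    ... | no _ = nothing

    key-over : ∀ {q} (col : Vec (Fin q) m → Colour m) u v → v ⊙ idx ≡ u → key col u v ≡ just (col v)
    key-over col u v p with over u v
    ... | yes _ = refl
    ... | no ¬p = ⊥-elim (¬p p)

    key-just : ∀ {q} (col : Vec (Fin q) m → Colour m) u v {c} → key col u v ≡ just c → v ⊙ idx ≡ u × col v ≡ c
    key-just col u v e with over u v
    key-just col u v refl | yes p = p , refl

    count-just : ∀ {q} (col : Vec (Fin q) m → Colour m) u c → ΣV m (λ v → [ ⌊ key col u v ≟M just c ⌋ ]) ≡ ΣV m (λ v → [ ⌊ over u v ⌋ ] * [ ⌊ col v ≟C c ⌋ ])
    count-just col u c = ΣV-cong m λ v → indicator-× (key col u v ≟M just c) (over u v) (col v ≟C c) (key-just col u v)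
      (λ p q → trans (key-over col u v p) (cong just q))

    count-nothing : ∀ {q} (col : Vec (Fin q) m → Colour m) u → ΣV m (λ v → [ ⌊ key col u v ≟M nothing ⌋ ]) + ΣV m (λ v → [ ⌊ over u v ⌋ ] * 1) ≡ ΣV {q} m (λ _ → 1)
    count-nothing {q} col u = trans (sym (ΣV-+ m _ _)) (ΣV-cong m each)
      where
      each : ∀ v → [ ⌊ key col u v ≟M nothing ⌋ ] + [ ⌊ over u v ⌋ ] * 1 ≡ 1
      each v with over u v
      ... | yes _ = refl
      ... | no _ = refl

    counts : ∀ c → ΣV m (λ v → [ ⌊ key colA a v ≟M c ⌋ ]) ≡ ΣV m (λ v → [ ⌊ key colB b v ≟M c ⌋ ])
    counts (just c) = trans (count-just colA a c) (trans (sum-over _ _ (λ h h' eq → cong (λ z → [ ⌊ z ≟C c ⌋ ]) eq)) (sym (count-just colB b c)))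
    -- Outside the fibres the counts are complements, obtained by cancelling the fibres from the
    -- numbers of all tuples.
    counts nothing = +-cancelʳ-≡ (ΣV m (λ v → [ ⌊ over a v ⌋ ] * 1)) _ _ (trans (count-nothing colA a) (trans (sum-all m≤k _ _ (λ _ _ _ → refl))
      (trans (sym (count-nothing colB b)) (cong (ΣV m (λ v → [ ⌊ key colB b v ≟M nothing ⌋ ]) +_) (sym (sum-over (λ _ → 1) (λ _ → 1) (λ _ _ _ → refl)))))))

    Over : (Vec (Fin (size A)) m ↔ Vec (Fin (size B)) m) → Set
    Over f = ∀ v → (v ⊙ idx ≡ a → Inverse.to f v ⊙ idx ≡ b × v ≈ (Inverse.to f v)) × (Inverse.to f v ⊙ idx ≡ b → v ⊙ idx ≡ a)

    keys-over : ∀ f → (∀ v → key colA a v ≡ key colB b (Inverse.to f v)) → Over f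
    keys-over f p v = (λ q → let (x , y) = key-just colB b (Inverse.to f v) (trans (sym (p v)) (key-over colA a v q)) in x , sym y)
                    , (λ q → proj₁ (key-just colA a v (trans (p v) (key-over colB b _ q))))

    fiber : Σ (Vec (Fin (size A)) m ↔ Vec (Fin (size B)) m) λ f → ∀ v → key colA a v ≡ key colB b (Inverse.to f v)
    fiber = Keyed.matchVec _≟M_ m (key colA a) (key colB b) counts

  rainbow : ∀ {m} → m ≤ k → Σ (Vec (Fin (size A)) m ↔ Vec (Fin (size B)) m) λ f → ∀ v → v ≈ (Inverse.to f v)
  rainbow {m} m≤k = Keyed.matchVec _≟C_ m colA colB (λ c → sum-all m≤k _ _ (λ h h' e → cong (λ z → [ ⌊ z ≟C c ⌋ ]) e))

  pinned : ∀ {m} → m ≤ k → ∀ {a : Vec _ m} {b : Vec _ m} → a ≈ b → Σ (Vec (Fin (size A)) m ↔ Vec (Fin (size B)) m) λ f → Inverse.to f a ≡ b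
  pinned m≤k {a} {b} e = let (f , p) = rainbow m≤k ; (g , _ , q) = pin (VecP.≡-dec FinP._≟_) colA colB f p a b e in g , q

  -- A tuple can be both the first entry of one constraint and the projection in others with the
  -- same symbol. The bijection has to send `a` to `b` and respect the fibres at once; exchanging
  -- images with equal keys achieves both.
  pinned-fiber : ∀ {m} (m≤k : m ≤ k) (r₀ : Fin m) (idx : Vec (Fin m) m) {a : Vec _ m} {b : Vec _ m} (e : a ≈ b) →
    Σ (Vec (Fin (size A)) m ↔ Vec (Fin (size B)) m) λ f → Fiber.Over m≤k m≤k r₀ idx e f × Inverse.to f a ≡ b
  pinned-fiber {m} m≤k r₀ idx {a} {b} e = let (g , p , q) = pin (VecP.≡-dec FinP._≟_) (key colA a) (key colB b) (proj₁ fiber) (proj₂ fiber) a b same in g , keys-over g p , q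
    where
    open Fiber m≤k m≤k r₀ idx e
    id-transfer = fixed-transfer e idx (Vec.allFin m)
    same : key colA a a ≡ key colB b b
    same with over a a
    ... | yes p = trans (cong just e) (sym (key-over colB b b (trans (proj₁ id-transfer (trans p (sym (⊙-id a)))) (⊙-id b))))
    ... | no ¬p with over b b
    ... | yes q = ⊥-elim (¬p (trans (proj₂ id-transfer (trans q (sym (⊙-id b)))) (⊙-id a)))
    ... | no _ = refl

-- Iterated degrees from a stable colouring

module StarFromGame {σ : Signature} {k : ℕ} (1≤k : 1 ≤ k) (ar≤k : ∀ R → ar σ R ≤ k) {A B : Structure σ} (G : Game k A B) where
  open Game G
  open StableColouring 1≤k ar≤k G
  private
    module SA = StarOf k A
    module SB = StarOf k B
    A⋆ = star k A
    B⋆ = star k B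


  tupleLength-≤ : (s : StarSym σ k) → tupleLength k s ≤ k
  tupleLength-≤ (T-S j _) = FinP.toℕ<n j
  tupleLength-≤ (T-i j _ _) = FinP.toℕ<n j
  tupleLength-≤ (R-S R _) = ar≤k R
  tupleLength-≤ (R-i R _ _) = ar≤k R

  constOn-transfer : ∀ {m} (P : Subset m) {a b} → a ≈ b → constOn k A P a ≡ constOn k B P b
  constOn-transfer P {a} {b} e = T-⇔⇒≡
    (λ t → SB.constOn⁺ P b (λ i i' p p' → proj₁ (equal-entries e i i') (SA.constOn⁻ P a t i i' p p')))
    (λ t → SA.constOn⁺ P a (λ i i' p p' → proj₂ (equal-entries e i i') (SB.constOn⁻ P b t i i' p p')))

  valid-transfer : ∀ s {a b} → a ≈ b → SA.valid s a ≡ SB.valid s b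
  valid-transfer (T-S j P) e = constOn-transfer P e
  valid-transfer (T-i _ _ _) e = refl
  valid-transfer (R-S R P) e = cong₂ _∧_ (rel-transfer R e) (constOn-transfer P e)
  valid-transfer (R-i R _ _) e = rel-transfer R e

  data Link : StarU k A → StarU k B → Set where
    tuples      : ∀ {j a b} → a ≈ b → Link (inj₁ (j , a)) (inj₁ (j , b))
    constraints : ∀ {R t p t' p'} → t ≈ t' → Link (inj₂ (R , t , p)) (inj₂ (R , t' , p'))

  data VRel : Vertex A⋆ → Vertex B⋆ → Set where
    element    : ∀ {u w} → Link u w → VRel (inj₁ u) (inj₁ w)
    constraint : ∀ {s a b p p'} → a ≈ b → VRel (inj₂ (SA.conOf s a p)) (inj₂ (SB.conOf s b p'))

  entries-link : ∀ s {a b p p'} → a ≈ b → ∀ i → Link (lookup (SA.entries s a p) i) (lookup (SB.entries s b p') i)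
  entries-link (T-S j P) e zero = tuples e
  entries-link (T-i j j' idx) e zero = tuples e
  entries-link (T-i j j' idx) e (suc zero) = tuples (rename (FinP.toℕ<n j) (FinP.toℕ<n j') e idx)
  entries-link (R-S R P) e zero = constraints e
  entries-link (R-i R j idx) e zero = constraints e
  entries-link (R-i R j idx) e (suc zero) = tuples (rename (ar≤k R) (FinP.toℕ<n j) e idx)

  fixed : ∀ {m} {a : Vec _ m} {b : Vec _ m} → a ≈ b → (s : Vec (Fin m) m) → (a ≡ a ⊙ s → b ≡ b ⊙ s) × (b ≡ b ⊙ s → a ≡ a ⊙ s)
  fixed {a = a} {b} e s = let (f , g) = fixed-transfer e (Vec.allFin _) s in
    (λ p → trans (sym (⊙-id b)) (f (trans (⊙-id a) p))) , (λ p → trans (sym (⊙-id a)) (g (trans (⊙-id b) p)))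

  TupleEqual : ∀ (S : Structure σ) {j j'} → Vec (Fin (size S)) (len {k} j) → Vec (Fin (size S)) (len {k} j') → Set
  TupleEqual S {j} {j'} a a' = _≡_ {A = StarU k S} (inj₁ (j , a)) (inj₁ (j' , a'))

  tuple-injective : ∀ S {j : Fin k} {a a' : Vec (Fin (size S)) (len j)} → TupleEqual S {j} {j} a a' → a ≡ a'
  tuple-injective S eq = ,-injectiveʳ (SumP.inj₁-injective eq)

  tuple-index : ∀ S {j j' : Fin k} {a : Vec (Fin (size S)) (len j)} {a' : Vec (Fin (size S)) (len j')} → TupleEqual S {j} {j'} a a' → j ≡ j'
  tuple-index S eq = cong proj₁ (SumP.inj₁-injective eq)

  projection-fixed : ∀ j j' (idx : Vec (Fin (len j)) (len j')) {a b} → a ≈ b →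
    (TupleEqual A {j} {j'} a (a ⊙ idx) → TupleEqual B {j} {j'} b (b ⊙ idx)) × (TupleEqual B {j} {j'} b (b ⊙ idx) → TupleEqual A {j} {j'} a (a ⊙ idx))
  projection-fixed j j' idx e with j FinP.≟ j'
  ... | no j≢j' = (λ p → ⊥-elim (j≢j' (tuple-index A p))) , (λ p → ⊥-elim (j≢j' (tuple-index B p)))
  ... | yes refl = (λ p → cong (λ z → inj₁ (j , z)) (proj₁ (fixed e idx) (tuple-injective A p)))
                 , (λ p → cong (λ z → inj₁ (j , z)) (proj₂ (fixed e idx) (tuple-injective B p)))

  entries-equal : ∀ s {a b p p'} → a ≈ b → ∀ i i' →
    (lookup (SA.entries s a p) i ≡ lookup (SA.entries s a p) i' → lookup (SB.entries s b p') i ≡ lookup (SB.entries s b p') i') ×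
    (lookup (SB.entries s b p') i ≡ lookup (SB.entries s b p') i' → lookup (SA.entries s a p) i ≡ lookup (SA.entries s a p) i')
  entries-equal (T-S j P) e zero zero = (λ _ → refl) , (λ _ → refl)
  entries-equal (T-i j j' idx) e zero zero = (λ _ → refl) , (λ _ → refl)
  entries-equal (T-i j j' idx) e zero (suc zero) = projection-fixed j j' idx e
  entries-equal (T-i j j' idx) e (suc zero) zero = let (f , g) = projection-fixed j j' idx e in sym ∘ f ∘ sym , sym ∘ g ∘ sym
  entries-equal (T-i j j' idx) e (suc zero) (suc zero) = (λ _ → refl) , (λ _ → refl)
  entries-equal (R-S R P) e zero zero = (λ _ → refl) , (λ _ → refl)
  entries-equal (R-i R j idx) e zero zero = (λ _ → refl) , (λ _ → refl)
  entries-equal (R-i R j idx) e zero (suc zero) = (λ ()) , (λ ())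
  entries-equal (R-i R j idx) e (suc zero) zero = (λ ()) , (λ ())
  entries-equal (R-i R j idx) e (suc zero) (suc zero) = (λ _ → refl) , (λ _ → refl)

  module Meet (S : Structure σ) where
    open StarOf k S
    Meets : StarU k S → (s : StarSym σ k) → Vec (Fin (size S)) (tupleLength k s) → Fin (starArity s) → Set
    Meets u s a x = ∃ λ p → lookup (entries s a p) x ≡ u

    conOf-injective : ∀ s {a a' p p'} → conOf s a p ≡ conOf s a' p' → a ≡ a'
    conOf-injective (T-S j P) eq = ,-injectiveʳ (SumP.inj₁-injective (cong (λ c → head-entry k (proj₁ c) (proj₁ (proj₂ c))) eq))
    conOf-injective (T-i j j' idx) eq = ,-injectiveʳ (SumP.inj₁-injective (cong (λ c → head-entry k (proj₁ c) (proj₁ (proj₂ c))) eq))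
    conOf-injective (R-S R P) eq = cong proj₁ (,-injectiveʳ (SumP.inj₂-injective (cong (λ c → head-entry k (proj₁ c) (proj₁ (proj₂ c))) eq)))
    conOf-injective (R-i R j idx) eq = cong proj₁ (,-injectiveʳ (SumP.inj₂-injective (cong (λ c → head-entry k (proj₁ c) (proj₁ (proj₂ c))) eq)))

    conOf-irrelevant : ∀ s {a a' p p'} → a ≡ a' → conOf s a p ≡ conOf s a' p'
    conOf-irrelevant s {p = p} {p'} refl rewrite BoolP.T-irrelevant p p' = refl

  open Meet

  -- A bijection between the first tuples of constraints with symbol s that matches
  -- the constraints containing u with those containing w.
  record Matching (u : StarU k A) (w : StarU k B) (s : StarSym σ k) : Set where
    field
      tuple : Vec (Fin (size A)) (tupleLength k s) ↔ Vec (Fin (size B)) (tupleLength k s)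
    open Inverse tuple using (to) public
    field
      forward  : ∀ a x → Meets A u s a x → Meets B w s (to a) x
      backward : ∀ a x → Meets B w s (to a) x → Meets A u s a x
      linked   : ∀ a x → Meets A u s a x → a ≈ to a

  -- Constraints are paired symbol by symbol through their first tuples. Since meeting is preserved
  -- and reflected at every place, the position vectors in the labels agree.
  element-nbrs : ∀ {u w} → (∀ s → Matching u w s) → Σ (Nbr A⋆ (inj₁ u) ↔ Nbr B⋆ (inj₁ w)) λ f → ∀ e →
    label A⋆ (inj₁ u) e ≡ label B⋆ (inj₁ w) (Inverse.to f e) × VRel (target A⋆ (inj₁ u) e) (target B⋆ (inj₁ w) (Inverse.to f e))
  element-nbrs {u} {w} M = OneToOne.bijection matching , λ e → describe e (Inverse.to (OneToOne.bijection matching) e) (OneToOne.related matching e)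
    where
    module M s = Matching (M s)
    Same : Nbr A⋆ (inj₁ u) → Nbr B⋆ (inj₁ w) → Set
    Same (c , _) (c' , _) = ∃ λ s → ∃ λ a → ∃ λ p → ∃ λ p' → c ≡ SA.conOf s a p × c' ≡ SB.conOf s (M.to s a) p'
    occursAt : ∀ (S : Structure σ) {m} {v : StarU k S} (t : Vec (StarU k S) m) x → lookup t x ≡ v → T (occurs (star k S) v t)
    occursAt S t x refl = occurs⁺ (star k S) t x
    total : ∀ e → ∃ (Same e)
    total ((s , t , q) , o) with SA.view s t q
    ... | a , p , refl with occurs⁻ A⋆ (SA.entries s a p) o
    ... | x , h with M.forward s a x (p , h)
    ... | p' , h' = (SB.conOf s (M.to s a) p' , occursAt B (SB.entries s (M.to s a) p') x h') , s , a , p , p' , refl , refl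
    cototal : ∀ e → ∃ λ e' → Same e' e
    cototal ((s , t , q) , o) with SB.view s t q
    ... | b , p' , refl with Inverse.from (M.tuple s) b | Inverse.strictlyInverseˡ (M.tuple s) b
    ... | a | refl with occurs⁻ B⋆ (SB.entries s (M.to s a) p') o
    ... | x , h' with M.backward s a x (p' , h')
    ... | p , h = (SA.conOf s a p , occursAt A (SA.entries s a p) x h) , s , a , p , p' , refl , refl
    matching : OneToOne Same
    matching = record
      { total = total
      ; cototal = cototal
      ; unique = λ { (s , a , p , p' , e , e') (s₁ , a₁ , p₁ , p₁' , e₁ , e₁') → nbr-≡ B⋆ (unique s a p p' e e' s₁ a₁ p₁ p₁' e₁ e₁') }
      ; counique = λ { (s , a , p , p' , e , e') (s₁ , a₁ , p₁ , p₁' , e₁ , e₁') → nbr-≡ A⋆ (counique s a p p' e e' s₁ a₁ p₁ p₁' e₁ e₁') }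
      }
      where
      unique : ∀ {c c' c₁'} s a p p' → c ≡ SA.conOf s a p → c' ≡ SB.conOf s (M.to s a) p' → ∀ s₁ a₁ p₁ p₁' → c ≡ SA.conOf s₁ a₁ p₁ → c₁' ≡ SB.conOf s₁ (M.to s₁ a₁) p₁' → c' ≡ c₁'
      unique s a p p' e e' s₁ a₁ p₁ p₁' e₁ e₁' with trans (cong proj₁ (sym e)) (cong proj₁ e₁)
      ... | refl = trans e' (trans (conOf-irrelevant B s (cong (M.to s) (conOf-injective A s (trans (sym e) e₁)))) (sym e₁'))
      counique : ∀ {c c₁ c'} s a p p' → c ≡ SA.conOf s a p → c' ≡ SB.conOf s (M.to s a) p' → ∀ s₁ a₁ p₁ p₁' → c₁ ≡ SA.conOf s₁ a₁ p₁ → c' ≡ SB.conOf s₁ (M.to s₁ a₁) p₁' → c ≡ c₁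
      counique s a p p' e e' s₁ a₁ p₁ p₁' e₁ e₁' with trans (cong proj₁ (sym e')) (cong proj₁ e₁')
      ... | refl = trans e (trans (conOf-irrelevant A s (trans (sym (Inverse.strictlyInverseʳ (M.tuple s) a))
              (trans (cong (Inverse.from (M.tuple s)) (conOf-injective B s (trans (sym e') e₁'))) (Inverse.strictlyInverseʳ (M.tuple s) a₁)))) (sym e₁))
    describe : ∀ e e' → Same e e' → label A⋆ (inj₁ u) e ≡ label B⋆ (inj₁ w) e' × VRel (target A⋆ (inj₁ u) e) (target B⋆ (inj₁ w) e')
    describe (_ , o) _ (s , a , p , p' , refl , refl) = cong (s ,_) (vec-ext λ x →
        trans (lookup-positions A⋆ u (SA.entries s a p) x) (trans
          (⌊⌋-cong (starDec k A (lookup (SA.entries s a p) x) u) (starDec k B (lookup (SB.entries s (M.to s a) p') x) w) (ahead x) (behind x))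
          (sym (lookup-positions B⋆ w (SB.entries s (M.to s a) p') x))))
      , constraint (M.linked s a (proj₁ met) (p , proj₂ met))
      where
      met = occurs⁻ A⋆ (SA.entries s a p) o
      ahead : ∀ x → lookup (SA.entries s a p) x ≡ u → lookup (SB.entries s (M.to s a) p') x ≡ w
      ahead x h with M.forward s a x (p , h)
      ... | p₁ , h' rewrite BoolP.T-irrelevant p₁ p' = h'
      behind : ∀ x → lookup (SB.entries s (M.to s a) p') x ≡ w → lookup (SA.entries s a p) x ≡ u
      behind x h with M.backward s a x (p' , h)
      ... | p₁ , h' rewrite BoolP.T-irrelevant p₁ p = h'

  unmatched : ∀ {u w} s → (∀ a x → ¬ Meets A u s a x) → (∀ b x → ¬ Meets B w s b x) → Matching u w s
  unmatched s ¬A ¬B = record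
    { tuple = proj₁ (rainbow (tupleLength-≤ s))
    ; forward = λ a x h → ⊥-elim (¬A a x h)
    ; backward = λ a x h → ⊥-elim (¬B _ x h)
    ; linked = λ a x h → ⊥-elim (¬A a x h)
    }

  -- For symbols where `u` determines the first tuple, so that at most one constraint contains it, a
  -- bijection pinned at this tuple suffices.
  matched-once : ∀ {u w} s {a₀ b₀} → a₀ ≈ b₀ → (∀ {a x} → Meets A u s a x → a ≡ a₀) → (∀ {b x} → Meets B w s b x → b ≡ b₀) →
    (∀ x → (Meets A u s a₀ x → Meets B w s b₀ x) × (Meets B w s b₀ x → Meets A u s a₀ x)) → Matching u w s
  matched-once {u} {w} s {a₀} {b₀} e onlyA onlyB at = record
    { tuple = f
    ; forward = λ a x h → forward a x h (onlyA h)
    ; backward = λ a x h → backward a x h (onlyB h)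
    ; linked = λ a x h → linked a (onlyA h)
    }
    where
    f = proj₁ (pinned (tupleLength-≤ s) e)
    f-at = proj₂ (pinned (tupleLength-≤ s) e)
    forward : ∀ a x → Meets A u s a x → a ≡ a₀ → Meets B w s (Inverse.to f a) x
    forward _ x h refl = subst (λ b → Meets B w s b x) (sym f-at) (proj₁ (at x) h)
    backward : ∀ a x → Meets B w s (Inverse.to f a) x → Inverse.to f a ≡ b₀ → Meets A u s a x
    backward a x h q = subst (λ a → Meets A u s a x) (trans (sym (Inverse.strictlyInverseʳ f a₀))
        (trans (cong (Inverse.from f) (trans f-at (sym q))) (Inverse.strictlyInverseʳ f a)))
      (proj₂ (at x) (subst (λ b → Meets B w s b x) q h))
    linked : ∀ a → a ≡ a₀ → a ≈ Inverse.to f a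
    linked _ refl = subst (a₀ ≈_) (sym f-at) e

  constraint-index : ∀ {S : Structure σ} {R R' t t' p p'} → _≡_ {A = StarU k S} (inj₂ (R , t , p)) (inj₂ (R' , t' , p')) → R ≡ R'
  constraint-index eq = cong proj₁ (SumP.inj₂-injective eq)

  constraint-injective : ∀ {S : Structure σ} {R t t' p p'} → _≡_ {A = StarU k S} (inj₂ (R , t , p)) (inj₂ (R , t' , p')) → t ≡ t'
  constraint-injective eq = cong proj₁ (,-injectiveʳ (SumP.inj₂-injective eq))

  constraint-irrelevant : ∀ {S : Structure σ} {R t t' p p'} → t ≡ t' → _≡_ {A = StarU k S} (inj₂ (R , t , p)) (inj₂ (R , t' , p'))
  constraint-irrelevant {S} {R} {t} {p = p} {p'} refl = cong (λ z → inj₂ (R , t , z)) (BoolP.T-irrelevant p p')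

  -- Constraints are met through their first tuple, through its projection, or both.
  matched-T-i : ∀ j₀ {a b} → a ≈ b → ∀ j j' idx → Matching (inj₁ (j₀ , a)) (inj₁ (j₀ , b)) (T-i j j' idx)
  matched-T-i j₀ {a} {b} e j j' idx with j FinP.≟ j₀ | j' FinP.≟ j₀
  ... | no j≢ | no j'≢ = unmatched (T-i j j' idx)
        (λ { _ zero (_ , h) → j≢ (tuple-index A h) ; _ (suc zero) (_ , h) → j'≢ (tuple-index A h) })
        (λ { _ zero (_ , h) → j≢ (tuple-index B h) ; _ (suc zero) (_ , h) → j'≢ (tuple-index B h) })
  ... | yes refl | no j'≢ = matched-once (T-i j j' idx) e
        (λ { {x = zero} (_ , h) → tuple-injective A h ; {x = suc zero} (_ , h) → ⊥-elim (j'≢ (tuple-index A h)) })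
        (λ { {x = zero} (_ , h) → tuple-injective B h ; {x = suc zero} (_ , h) → ⊥-elim (j'≢ (tuple-index B h)) })
        (λ { zero → (λ _ → tt , refl) , (λ _ → tt , refl)
           ; (suc zero) → (λ { (_ , h) → ⊥-elim (j'≢ (tuple-index A h)) }) , (λ { (_ , h) → ⊥-elim (j'≢ (tuple-index B h)) }) })
  ... | no j≢ | yes refl = record
        { tuple = proj₁ F.fiber
        ; forward = λ { _ zero (_ , h) → ⊥-elim (j≢ (tuple-index A h))
                      ; v (suc zero) (_ , h) → tt , cong (λ z → inj₁ (j' , z)) (proj₁ (proj₁ (over v) (tuple-injective A h))) }
        ; backward = λ { _ zero (_ , h) → ⊥-elim (j≢ (tuple-index B h))
                       ; v (suc zero) (_ , h) → tt , cong (λ z → inj₁ (j' , z)) (proj₂ (over v) (tuple-injective B h)) }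
        ; linked = λ { _ zero (_ , h) → ⊥-elim (j≢ (tuple-index A h))
                     ; v (suc zero) (_ , h) → proj₂ (proj₁ (over v) (tuple-injective A h)) }
        }
    where
    module F = Fiber (FinP.toℕ<n j) (FinP.toℕ<n j') zero idx e
    over = F.keys-over (proj₁ F.fiber) (proj₂ F.fiber)
  ... | yes refl | yes refl = record
        { tuple = f
        ; forward = λ { v zero (_ , h) → tt , cong (λ z → inj₁ (j , z)) (trans (cong (Inverse.to f) (tuple-injective A h)) f-at)
                      ; v (suc zero) (_ , h) → tt , cong (λ z → inj₁ (j , z)) (proj₁ (proj₁ (over v) (tuple-injective A h))) }
        ; backward = λ { v zero (_ , h) → tt , cong (λ z → inj₁ (j , z)) (injective (trans (tuple-injective B h) (sym f-at)))
                       ; v (suc zero) (_ , h) → tt , cong (λ z → inj₁ (j , z)) (proj₂ (over v) (tuple-injective B h)) }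
        ; linked = λ { v zero (_ , h) → subst (λ z → z ≈ Inverse.to f z) (sym (tuple-injective A h)) (subst (a ≈_) (sym f-at) e)
                     ; v (suc zero) (_ , h) → proj₂ (proj₁ (over v) (tuple-injective A h)) }
        }
    where
    P = pinned-fiber (FinP.toℕ<n j) zero idx e
    f = proj₁ P
    over = proj₁ (proj₂ P)
    f-at = proj₂ (proj₂ P)
    injective : ∀ {x y} → Inverse.to f x ≡ Inverse.to f y → x ≡ y
    injective {x} {y} q = trans (sym (Inverse.strictlyInverseʳ f x)) (trans (cong (Inverse.from f) q) (Inverse.strictlyInverseʳ f y))

  matching : ∀ {u w} → Link u w → ∀ s → Matching u w s
  matching (tuples {j₀} {a} {b} e) (T-S j P) with j FinP.≟ j₀
  ... | no j≢ = unmatched (T-S j P) (λ { _ zero (_ , h) → j≢ (tuple-index A h) }) (λ { _ zero (_ , h) → j≢ (tuple-index B h) })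
  ... | yes refl = matched-once (T-S j P) e (λ { {x = zero} (_ , h) → tuple-injective A h }) (λ { {x = zero} (_ , h) → tuple-injective B h })
        (λ { zero → (λ { (p , _) → subst T (constOn-transfer P e) p , refl }) , (λ { (p , _) → subst T (sym (constOn-transfer P e)) p , refl }) })
  matching (tuples {j₀} e) (T-i j j' idx) = matched-T-i j₀ e j j' idx
  matching (tuples e) (R-S R P) = unmatched (R-S R P) (λ { _ zero (_ , ()) }) (λ { _ zero (_ , ()) })
  matching (tuples {j₀} {a} {b} e) (R-i R j idx) with j FinP.≟ j₀
  ... | no j≢ = unmatched (R-i R j idx) (λ { _ zero (_ , ()) ; _ (suc zero) (_ , h) → j≢ (tuple-index A h) }) (λ { _ zero (_ , ()) ; _ (suc zero) (_ , h) → j≢ (tuple-index B h) })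
  ... | yes refl = record
        { tuple = proj₁ F.fiber
        ; forward = λ { _ zero (_ , ()) ; v (suc zero) (p , h) → let (q , l) = proj₁ (over v) (tuple-injective A h) in
                          subst T (rel-transfer R l) p , cong (λ z → inj₁ (j , z)) q }
        ; backward = λ { _ zero (_ , ()) ; v (suc zero) (p , h) → let q = proj₂ (over v) (tuple-injective B h) in
                          subst T (sym (rel-transfer R (proj₂ (proj₁ (over v) q)))) p , cong (λ z → inj₁ (j , z)) q }
        ; linked = λ { _ zero (_ , ()) ; v (suc zero) (_ , h) → proj₂ (proj₁ (over v) (tuple-injective A h)) }
        }
    where
    module F = Fiber (ar≤k R) (FinP.toℕ<n j) zero idx e
    over = F.keys-over (proj₁ F.fiber) (proj₂ F.fiber)
  matching (constraints e) (T-S j P) = unmatched (T-S j P) (λ { _ zero (_ , ()) }) (λ { _ zero (_ , ()) })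
  matching (constraints e) (T-i j j' idx) = unmatched (T-i j j' idx) (λ { _ zero (_ , ()) ; _ (suc zero) (_ , ()) }) (λ { _ zero (_ , ()) ; _ (suc zero) (_ , ()) })
  matching (constraints {R₀} e) (R-S R P) with R FinP.≟ R₀
  ... | no R≢ = unmatched (R-S R P) (λ { _ zero (_ , h) → R≢ (constraint-index {A} h) }) (λ { _ zero (_ , h) → R≢ (constraint-index {B} h) })
  ... | yes refl = matched-once (R-S R P) e (λ { {x = zero} (_ , h) → constraint-injective {A} h }) (λ { {x = zero} (_ , h) → constraint-injective {B} h })
        (λ { zero → (λ { (p , _) → subst T (valid-transfer (R-S R P) e) p , constraint-irrelevant {B} refl })
                  , (λ { (p , _) → subst T (sym (valid-transfer (R-S R P) e)) p , constraint-irrelevant {A} refl }) })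
  matching (constraints {R₀} {p = r} {p' = r'} e) (R-i R j idx) with R FinP.≟ R₀
  ... | no R≢ = unmatched (R-i R j idx) (λ { _ zero (_ , h) → R≢ (constraint-index {A} h) ; _ (suc zero) (_ , ()) }) (λ { _ zero (_ , h) → R≢ (constraint-index {B} h) ; _ (suc zero) (_ , ()) })
  ... | yes refl = matched-once (R-i R j idx) e
        (λ { {x = zero} (_ , h) → constraint-injective {A} h ; {x = suc zero} (_ , ()) }) (λ { {x = zero} (_ , h) → constraint-injective {B} h ; {x = suc zero} (_ , ()) })
        (λ { zero → (λ _ → r' , refl) , (λ _ → r , refl) ; (suc zero) → (λ { (_ , ()) }) , (λ { (_ , ()) }) })

  move : ∀ {v w} → VRel v w → Σ (Nbr A⋆ v ↔ Nbr B⋆ w) λ f → ∀ e →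
     label A⋆ v e ≡ label B⋆ w (Inverse.to f e) × VRel (target A⋆ v e) (target B⋆ w (Inverse.to f e))
  move (element l) = element-nbrs (matching l)
  move (constraint {s} {a} {b} {p} {p'} e) = let (f , q) = constraint-nbrs s (SA.entries s a p) (SA.entries-related s a p) (SB.entries s b p') (SB.entries-related s b p')
                                                      (entries-equal s e) Link (entries-link s e)
    in f , λ x → proj₁ (q x) , element (proj₂ (q x))

  same-kind : ∀ {v w} → VRel v w → isElement A⋆ v ≡ isElement B⋆ w
  same-kind (element _) = refl
  same-kind (constraint _) = refl

  private
    Φ : ∀ {m} → m ≤ k → Vec (Fin (size A)) m ↔ Vec (Fin (size B)) m
    Φ m≤k = proj₁ (rainbow m≤k)

    Φ-linked : ∀ {m} (m≤k : m ≤ k) a → a ≈ Inverse.to (Φ m≤k) a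
    Φ-linked m≤k = proj₂ (rainbow m≤k)

    Φ-injective : ∀ {m} (m≤k : m ≤ k) {a a'} → Inverse.to (Φ m≤k) a ≡ Inverse.to (Φ m≤k) a' → a ≡ a'
    Φ-injective m≤k {a} {a'} q = trans (sym (Inverse.strictlyInverseʳ (Φ m≤k) a)) (trans (cong (Inverse.from (Φ m≤k)) q) (Inverse.strictlyInverseʳ (Φ m≤k) a'))

  -- Every vertex is parametrised by a tuple of length at most `k`, so one colour-preserving
  -- bijection for each length pairs them all.
  data Paired : Vertex A⋆ → Vertex B⋆ → Set where
    tuple : ∀ j a {b} → b ≡ Inverse.to (Φ (FinP.toℕ<n j)) a → Paired (inj₁ (inj₁ (j , a))) (inj₁ (inj₁ (j , b)))
    con   : ∀ R t {p t' p'} → t' ≡ Inverse.to (Φ (ar≤k R)) t → Paired (inj₁ (inj₂ (R , t , p))) (inj₁ (inj₂ (R , t' , p')))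
    cst   : ∀ s a p p' {c c'} → c ≡ SA.conOf s a p → c' ≡ SB.conOf s (Inverse.to (Φ (tupleLength-≤ s)) a) p' → Paired (inj₂ c) (inj₂ c')

  paired⇒VRel : ∀ {v w} → Paired v w → VRel v w
  paired⇒VRel (tuple j a refl) = element (tuples (Φ-linked (FinP.toℕ<n j) a))
  paired⇒VRel (con R t refl) = element (constraints (Φ-linked (ar≤k R) t))
  paired⇒VRel (cst s a p p' refl refl) = constraint (Φ-linked (tupleLength-≤ s) a)

  pairing : OneToOne Paired
  pairing = record { total = total ; cototal = cototal ; unique = unique ; counique = counique }
    where
    total : ∀ v → ∃ (Paired v)
    total (inj₁ (inj₁ (j , a))) = _ , tuple j a refl
    total (inj₁ (inj₂ (R , t , p))) = inj₁ (inj₂ (R , _ , subst T (rel-transfer R (Φ-linked (ar≤k R) t)) p)) , con R t refl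
    total (inj₂ (s , t , q)) with SA.view s t q
    ... | a , p , e = inj₂ (SB.conOf s (Inverse.to (Φ (tupleLength-≤ s)) a) p') , cst s a p p' e refl
      where p' = subst T (valid-transfer s (Φ-linked (tupleLength-≤ s) a)) p
    cototal : ∀ w → ∃ λ v → Paired v w
    cototal (inj₁ (inj₁ (j , b))) = _ , tuple j (Inverse.from (Φ (FinP.toℕ<n j)) b) (sym (Inverse.strictlyInverseˡ (Φ (FinP.toℕ<n j)) b))
    cototal (inj₁ (inj₂ (R , t' , p'))) = inj₁ (inj₂ (R , t , subst T (sym (rel-transfer R (subst (t ≈_) e (Φ-linked (ar≤k R) t)))) p')) , con R t (sym e)
      where
      t = Inverse.from (Φ (ar≤k R)) t'
      e = Inverse.strictlyInverseˡ (Φ (ar≤k R)) t'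
    cototal (inj₂ (s , t , q)) with SB.view s t q
    ... | b , p' , e = inj₂ (SA.conOf s a (subst T (sym (valid-transfer s (Φ-linked (tupleLength-≤ s) a))) p₁)) , cst s a _ p₁ refl (trans e (conOf-irrelevant B s (sym a↦b)))
      where
      a = Inverse.from (Φ (tupleLength-≤ s)) b
      a↦b = Inverse.strictlyInverseˡ (Φ (tupleLength-≤ s)) b
      p₁ = subst (T ∘ SB.valid s) (sym a↦b) p'
    unique : ∀ {v w w'} → Paired v w → Paired v w' → w ≡ w'
    unique (tuple j a refl) (tuple .j .a refl) = refl
    unique (con R t e) (con .R .t e') = cong inj₁ (constraint-irrelevant {B} (trans e (sym e')))
    unique (cst s a p p' e e') (cst s₁ a₁ p₁ p₁' e₁ e₁') with trans (cong proj₁ (sym e)) (cong proj₁ e₁)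
    ... | refl = cong inj₂ (trans e' (trans (conOf-irrelevant B s (cong (Inverse.to (Φ (tupleLength-≤ s))) (conOf-injective A s (trans (sym e) e₁)))) (sym e₁')))
    counique : ∀ {v v' w} → Paired v w → Paired v' w → v ≡ v'
    counique (tuple j a e) (tuple .j a' e') = cong (λ z → inj₁ (inj₁ (j , z))) (Φ-injective (FinP.toℕ<n j) (trans (sym e) e'))
    counique (con R t e) (con .R t₁ e') = cong inj₁ (constraint-irrelevant {A} (Φ-injective (ar≤k R) (trans (sym e) e')))
    counique (cst s a p p' e e') (cst s₁ a₁ p₁ p₁' e₁ e₁') with trans (cong proj₁ (sym e')) (cong proj₁ e₁')
    ... | refl = cong inj₂ (trans e (trans (conOf-irrelevant A s (Φ-injective (tupleLength-≤ s) (conOf-injective B s (trans (sym e') e₁')))) (sym e₁)))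

  star-equivalent : star k A ≡₁ star k B
  star-equivalent = OneToOne.bijection pairing , λ v j → Bisimulation.sameDeg VRel same-kind move j (paired⇒VRel (OneToOne.related pairing v))

-- Factor graphs of the structures themselves, for k = 1

module FlatFromGame {σ : Signature} (ar≤1 : ∀ R → ar σ R ≤ 1) {A B : Structure σ} (G : Game 1 A B) where
  open Game G
  open StableColouring ≤-refl ar≤1 G

  private
    Aᵍ = toGStr A
    Bᵍ = toGStr B


  data VRel : Vertex Aᵍ → Vertex Bᵍ → Set where
    element    : ∀ {c d} → (c ∷ []) ≈ (d ∷ []) → VRel (inj₁ c) (inj₁ d)
    constraint : ∀ {R t p t' p'} → t ≈ t' → VRel (inj₂ (R , t , p)) (inj₂ (R , t' , p'))

  -- Writing a tuple as `replicate` treats the arities 0 and 1 alike, without a case distinction on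
  -- `ar σ R`.
  constant : ∀ {X : Set} {m} → m ≤ 1 → (t : Vec X m) → ∀ {i x} → lookup t i ≡ x → t ≡ Vec.replicate m x
  constant (s≤s z≤n) (x ∷ []) {zero} refl = refl

  replicate-⊙ : ∀ {X : Set} m (c : X) → (c ∷ []) ⊙ Vec.replicate m zero ≡ Vec.replicate m c
  replicate-⊙ m c = VecP.map-replicate (lookup (c ∷ [])) zero m

  replicate-linked : ∀ {m c d} → m ≤ 1 → (c ∷ []) ≈ (d ∷ []) → Vec.replicate m c ≈ Vec.replicate m d
  replicate-linked {m} {c} {d} m≤1 e = subst₂ _≈_ (replicate-⊙ m c) (replicate-⊙ m d) (rename ≤-refl m≤1 e (Vec.replicate m zero))

  element-nbrs : ∀ {c d} → (c ∷ []) ≈ (d ∷ []) → Σ (Nbr Aᵍ (inj₁ c) ↔ Nbr Bᵍ (inj₁ d)) λ f → ∀ e →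
    label Aᵍ (inj₁ c) e ≡ label Bᵍ (inj₁ d) (Inverse.to f e) × VRel (target Aᵍ (inj₁ c) e) (target Bᵍ (inj₁ d) (Inverse.to f e))
  element-nbrs {c} {d} e = OneToOne.bijection matching , λ x → describe x (Inverse.to (OneToOne.bijection matching) x) (OneToOne.related matching x)
    where
    -- With arity at most 1 the symbol alone determines a neighbour of `c`: its tuple has `c` as the
    -- only entry.
    Same : Nbr Aᵍ (inj₁ c) → Nbr Bᵍ (inj₁ d) → Set
    Same x y = proj₁ (proj₁ x) ≡ proj₁ (proj₁ y)
    tuple-of : ∀ (S : Structure σ) {v} R (t : Vec (Fin (size S)) (ar σ R)) → T (occurs (toGStr S) v t) → t ≡ Vec.replicate _ v
    tuple-of S R t o = constant (ar≤1 R) t (proj₂ (occurs⁻ (toGStr S) t o))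
    occurs-replicate : ∀ (S : Structure σ) v m → Fin m → T (occurs (toGStr S) v (Vec.replicate m v))
    occurs-replicate S v m i = subst (λ z → T (occurs (toGStr S) z (Vec.replicate m v))) (VecP.lookup-replicate i v) (occurs⁺ (toGStr S) (Vec.replicate m v) i)
    same-nbr : ∀ (S : Structure σ) {v} (x y : Nbr (toGStr S) (inj₁ v)) → proj₁ (proj₁ x) ≡ proj₁ (proj₁ y) → x ≡ y
    same-nbr S ((R , t , p) , o) ((.R , t' , p') , o') refl = nbr-≡ (toGStr S) (con-≡ (toGStr S) refl (trans (tuple-of S R t o) (sym (tuple-of S R t' o'))))
    matching : OneToOne Same
    matching = record
      { total = λ { ((R , t , p) , o) → ((R , Vec.replicate _ d , subst T (trans (cong (rel A R) (tuple-of A R t o)) (rel-transfer R (replicate-linked (ar≤1 R) e))) p)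
                                        , occurs-replicate B d (ar σ R) (proj₁ (occurs⁻ Aᵍ t o))) , refl }
      ; cototal = λ { ((R , t , p) , o) → ((R , Vec.replicate _ c , subst T (trans (cong (rel B R) (tuple-of B R t o)) (sym (rel-transfer R (replicate-linked (ar≤1 R) e)))) p)
                                        , occurs-replicate A c (ar σ R) (proj₁ (occurs⁻ Bᵍ t o))) , refl }
      ; unique = λ {_} {y} {y'} q q' → same-nbr B y y' (trans (sym q) q')
      ; counique = λ {x} {x'} q q' → same-nbr A x x' (trans q (sym q'))
      }
    hit : ∀ (S : Structure σ) {v} R (t : Vec (Fin (size S)) (ar σ R)) → T (occurs (toGStr S) v t) → ∀ i → lookup (positions (toGStr S) v t) i ≡ true
    hit S {v} R t o i = trans (lookup-positions (toGStr S) v t i) (⌊⌋-true (lookup t i FinP.≟ v)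
      (trans (cong (λ z → lookup z i) (tuple-of S R t o)) (VecP.lookup-replicate i v)))
    describe : ∀ x y → Same x y → label Aᵍ (inj₁ c) x ≡ label Bᵍ (inj₁ d) y × VRel (inj₂ (proj₁ x)) (inj₂ (proj₁ y))
    describe ((R , t , p) , o) ((.R , t' , p') , o') refl = cong (R ,_) (vec-ext (λ i → trans (hit A R t o i) (sym (hit B R t' o' i))))
      , constraint (subst₂ _≈_ (sym (tuple-of A R t o)) (sym (tuple-of B R t' o')) (replicate-linked (ar≤1 R) e))

  move : ∀ {v w} → VRel v w → Σ (Nbr Aᵍ v ↔ Nbr Bᵍ w) λ f → ∀ e →
     label Aᵍ v e ≡ label Bᵍ w (Inverse.to f e) × VRel (target Aᵍ v e) (target Bᵍ w (Inverse.to f e))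
  move (element e) = element-nbrs e
  move (constraint {R} {t} {p} {t'} {p'} e) = let (f , q) = constraint-nbrs R t p t' p' (equal-entries e) (λ c d → (c ∷ []) ≈ (d ∷ []))
                                                      (λ i → rename (ar≤1 R) ≤-refl e (i ∷ []))
    in f , λ x → proj₁ (q x) , element (proj₂ (q x))

  same-kind : ∀ {v w} → VRel v w → isElement Aᵍ v ≡ isElement Bᵍ w
  same-kind (element _) = refl
  same-kind (constraint _) = refl

  private
    first = extend {a = []} {b = []} ≤-refl start
    π = proj₁ first

    Φ : ∀ R → Vec (Fin (size A)) (ar σ R) ↔ Vec (Fin (size B)) (ar σ R)
    Φ R = proj₁ (rainbow (ar≤1 R))

    Φ-linked : ∀ R t → t ≈ Inverse.to (Φ R) t
    Φ-linked R = proj₂ (rainbow (ar≤1 R))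

  data Paired : Vertex Aᵍ → Vertex Bᵍ → Set where
    elem : ∀ c {d} → d ≡ π ⟨$⟩ʳ c → Paired (inj₁ c) (inj₁ d)
    con  : ∀ R t {p t' p'} → t' ≡ Inverse.to (Φ R) t → Paired (inj₂ (R , t , p)) (inj₂ (R , t' , p'))

  paired⇒VRel : ∀ {v w} → Paired v w → VRel v w
  paired⇒VRel (elem c refl) = element (proj₂ first c)
  paired⇒VRel (con R t refl) = constraint (Φ-linked R t)

  pairing : OneToOne Paired
  pairing = record { total = total ; cototal = cototal ; unique = unique ; counique = counique }
    where
    total : ∀ v → ∃ (Paired v)
    total (inj₁ c) = _ , elem c refl
    total (inj₂ (R , t , p)) = inj₂ (R , _ , subst T (rel-transfer R (Φ-linked R t)) p) , con R t refl
    cototal : ∀ w → ∃ λ v → Paired v w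
    cototal (inj₁ d) = _ , elem (π ⟨$⟩ˡ d) (sym (inverseʳ π))
    cototal (inj₂ (R , t' , p')) = inj₂ (R , t , subst T (sym (rel-transfer R (subst (t ≈_) e (Φ-linked R t)))) p') , con R t (sym e)
      where
      t = Inverse.from (Φ R) t'
      e = Inverse.strictlyInverseˡ (Φ R) t'
    unique : ∀ {v w w'} → Paired v w → Paired v w' → w ≡ w'
    unique (elem c refl) (elem .c refl) = refl
    unique (con R t e) (con .R .t e') = cong inj₂ (con-≡ Bᵍ refl (trans e (sym e')))
    counique : ∀ {v v' w} → Paired v w → Paired v' w → v ≡ v'
    counique (elem c e) (elem c' e') = cong inj₁ (trans (sym (Inverse.strictlyInverseʳ π c)) (trans (cong (π ⟨$⟩ˡ_) (trans (sym e) e')) (Inverse.strictlyInverseʳ π c')))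
    counique (con R t e) (con .R t₁ e') = cong inj₂ (con-≡ Aᵍ refl (trans (sym (Inverse.strictlyInverseʳ (Φ R) t))
      (trans (cong (Inverse.from (Φ R)) (trans (sym e) e')) (Inverse.strictlyInverseʳ (Φ R) t₁))))

  flat-equivalent : toGStr A ≡₁ toGStr B
  flat-equivalent = OneToOne.bijection pairing , λ v j → Bisimulation.sameDeg VRel same-kind move j (paired⇒VRel (OneToOne.related pairing v))

-- The equivalences

arity-bound : ∀ σ {k} → maxArity σ ≤ k → ∀ R → ar σ R ≤ k
arity-bound σ {k} bound R = ≤-trans (go (allFin _) (∈-allFin R)) bound
  where
  go : ∀ Rs {R} → R ∈ Rs → ar σ R ≤ List.foldr (λ R m → ar σ R ⊔ m) 0 Rs
  go (R ∷ Rs) (here refl) = m≤m⊔n _ _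
  go (_ ∷ Rs) (there R∈) = ≤-trans (go Rs R∈) (m≤n⊔m _ _)

module _ (σ : Signature) {k' : ℕ} (ar≤k : ∀ R → ar σ R ≤ suc k') (A B : Structure σ) where
  private
    k = suc k'

  hom⇒game : ((X : Structure σ) → TreewidthLess X k → hom X A ≡ hom X B) → Game k A B
  hom⇒game h = Refine.game k (Canonical.count {σ} {k}) (λ x y x≢y → tt , x≢y) A B (Canonical.hom⇒closed ar≤k (s≤s z≤n) A B h)

  sameCk⇒game : SameCk k A B → Game k A B
  sameCk⇒game s = Refine.game k threshold threshold-separates A B (sameCk⇒closed zero A B s)

game⇒≡ : ∀ σ k → 1 ≤ k → (∀ R → ar σ R ≤ k) → {A B : Structure σ} → Game k A B → ≡[ k ] A B
game⇒≡ σ 1 _ ar≤k G = FlatFromGame.flat-equivalent ar≤k G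
game⇒≡ σ (suc (suc k)) 1≤k ar≤k G = StarFromGame.star-equivalent 1≤k ar≤k G

≡⇒rounds : ∀ σ k → 1 ≤ k → (∀ R → ar σ R ≤ k) → {A B : Structure σ} → ≡[ k ] A B → RoundGame k A B
≡⇒rounds σ 1 _ ar≤k e = FlatRounds.flatRounds ar≤k e
≡⇒rounds σ (suc (suc k)) 1≤k ar≤k e = StarRounds.starRounds 1≤k ar≤k e

theorem7p6 : (σ : Signature) (k : ℕ) → 1 ≤ k → maxArity σ ≤ k →
    (A B : Structure σ) →
    (≡[ k ] A B ⇔ ((X : Structure σ) → TreewidthLess X k → hom X A ≡ hom X B))
    × (≡[ k ] A B ⇔ SameCk k A B)
theorem7p6 σ k@(suc _) 1≤k bound A B =
    -- Homomorphism counts need one colouring for all rounds. From (1) it is obtained by first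
    -- passing to the logic and refining there.
    mk⇔ (λ e → game⇒hom 1≤k (sameCk⇒game σ ar≤k A B (logic e))) (λ h → game⇒≡ σ k 1≤k ar≤k (hom⇒game σ ar≤k A B h))
  , mk⇔ logic (λ s → game⇒≡ σ k 1≤k ar≤k (sameCk⇒game σ ar≤k A B s))
  where
  ar≤k = arity-bound σ bound
  logic : ≡[ k ] A B → SameCk k A B
  logic e = Evaluation.game⇒sameCk ar≤k (≡⇒rounds σ k 1≤k ar≤k e)
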